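{- Let $G$ be a finite abelian group and let $\varepsilon > 0$. Then there exists $C=C(G,\varepsilon)$ such that for every positive integer $n$, if $Z_0 \subset G$ is not contained in any strict coset in $G$ and $E,F$ are subsets of $G^n$ with $(E+F) \cap Z_0^n = \emptyset$, then there exist $I \subset [n]$ with $0<|I|<C$ and subsets $E',F'$ of $G^{I}$ satisfying \[ |E \setminus (E' \times G^{I^c})| \le \varepsilon |G^n|, \quad |F \setminus (F' \times G^{I^c})| \le \varepsilon |G^n|, \quad (E'+F') \cap Z_0^I = \emptyset. \]
   Context: A strict coset in $G$ is a set $H+\{x\}$ where $H$ is a subgroup of $G$ with $H\neq G$ and $x\in G$. $[n]=\{1,\dots,n\}$, $I^c=[n]\setminus I$. For $E'\subset G^I$, $E'\times G^{I^c}$ denotes the set of $x\in G^n$ with $(x_i)_{i\in I}\in E'$. $Z_0^I$ is the set of elements of $G^I$ with all coordinates in $Z_0$; sums of sets are Minkowski sums. -}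

module Defs where

open import Data.Nat using (ℕ; zero; suc)
open import Data.Fin using (Fin; zero; suc)
open import Data.Fin.Subset using (Subset; _∈_)
open import Data.List using (List; []; _∷_; [_]; map; concatMap; length; filterᵇ; allFin)
open import Data.Bool using (Bool; true; false; _∧_; not)
open import Data.Product using (Σ; ∃; _×_; _,_)
open import Data.Empty using (⊥)
open import Relation.Nullary using (¬_)
open import Relation.Binary.PropositionalEquality using (_≡_)

-- A finite abelian group G is modelled (up to isomorphism) as an abelian group
-- structure on Fin m; the operations _⊕_ are passed explicitly.
-- Subsets of finite sets are Bool-valued characteristic functions.

Vecᴳ : ℕ → ℕ → Set
Vecᴳ m n = Fin n → Fin m

Vecᴵ : ℕ → {n : ℕ} → Subset n → Set
Vecᴵ m {n} I = Σ (Fin n) (λ i → i ∈ I) → Fin m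

restrict : ∀ {m n} (I : Subset n) → Vecᴳ m n → Vecᴵ m I
restrict I x (i , _) = x i

consF : ∀ {m n} → Fin m → Vecᴳ m n → Vecᴳ m (suc n)
consF a f zero = a
consF a f (suc i) = f i

allVecs : (m n : ℕ) → List (Vecᴳ m n)
allVecs m zero = [ (λ ()) ]
allVecs m (suc n) = concatMap (λ a → map (consF a) (allVecs m n)) (allFin m)

card : ∀ m n → (Vecᴳ m n → Bool) → ℕ
card m n S = length (filterᵇ S (allVecs m n))

IsSubgroup : ∀ {m} → (Fin m → Fin m → Fin m) → Fin m → (Fin m → Fin m) → (Fin m → Bool) → Set
IsSubgroup _⊕_ e ⊝ H =
  (H e ≡ true)
  × (∀ a b → H a ≡ true → H b ≡ true → H (a ⊕ b) ≡ true)
  × (∀ a → H a ≡ true → H (⊝ a) ≡ true)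

InStrictCoset : ∀ {m} → (Fin m → Fin m → Fin m) → Fin m → (Fin m → Fin m) → (Fin m → Bool) → Set
InStrictCoset {m} _⊕_ e ⊝ Z =
  Σ (Fin m → Bool) λ H →
    IsSubgroup _⊕_ e ⊝ H
    × (∃ λ g → H g ≡ false)
    × (∃ λ x → ∀ z → Z z ≡ true → ∃ λ h → H h ≡ true × z ≡ h ⊕ x)

SumAvoids : ∀ {m} {J : Set} → (Fin m → Fin m → Fin m) → ((J → Fin m) → Bool) → ((J → Fin m) → Bool) → (Fin m → Bool) → Set
SumAvoids _⊕_ A B Z =
  ¬ (∃ λ a → ∃ λ b → A a ≡ true × B b ≡ true × (∀ j → Z (a j ⊕ b j) ≡ true))

{-# OPTIONS --safe #-}

-- Fix z₀ ∈ Z₀ and put Z = z₀ - Z₀ ∋ 0, so that E is disjoint from z₀ - (F + Zⁿ). For a random set W of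
-- coordinates (each included with probability q), 1[x ∈ F + Z^W] is monotone in W, and since Z generates G
-- every x-influence is at most |G| times the W-influence. By Russo's formula the total influence is bounded
-- for some q, so Friedgut's junta theorem (hypercontractivity) approximates the indicator by a junta on few
-- coordinates J. An energy decrement makes J robust: the approximation persists when W is replaced by W \ J.
-- Let u_J ∈ F′ when, conditionally on x_J = u_J, x lies in F + Z^{W \ J} with probability at least 1 - ε.
-- Robustness says that F is almost contained in F′ × G^{Jᶜ}. If y_J + u_J ∈ Z₀^J with u_J ∈ F′, then for
-- almost no extension y of y_J does y lie in E, so such y_J can be excluded from E′.
module Submission where

open import Defs
open import Data.Nat using (ℕ; _<_; _≤_; _^_)
open import Data.Fin using (Fin)
open import Data.Fin.Subset using (Subset; ∣_∣)
open import Data.Bool using (Bool; _∧_; not)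
open import Data.Product using (Σ; ∃; _×_; _,_)
open import Data.Integer using (+_)
open import Data.Rational using (ℚ; _/_; _*_; 0ℚ) renaming (_≤_ to _≤ℚ_; _<_ to _<ℚ_)
open import Relation.Nullary using (¬_)
open import Algebra.Structures using (IsAbelianGroup)
open import Relation.Binary.PropositionalEquality using (_≡_)

import Algebra.Properties.CommutativeMonoid.Sum as SumProperties
open import Data.Bool using (true; false; _∨_)
import Data.Bool.Properties as Boolₚ
open import Data.Empty using (⊥; ⊥-elim)
open import Data.Fin using (zero; suc)
import Data.Fin as Fin
import Data.Fin.Permutation as Perm
import Data.Fin.Subset.Properties as Subsetₚ
import Data.Fin.Properties as Finₚ
open import Data.Fin.Subset using (⁅_⁆) renaming (_∈_ to _∈ₛ_)
open import Data.List using (List; []; _∷_; map; concatMap; length; filterᵇ; allFin)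
import Data.List.Properties as Listₚ
open import Data.Nat using (zero; suc; z≤n; s≤s)
import Data.Nat as ℕ
import Data.Nat.Properties as ℕₚ
import Data.Integer as ℤ
import Data.Integer.Properties as ℤₚ
open import Data.Product using (proj₁; proj₂)
open import Data.Rational using (1ℚ; _+_; _-_; -_; 1/_; positive; nonNegative)
import Data.Rational as ℚ
import Data.Rational.Properties as ℚₚ
import Data.Rational.Unnormalised as ℚᵘ
import Data.Rational.Unnormalised.Properties as ℚᵘₚ
open import Data.Sum using (_⊎_; inj₁; inj₂)
open import Data.Vec using (Vec; []; _∷_; replicate; zipWith; lookup; tabulate; _[_]≔_; here)
import Data.Vec as Vec
import Data.Vec.Properties as Vecₚ
open import Function using (_∘_)
open import Relation.Binary.PropositionalEquality using (refl; sym; trans; cong; cong₂; subst; module ≡-Reasoning)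
open import Relation.Nullary using (Dec; yes; no; does)
open import Relation.Nullary.Decidable using (dec⇒maybe; dec-true; _×-dec_; _→-dec_)
open import Tactic.RingSolver using (solve-∀)
open import Tactic.RingSolver.Core.AlmostCommutativeRing using (AlmostCommutativeRing; fromCommutativeRing)

-- Probability is done over `ℚ`, where derivatives and real exponents do not exist. Russo's formula
-- therefore becomes a finite-difference inequality along a fine grid of rates q, and strong noise
-- is reached by repeated squaring, so that only exponents 2^r occur. Rates stay in [¼, ¾]: every
-- atom of a coordinate then has mass at least 1/(4|G|), and one hypercontractivity constant serves
-- all q. The obstacle in the energy argument is that the rate with low total influence depends on
-- the current J, so the density at one fixed rate is not a usable potential. The range of rates is
-- cut into cells, and the rate is taken inside a cell over which the density rises little;
-- monotonicity in q then carries a comparison at the lower boundary of the cell over to that rate.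
-- Coordinates in J no longer respond to their bits; they are counted as influential outright, at a
-- cost of at most |J|.

-- Inequalities between rational numbers

ℚ-ring : AlmostCommutativeRing _ _
ℚ-ring = fromCommutativeRing ℚₚ.+-*-commutativeRing (λ x → dec⇒maybe (0ℚ ℚₚ.≟ x))

0≤+ : ∀ {x y} → 0ℚ ≤ℚ x → 0ℚ ≤ℚ y → 0ℚ ≤ℚ x + y
0≤+ p q = ℚₚ.+-mono-≤ p q

0≤* : ∀ {x y} → 0ℚ ≤ℚ x → 0ℚ ≤ℚ y → 0ℚ ≤ℚ x * y
0≤* {x} {y} p q =
  ℚₚ.nonNegative⁻¹ _ {{ℚₚ.nonNeg*nonNeg⇒nonNeg x {{nonNegative p}} y {{nonNegative q}}}}

0<* : ∀ {x y} → 0ℚ <ℚ x → 0ℚ <ℚ y → 0ℚ <ℚ x * y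
0<* {x} {y} p q = ℚₚ.positive⁻¹ _ {{ℚₚ.pos*pos⇒pos x {{positive p}} y {{positive q}}}}

≤⇒0≤ : ∀ {x y} → x ≤ℚ y → 0ℚ ≤ℚ y - x
≤⇒0≤ {x} {y} p = subst (_≤ℚ y - x) (ℚₚ.+-inverseʳ x) (ℚₚ.+-monoˡ-≤ (- x) p)

0≤⇒≤ : ∀ {x y} → 0ℚ ≤ℚ y - x → x ≤ℚ y
0≤⇒≤ {x} {y} p =
  ℚₚ.≤-trans (ℚₚ.≤-reflexive (sym (ℚₚ.+-identityˡ x)))
    (ℚₚ.≤-trans (ℚₚ.+-monoˡ-≤ x p) (ℚₚ.≤-reflexive (y-x+x x y)))
  where
  y-x+x : ∀ x y → y - x + x ≡ y
  y-x+x = solve-∀ ℚ-ring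

-- Inequalities are proved by exhibiting the difference as a manifestly nonnegative expression.
certify : ∀ {x y c} → y - x ≡ c → 0ℚ ≤ℚ c → x ≤ℚ y
certify e p = 0≤⇒≤ (subst (0ℚ ≤ℚ_) (sym e) p)

0≤square : ∀ x → 0ℚ ≤ℚ x * x
0≤square x with ℚₚ.≤-total 0ℚ x
... | inj₁ p = 0≤* p p
... | inj₂ p = subst (0ℚ ≤ℚ_) (neg-square x) (0≤* (≤⇒0≤ p) (≤⇒0≤ p))
  where
  neg-square : ∀ x → (0ℚ - x) * (0ℚ - x) ≡ x * x
  neg-square = solve-∀ ℚ-ring

*-mono-≤ : ∀ {x y u v} → 0ℚ ≤ℚ x → x ≤ℚ y → 0ℚ ≤ℚ u → u ≤ℚ v → x * u ≤ℚ y * v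
*-mono-≤ {x} {y} {u} {v} p q r s =
  certify (lemma x y u v) (0≤+ (0≤* (≤⇒0≤ q) (ℚₚ.≤-trans r s)) (0≤* p (≤⇒0≤ s)))
  where
  lemma : ∀ x y u v → y * v - x * u ≡ (y - x) * v + x * (v - u)
  lemma = solve-∀ ℚ-ring

*-monoˡ : ∀ {u v} x → 0ℚ ≤ℚ x → u ≤ℚ v → x * u ≤ℚ x * v
*-monoˡ x p q = ℚₚ.*-monoˡ-≤-nonNeg x {{nonNegative p}} q

*-cancelˡ : ∀ {u v} x → 0ℚ <ℚ x → x * u ≤ℚ x * v → u ≤ℚ v
*-cancelˡ x p q = ℚₚ.*-cancelˡ-≤-pos x {{positive p}} q

square-cancel-≤ : ∀ {x y} → 0ℚ ≤ℚ y → x * x ≤ℚ y * y → x ≤ℚ y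
square-cancel-≤ {x} {y} p q with x ℚₚ.≤? y
... | yes r = r
... | no ¬r = ⊥-elim (ℚₚ.<-irrefl refl (ℚₚ.<-≤-trans y²<x² q))
  where
  y<x : y <ℚ x
  y<x = ℚₚ.≰⇒> ¬r
  y²<x² : y * y <ℚ x * x
  y²<x² = ℚₚ.≤-<-trans (*-monoˡ y p (ℚₚ.<⇒≤ y<x))
    (ℚₚ.*-monoˡ-<-pos x {{positive (ℚₚ.≤-<-trans p y<x)}} y<x)

2ℚ 3ℚ 4ℚ 8ℚ : ℚ
2ℚ = + 2 / 1
3ℚ = + 3 / 1
4ℚ = + 4 / 1
8ℚ = + 8 / 1

recip : ∀ x → 0ℚ <ℚ x → ∃ λ y → 0ℚ <ℚ y × x * y ≡ 1ℚ
recip x p = 1/x , ℚₚ.positive⁻¹ _ {{ℚₚ.1/pos⇒pos x {{positive p}}}} , ℚₚ.*-inverseʳ x {{nz}}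
  where
  nz = ℚₚ.pos⇒nonZero x {{positive p}}
  1/x = (1/ x) {{nz}}

-- Abstract, so that conversion checking never runs into the gcd computations of _/_.
abstract
  fromℕ : ℕ → ℚ
  fromℕ n = + n / 1

  fromℕ-def : ∀ n → fromℕ n ≡ + n / 1
  fromℕ-def n = refl

  fromℕ-+ : ∀ a b → fromℕ (a ℕ.+ b) ≡ fromℕ a + fromℕ b
  fromℕ-+ a b = ℚₚ.toℚᵘ-injective (begin
    ℚ.toℚᵘ (fromℕ (a ℕ.+ b))                 ≈⟨ ℚₚ.toℚᵘ-fromℚᵘ (ℚᵘ.mkℚᵘ (+ (a ℕ.+ b)) 0) ⟩
    ℚᵘ.mkℚᵘ (+ (a ℕ.+ b)) 0                  ≈⟨ ℚᵘ.*≡* (cong (ℤ._* + 1) (cong₂ ℤ._+_ (sym (ℤₚ.*-identityʳ (+ a))) (sym (ℤₚ.*-identityʳ (+ b))))) ⟩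
    ℚᵘ.mkℚᵘ (+ a) 0 ℚᵘ.+ ℚᵘ.mkℚᵘ (+ b) 0     ≈⟨ ℚᵘₚ.+-cong (ℚₚ.toℚᵘ-fromℚᵘ (ℚᵘ.mkℚᵘ (+ a) 0)) (ℚₚ.toℚᵘ-fromℚᵘ (ℚᵘ.mkℚᵘ (+ b) 0)) ⟨
    ℚ.toℚᵘ (fromℕ a) ℚᵘ.+ ℚ.toℚᵘ (fromℕ b)   ≈⟨ ℚₚ.toℚᵘ-homo-+ (fromℕ a) (fromℕ b) ⟨
    ℚ.toℚᵘ (fromℕ a + fromℕ b)               ∎)
    where open ℚᵘₚ.≃-Reasoning

  archimedean : ∀ x → ∃ λ n → x ≤ℚ fromℕ n
  archimedean x@(ℚ.mkℚ n d _) = ℤ.∣ n ∣ , ℚₚ.toℚᵘ-cancel-≤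
    (ℚᵘₚ.≤-respʳ-≃ (ℚᵘₚ.≃-sym (ℚₚ.toℚᵘ-fromℚᵘ (ℚᵘ.mkℚᵘ (+ ℤ.∣ n ∣) 0)))
      (ℚᵘ.*≤* (ℤₚ.≤-trans (ℤₚ.≤-reflexive (ℤₚ.*-identityʳ n)) (bound n))))
    where
    bound : ∀ n → n ℤ.≤ + ℤ.∣ n ∣ ℤ.* + suc d
    bound (+ k) = ℤₚ.≤-trans (ℤ.+≤+ (ℕₚ.m≤m*n k (suc d))) (ℤₚ.≤-reflexive (ℤₚ.pos-* k (suc d)))
    bound ℤ.-[1+ k ] = ℤₚ.≤-trans ℤ.-≤+ (ℤₚ.≤-reflexive (ℤₚ.pos-* (suc k) (suc d)))

fromℕ-suc : ∀ n → fromℕ (suc n) ≡ 1ℚ + fromℕ n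
fromℕ-suc n = trans (fromℕ-+ 1 n) (cong (_+ fromℕ n) (fromℕ-def 1))

fromℕ-* : ∀ a b → fromℕ (a ℕ.* b) ≡ fromℕ a * fromℕ b
fromℕ-* zero b = trans (fromℕ-def 0) (sym (trans (cong (_* fromℕ b) (fromℕ-def 0)) (ℚₚ.*-zeroˡ (fromℕ b))))
fromℕ-* (suc a) b = trans (fromℕ-+ b (a ℕ.* b)) (trans (cong (λ z → fromℕ b + z) (fromℕ-* a b))
  (trans (distrib (fromℕ a) (fromℕ b)) (cong (_* fromℕ b) (sym (fromℕ-suc a)))))
  where
  distrib : ∀ x y → y + x * y ≡ (1ℚ + x) * y
  distrib = solve-∀ ℚ-ring

0≤1 : 0ℚ ≤ℚ 1ℚ
0≤1 = ℚₚ.nonNegative⁻¹ 1ℚ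

0<1 : 0ℚ <ℚ 1ℚ
0<1 = ℚₚ.positive⁻¹ 1ℚ

0≤fromℕ : ∀ n → 0ℚ ≤ℚ fromℕ n
0≤fromℕ zero = ℚₚ.≤-reflexive (sym (fromℕ-def 0))
0≤fromℕ (suc n) = subst (0ℚ ≤ℚ_) (sym (fromℕ-suc n)) (0≤+ 0≤1 (0≤fromℕ n))

0<fromℕ : ∀ n → 0ℚ <ℚ fromℕ (suc n)
0<fromℕ n = subst (0ℚ <ℚ_) (sym (fromℕ-suc n)) (ℚₚ.+-mono-<-≤ 0<1 (0≤fromℕ n))

1≤fromℕ-suc : ∀ n → 1ℚ ≤ℚ fromℕ (suc n)
1≤fromℕ-suc n = certify (trans (cong (_- 1ℚ) (fromℕ-suc n)) (lemma (fromℕ n))) (0≤fromℕ n)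
  where
  lemma : ∀ x → 1ℚ + x - 1ℚ ≡ x
  lemma = solve-∀ ℚ-ring

fromℕ-mono : ∀ {a b} → a ≤ b → fromℕ a ≤ℚ fromℕ b
fromℕ-mono {b = b} z≤n = subst (_≤ℚ fromℕ b) (sym (fromℕ-def 0)) (0≤fromℕ b)
fromℕ-mono {suc a} {suc b} (s≤s p) = ℚₚ.≤-trans (ℚₚ.≤-reflexive (fromℕ-suc a))
  (ℚₚ.≤-trans (ℚₚ.+-monoʳ-≤ 1ℚ (fromℕ-mono p)) (ℚₚ.≤-reflexive (sym (fromℕ-suc b))))

fromℕ-cancel : ∀ {a b} → fromℕ a ≤ℚ fromℕ b → a ≤ b
fromℕ-cancel {a} {b} p with a ℕₚ.≤? b
... | yes q = q
... | no ¬q = ⊥-elim (ℚₚ.<-irrefl refl (ℚₚ.<-≤-trans b<a p))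
  where
  b<a : fromℕ b <ℚ fromℕ a
  b<a = ℚₚ.<-≤-trans
    (subst (fromℕ b <ℚ_) (sym (fromℕ-suc b))
      (subst (_<ℚ 1ℚ + fromℕ b) (ℚₚ.+-identityˡ (fromℕ b)) (ℚₚ.+-monoˡ-< (fromℕ b) 0<1)))
    (fromℕ-mono (ℕₚ.≰⇒> ¬q))

-- Finite sums, linear functionals and expectations on product spaces

sum : ∀ n → (Fin n → ℚ) → ℚ
sum zero f = 0ℚ
sum (suc n) f = f zero + sum n (f ∘ suc)

sum-cong : ∀ n {f g : Fin n → ℚ} → (∀ i → f i ≡ g i) → sum n f ≡ sum n g
sum-cong zero e = refl
sum-cong (suc n) e = cong₂ _+_ (e zero) (sum-cong n (e ∘ suc))

sum-mono : ∀ n {f g : Fin n → ℚ} → (∀ i → f i ≤ℚ g i) → sum n f ≤ℚ sum n g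
sum-mono zero p = ℚₚ.≤-refl
sum-mono (suc n) p = ℚₚ.+-mono-≤ (p zero) (sum-mono n (p ∘ suc))

sum-+ : ∀ n (f g : Fin n → ℚ) → sum n (λ i → f i + g i) ≡ sum n f + sum n g
sum-+ zero f g = refl
sum-+ (suc n) f g = trans (cong (λ z → f zero + g zero + z) (sum-+ n _ _)) (interchange (f zero) (g zero) _ _)
  where
  interchange : ∀ a b c d → a + b + (c + d) ≡ a + c + (b + d)
  interchange = solve-∀ ℚ-ring

sum-* : ∀ n c (f : Fin n → ℚ) → sum n (λ i → c * f i) ≡ c * sum n f
sum-* zero c f = sym (ℚₚ.*-zeroʳ c)
sum-* (suc n) c f = trans (cong (λ z → c * f zero + z) (sum-* n c _)) (sym (ℚₚ.*-distribˡ-+ c (f zero) _))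

sum-const : ∀ n c → sum n (λ _ → c) ≡ fromℕ n * c
sum-const zero c = sym (trans (cong (_* c) (fromℕ-def 0)) (ℚₚ.*-zeroˡ c))
sum-const (suc n) c = trans (cong (λ z → c + z) (sum-const n c))
  (trans (lemma c (fromℕ n)) (cong (_* c) (sym (fromℕ-suc n))))
  where
  lemma : ∀ c x → c + x * c ≡ (1ℚ + x) * c
  lemma = solve-∀ ℚ-ring

0≤sum : ∀ n {f : Fin n → ℚ} → (∀ i → 0ℚ ≤ℚ f i) → 0ℚ ≤ℚ sum n f
0≤sum zero p = ℚₚ.≤-refl
0≤sum (suc n) p = 0≤+ (p zero) (0≤sum n (p ∘ suc))

term≤sum : ∀ n {f : Fin n → ℚ} → (∀ i → 0ℚ ≤ℚ f i) → ∀ i → f i ≤ℚ sum n f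
term≤sum (suc n) {f} p zero = subst (_≤ℚ sum (suc n) f) (ℚₚ.+-identityʳ (f zero))
  (ℚₚ.+-monoʳ-≤ (f zero) (0≤sum n (p ∘ suc)))
term≤sum (suc n) {f} p (suc i) = subst (_≤ℚ sum (suc n) f) (ℚₚ.+-identityˡ (f (suc i)))
  (ℚₚ.+-mono-≤ (p zero) (term≤sum n (p ∘ suc) i))

-- Positivity is left to `Expectation`, because the noise kernels below take arbitrary rational
-- parameters.
record Linear (A : Set) : Set where
  no-eta-equality
  field
    ap : (A → ℚ) → ℚ
    ap-cong : ∀ {f g} → (∀ x → f x ≡ g x) → ap f ≡ ap g
    ap-+ : ∀ f g → ap (λ x → f x + g x) ≡ ap f + ap g
    ap-* : ∀ c f → ap (λ x → c * f x) ≡ c * ap f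

  ap-*ʳ : ∀ f c → ap (λ x → f x * c) ≡ ap f * c
  ap-*ʳ f c = trans (ap-cong (λ x → ℚₚ.*-comm (f x) c)) (trans (ap-* c f) (ℚₚ.*-comm c _))

  ap-combination₂ : ∀ a f b g → ap (λ x → a * f x + b * g x) ≡ a * ap f + b * ap g
  ap-combination₂ a f b g = trans (ap-+ _ _) (cong₂ _+_ (ap-* a f) (ap-* b g))

  ap-combination₃ : ∀ a f b g c h →
    ap (λ x → a * f x + b * g x + c * h x) ≡ a * ap f + b * ap g + c * ap h
  ap-combination₃ a f b g c h = trans (ap-+ _ _) (cong₂ _+_ (ap-combination₂ a f b g) (ap-* c h))

  ap-combination₄ : ∀ a f b g c h d k →
    ap (λ x → a * f x + b * g x + c * h x + d * k x) ≡ a * ap f + b * ap g + c * ap h + d * ap k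
  ap-combination₄ a f b g c h d k = trans (ap-+ _ _) (cong₂ _+_ (ap-combination₃ a f b g c h) (ap-* d k))

  ap-- : ∀ f g → ap (λ x → f x - g x) ≡ ap f - ap g
  ap-- f g = trans (ap-cong (λ x → lemma (f x) (g x)))
    (trans (ap-combination₂ 1ℚ f (- 1ℚ) g) (sym (lemma (ap f) (ap g))))
    where
    lemma : ∀ x y → x - y ≡ 1ℚ * x + (- 1ℚ) * y
    lemma = solve-∀ ℚ-ring

record Expectation (A : Set) : Set₁ where
  no-eta-equality
  field
    linear : Linear A
  open Linear linear public
  field
    ap-nonneg : ∀ {f} → (∀ x → 0ℚ ≤ℚ f x) → 0ℚ ≤ℚ ap f
    ap-1 : ap (λ _ → 1ℚ) ≡ 1ℚ
    -- Fubini against an arbitrary linear functional. As a field it is established along with each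
    -- construction, so that no measure has to be written out as a family of weights.
    ap-swap : ∀ {B} (M : Linear B) (h : A → B → ℚ) →
      ap (λ a → Linear.ap M (h a)) ≡ Linear.ap M (λ b → ap (λ a → h a b))

  ap-mono : ∀ {f g} → (∀ x → f x ≤ℚ g x) → ap f ≤ℚ ap g
  ap-mono {f} {g} p = 0≤⇒≤ (subst (0ℚ ≤ℚ_) (ap-- g f) (ap-nonneg (λ x → ≤⇒0≤ (p x))))

  ap-const : ∀ c → ap (λ _ → c) ≡ c
  ap-const c = trans (ap-cong (λ _ → sym (ℚₚ.*-identityʳ c)))
    (trans (ap-* c (λ _ → 1ℚ)) (trans (cong (c *_) ap-1) (ℚₚ.*-identityʳ c)))

  ap-≤const : ∀ {f} c → (∀ x → f x ≤ℚ c) → ap f ≤ℚ c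
  ap-≤const c p = ℚₚ.≤-trans (ap-mono p) (ℚₚ.≤-reflexive (ap-const c))

  -- Lagrange's identity: for independent x and y the mean of (f x · g y - f y · g x)² is twice the
  -- difference of the two sides.
  cauchy-schwarz : ∀ f g → ap (λ x → f x * g x) * ap (λ x → f x * g x)
    ≤ℚ ap (λ x → f x * f x) * ap (λ x → g x * g x)
  cauchy-schwarz f g = *-cancelˡ (1ℚ + 1ℚ) (ℚₚ.+-mono-< 0<1 0<1)
    (certify (trans (double F G H) (sym outer)) (ap-nonneg (λ x → ap-nonneg (λ y → 0≤square (f x * g y - f y * g x)))))
    where
    F = ap (λ x → f x * f x)
    G = ap (λ x → g x * g x)
    H = ap (λ x → f x * g x)
    double : ∀ F G H → (1ℚ + 1ℚ) * (F * G) - (1ℚ + 1ℚ) * (H * H) ≡ G * F + F * G + (- (H + H)) * H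
    double = solve-∀ ℚ-ring
    expand : ∀ fx gx fy gy → (fx * gy - fy * gx) * (fx * gy - fy * gx)
      ≡ (fx * fx) * (gy * gy) + (gx * gx) * (fy * fy) + (- (fx * gx + fx * gx)) * (fy * gy)
    expand = solve-∀ ℚ-ring
    rotate : ∀ F G H ff gg fg → ff * G + gg * F + (- (fg + fg)) * H ≡ G * ff + F * gg + (- (H + H)) * fg
    rotate = solve-∀ ℚ-ring
    inner : ∀ x → ap (λ y → (f x * g y - f y * g x) * (f x * g y - f y * g x))
      ≡ G * (f x * f x) + F * (g x * g x) + (- (H + H)) * (f x * g x)
    inner x = trans (ap-cong (λ y → expand (f x) (g x) (f y) (g y)))
      (trans (ap-combination₃ (f x * f x) (λ y → g y * g y) (g x * g x) (λ y → f y * f y)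
          (- (f x * g x + f x * g x)) (λ y → f y * g y))
        (rotate F G H (f x * f x) (g x * g x) (f x * g x)))
    outer : ap (λ x → ap (λ y → (f x * g y - f y * g x) * (f x * g y - f y * g x)))
      ≡ G * F + F * G + (- (H + H)) * H
    outer = trans (ap-cong inner) (ap-combination₃ G (λ x → f x * f x) F (λ x → g x * g x)
      (- (H + H)) (λ x → f x * g x))

  jensen : ∀ f → ap f * ap f ≤ℚ ap (λ x → f x * f x)
  jensen f = ℚₚ.≤-trans (ℚₚ.≤-reflexive (cong (λ z → z * z) (ap-cong (λ x → sym (ℚₚ.*-identityʳ (f x))))))
    (ℚₚ.≤-trans (cauchy-schwarz f (λ _ → 1ℚ))
      (ℚₚ.≤-reflexive (trans (cong (ap (λ x → f x * f x) *_) (ap-const 1ℚ)) (ℚₚ.*-identityʳ _))))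

bit : ∀ q → 0ℚ ≤ℚ q → q ≤ℚ 1ℚ → Expectation Bool
bit q 0≤q q≤1 = record
  { linear = record
    { ap = λ f → q * f true + (1ℚ - q) * f false
    ; ap-cong = λ e → cong₂ (λ x y → q * x + (1ℚ - q) * y) (e true) (e false)
    ; ap-+ = λ f g → additive q (f true) (f false) (g true) (g false)
    ; ap-* = λ c f → homogeneous q c (f true) (f false)
    }
  ; ap-nonneg = λ p → 0≤+ (0≤* 0≤q (p true)) (0≤* (≤⇒0≤ q≤1) (p false))
  ; ap-1 = total q
  ; ap-swap = λ M h → sym (Linear.ap-combination₂ M q (h true) (1ℚ - q) (h false))
  }
  where
  additive : ∀ q a b c d → q * (a + c) + (1ℚ - q) * (b + d) ≡ q * a + (1ℚ - q) * b + (q * c + (1ℚ - q) * d)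
  additive = solve-∀ ℚ-ring
  homogeneous : ∀ q c a b → q * (c * a) + (1ℚ - q) * (c * b) ≡ c * (q * a + (1ℚ - q) * b)
  homogeneous = solve-∀ ℚ-ring
  total : ∀ q → q * 1ℚ + (1ℚ - q) * 1ℚ ≡ 1ℚ
  total = solve-∀ ℚ-ring

abstract
  1/suc : ℕ → ℚ
  1/suc k = proj₁ (recip (fromℕ (suc k)) (0<fromℕ k))

  0<1/suc : ∀ k → 0ℚ <ℚ 1/suc k
  0<1/suc k = proj₁ (proj₂ (recip (fromℕ (suc k)) (0<fromℕ k)))

  suc*1/suc : ∀ k → fromℕ (suc k) * 1/suc k ≡ 1ℚ
  suc*1/suc k = proj₂ (proj₂ (recip (fromℕ (suc k)) (0<fromℕ k)))

sum-swap : ∀ n {B} (M : Linear B) (h : Fin n → B → ℚ) →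
  sum n (λ i → Linear.ap M (h i)) ≡ Linear.ap M (λ b → sum n (λ i → h i b))
sum-swap zero M h = sym (trans (Linear.ap-cong M (λ _ → refl)) (trans (Linear.ap-* M 0ℚ (λ _ → 0ℚ)) (ℚₚ.*-zeroˡ (Linear.ap M (λ _ → 0ℚ)))))
sum-swap (suc n) M h = trans (cong (λ z → Linear.ap M (h zero) + z) (sum-swap n M (h ∘ suc)))
  (sym (Linear.ap-+ M (h zero) _))

uniform : ∀ k → Expectation (Fin (suc k))
uniform k = record
  { linear = record
    { ap = λ f → 1/suc k * sum (suc k) f
    ; ap-cong = λ e → cong (1/suc k *_) (sum-cong (suc k) e)
    ; ap-+ = λ f g → trans (cong (1/suc k *_) (sum-+ (suc k) f g)) (ℚₚ.*-distribˡ-+ (1/suc k) (sum (suc k) f) (sum (suc k) g))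
    ; ap-* = λ c f → trans (cong (1/suc k *_) (sum-* (suc k) c f)) (exchange (1/suc k) c (sum (suc k) f))
    }
  ; ap-nonneg = λ p → 0≤* (ℚₚ.<⇒≤ (0<1/suc k)) (0≤sum (suc k) p)
  ; ap-1 = trans (cong (1/suc k *_) (trans (sum-const (suc k) 1ℚ) (ℚₚ.*-identityʳ (fromℕ (suc k)))))
      (trans (ℚₚ.*-comm (1/suc k) (fromℕ (suc k))) (suc*1/suc k))
  ; ap-swap = λ M h → trans (cong (1/suc k *_) (sum-swap (suc k) M h)) (sym (Linear.ap-* M (1/suc k) _))
  }
  where
  exchange : ∀ a b c → a * (b * c) ≡ b * (a * c)
  exchange = solve-∀ ℚ-ring

_⊗_ : ∀ {A B} → Expectation A → Expectation B → Expectation (A × B)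
P ⊗ Q = record
  { linear = record
    { ap = λ f → P.ap (λ a → Q.ap (λ b → f (a , b)))
    ; ap-cong = λ e → P.ap-cong (λ a → Q.ap-cong (λ b → e (a , b)))
    ; ap-+ = λ f g → trans (P.ap-cong (λ a → Q.ap-+ _ _)) (P.ap-+ _ _)
    ; ap-* = λ c f → trans (P.ap-cong (λ a → Q.ap-* c _)) (P.ap-* c _)
    }
  ; ap-nonneg = λ p → P.ap-nonneg (λ a → Q.ap-nonneg (λ b → p (a , b)))
  ; ap-1 = trans (P.ap-cong (λ _ → Q.ap-1)) P.ap-1
  ; ap-swap = λ M h → trans (P.ap-cong (λ a → Q.ap-swap M _)) (P.ap-swap M _)
  }
  where
  module P = Expectation P
  module Q = Expectation Q

power : ∀ {A} → Expectation A → ∀ n → Expectation (Vec A n)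
power P zero = record
  { linear = record
    { ap = λ f → f []
    ; ap-cong = λ e → e []
    ; ap-+ = λ f g → refl
    ; ap-* = λ c f → refl
    }
  ; ap-nonneg = λ p → p []
  ; ap-1 = refl
  ; ap-swap = λ M h → refl
  }
power P (suc n) = record
  { linear = record
    { ap = λ f → P.ap (λ a → Q.ap (λ v → f (a ∷ v)))
    ; ap-cong = λ e → P.ap-cong (λ a → Q.ap-cong (λ v → e (a ∷ v)))
    ; ap-+ = λ f g → trans (P.ap-cong (λ a → Q.ap-+ _ _)) (P.ap-+ _ _)
    ; ap-* = λ c f → trans (P.ap-cong (λ a → Q.ap-* c _)) (P.ap-* c _)
    }
  ; ap-nonneg = λ p → P.ap-nonneg (λ a → Q.ap-nonneg (λ v → p (a ∷ v)))
  ; ap-1 = trans (P.ap-cong (λ _ → Q.ap-1)) P.ap-1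
  ; ap-swap = λ M h → trans (P.ap-cong (λ a → Q.ap-swap M _)) (P.ap-swap M _)
  }
  where
  module P = Expectation P
  module Q = Expectation (power P n)

-- Noise operators and their quadratic forms

infixl 7 _⊙_

_⊙_ : ∀ {n} → Vec ℚ n → Vec ℚ n → Vec ℚ n
_⊙_ = zipWith _*_

-- As a noise parameter, 1 keeps a coordinate and 0 averages it out. The operators of idempotent
-- vectors are thus conditional expectations, that is, orthogonal projections.
Idempotent : ∀ {n} → Vec ℚ n → Set
Idempotent αs = αs ⊙ αs ≡ αs

ones : ∀ n → Vec ℚ n
ones n = replicate n 1ℚ

except : ∀ {n} → Fin n → Vec ℚ n
except {suc n} zero = 0ℚ ∷ ones n
except {suc n} (suc i) = 1ℚ ∷ except i

ones-idempotent : ∀ n → Idempotent (ones n)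
ones-idempotent zero = refl
ones-idempotent (suc n) = cong₂ _∷_ (ℚₚ.*-identityˡ 1ℚ) (ones-idempotent n)

except-idempotent : ∀ {n} (i : Fin n) → Idempotent (except i)
except-idempotent {suc n} zero = cong₂ _∷_ (ℚₚ.*-zeroˡ 0ℚ) (ones-idempotent n)
except-idempotent {suc n} (suc i) = cong₂ _∷_ (ℚₚ.*-identityˡ 1ℚ) (except-idempotent i)

⊙-comm : ∀ {n} (αs βs : Vec ℚ n) → αs ⊙ βs ≡ βs ⊙ αs
⊙-comm = Vecₚ.zipWith-comm ℚₚ.*-comm

module Noise {Ω : Set} (P : Expectation Ω) where

  private module P = Expectation P

  𝔼ₙ : ∀ n → Expectation (Vec Ω n)
  𝔼ₙ = power P

  private module 𝔼 {n} = Expectation (𝔼ₙ n)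

  𝔼 : ∀ {n} → (Vec Ω n → ℚ) → ℚ
  𝔼 {n} = Expectation.ap (𝔼ₙ n)

  ⟪_,_⟫ : ∀ {n} → (Vec Ω n → ℚ) → (Vec Ω n → ℚ) → ℚ
  ⟪ f , g ⟫ = 𝔼 (λ v → f v * g v)

  mean : ∀ {n} → (Vec Ω (suc n) → ℚ) → Vec Ω n → ℚ
  mean f v = P.ap (λ b → f (b ∷ v))

  -- For parameters in [0, 1] this is the law of v after each coordinate is kept with probability αᵢ
  -- and resampled otherwise. Being a linear functional, it can be exchanged with `P` through
  -- `ap-swap`.
  kernel : ∀ {n} → Vec ℚ n → Vec Ω n → Linear (Vec Ω n)
  kernel [] [] = record
    { ap = λ f → f []
    ; ap-cong = λ e → e []
    ; ap-+ = λ f g → refl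
    ; ap-* = λ c f → refl
    }
  kernel (α ∷ αs) (a ∷ v) = record
    { ap = λ f → α * K.ap (λ w → f (a ∷ w)) + (1ℚ - α) * P.ap (λ b → K.ap (λ w → f (b ∷ w)))
    ; ap-cong = λ e → cong₂ (λ x y → α * x + (1ℚ - α) * y)
        (K.ap-cong (λ w → e (a ∷ w))) (P.ap-cong (λ b → K.ap-cong (λ w → e (b ∷ w))))
    ; ap-+ = λ f g → trans
        (cong₂ (λ x y → α * x + (1ℚ - α) * y) (K.ap-+ _ _)
          (trans (P.ap-cong (λ b → K.ap-+ _ _)) (P.ap-+ _ _)))
        (additive α _ _ _ _)
    ; ap-* = λ c f → trans
        (cong₂ (λ x y → α * x + (1ℚ - α) * y) (K.ap-* c _)
          (trans (P.ap-cong (λ b → K.ap-* c _)) (P.ap-* c _)))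
        (homogeneous α c _ _)
    }
    where
    module K = Linear (kernel αs v)
    additive : ∀ q a b c d → q * (a + c) + (1ℚ - q) * (b + d) ≡ q * a + (1ℚ - q) * b + (q * c + (1ℚ - q) * d)
    additive = solve-∀ ℚ-ring
    homogeneous : ∀ q c a b → q * (c * a) + (1ℚ - q) * (c * b) ≡ c * (q * a + (1ℚ - q) * b)
    homogeneous = solve-∀ ℚ-ring

  -- The tensor product of the operators αᵢ·id + (1 - αᵢ)·𝔼.
  noise : ∀ {n} → Vec ℚ n → (Vec Ω n → ℚ) → Vec Ω n → ℚ
  noise αs f v = Linear.ap (kernel αs v) f

  module K {n} (αs : Vec ℚ n) (v : Vec Ω n) = Linear (kernel αs v)

  noise-mean : ∀ {n} (αs : Vec ℚ n) f v → P.ap (λ b → noise αs (λ w → f (b ∷ w)) v) ≡ noise αs (mean f) v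
  noise-mean αs f v = P.ap-swap (kernel αs v) (λ b w → f (b ∷ w))

  noise-∷ : ∀ {n} α (αs : Vec ℚ n) f a v →
    noise (α ∷ αs) f (a ∷ v) ≡ α * noise αs (λ w → f (a ∷ w)) v + (1ℚ - α) * noise αs (mean f) v
  noise-∷ α αs f a v = cong (λ z → α * noise αs (λ w → f (a ∷ w)) v + (1ℚ - α) * z) (noise-mean αs f v)

  noise-ones : ∀ {n} f (v : Vec Ω n) → noise (ones n) f v ≡ f v
  noise-ones f [] = refl
  noise-ones f (a ∷ v) = trans
    (lemma (noise (ones _) (λ w → f (a ∷ w)) v) (P.ap (λ b → noise (ones _) (λ w → f (b ∷ w)) v)))
    (noise-ones (λ w → f (a ∷ w)) v)
    where
    lemma : ∀ x y → 1ℚ * x + (1ℚ - 1ℚ) * y ≡ x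
    lemma = solve-∀ ℚ-ring

  noise-const : ∀ {n} (αs : Vec ℚ n) c v → noise αs (λ _ → c) v ≡ c
  noise-const [] c [] = refl
  noise-const (α ∷ αs) c (a ∷ v) = trans
    (cong₂ (λ x y → α * x + (1ℚ - α) * y) (noise-const αs c v)
      (trans (P.ap-cong (λ b → noise-const αs c v)) (P.ap-const c)))
    (lemma α c)
    where
    lemma : ∀ α c → α * c + (1ℚ - α) * c ≡ c
    lemma = solve-∀ ℚ-ring

  -- In one coordinate, α·id + (1 - α)·𝔼 and β·id + (1 - β)·𝔼 multiply to αβ·id + (1 - αβ)·𝔼,
  -- because 𝔼 is a projection.
  noise-noise : ∀ {n} (αs βs : Vec ℚ n) f v → noise αs (noise βs f) v ≡ noise (αs ⊙ βs) f v
  noise-noise [] [] f [] = refl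
  noise-noise {suc n} (α ∷ αs) (β ∷ βs) f (a ∷ v) = begin
    α * noise αs (λ w → noise (β ∷ βs) f (a ∷ w)) v
      + (1ℚ - α) * P.ap (λ b → noise αs (λ w → noise (β ∷ βs) f (b ∷ w)) v)
      ≡⟨ cong₂ (λ x y → α * x + (1ℚ - α) * y) (slice a)
          (trans (P.ap-cong slice) (P.ap-combination₂ β C (1ℚ - β) (λ _ → X))) ⟩
    α * (β * C a + (1ℚ - β) * X) + (1ℚ - α) * (β * P.ap C + (1ℚ - β) * P.ap (λ _ → X))
      ≡⟨ cong₂ (λ x y → α * (β * C a + (1ℚ - β) * X) + (1ℚ - α) * (β * x + (1ℚ - β) * y))
          (noise-mean (αs ⊙ βs) f v) (P.ap-const X) ⟩
    α * (β * C a + (1ℚ - β) * X) + (1ℚ - α) * (β * X + (1ℚ - β) * X)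
      ≡⟨ collect α β (C a) X ⟩
    α * β * C a + (1ℚ - α * β) * X
      ≡⟨ noise-∷ (α * β) (αs ⊙ βs) f a v ⟨
    noise (α * β ∷ αs ⊙ βs) f (a ∷ v) ∎
    where
    open ≡-Reasoning
    C : Ω → ℚ
    C b = noise (αs ⊙ βs) (λ w → f (b ∷ w)) v
    X = noise (αs ⊙ βs) (mean f) v
    slice : ∀ b → noise αs (λ w → noise (β ∷ βs) f (b ∷ w)) v ≡ β * C b + (1ℚ - β) * X
    slice b = trans (K.ap-cong αs v (λ w → noise-∷ β βs f b w))
      (trans (K.ap-combination₂ αs v β (noise βs (λ w → f (b ∷ w))) (1ℚ - β) (noise βs (mean f)))
        (cong₂ (λ x y → β * x + (1ℚ - β) * y)
          (noise-noise αs βs (λ w → f (b ∷ w)) v) (noise-noise αs βs (mean f) v)))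
    collect : ∀ α β c x →
      α * (β * c + (1ℚ - β) * x) + (1ℚ - α) * (β * x + (1ℚ - β) * x) ≡ α * β * c + (1ℚ - α * β) * x
    collect = solve-∀ ℚ-ring

  ⟪⟫-cong : ∀ {n} {f f′ g g′ : Vec Ω n → ℚ} → (∀ v → f v ≡ f′ v) → (∀ v → g v ≡ g′ v) → ⟪ f , g ⟫ ≡ ⟪ f′ , g′ ⟫
  ⟪⟫-cong p q = 𝔼.ap-cong (λ v → cong₂ _*_ (p v) (q v))

  ⟪⟫-congʳ : ∀ {n} (f : Vec Ω n → ℚ) {g g′} → (∀ v → g v ≡ g′ v) → ⟪ f , g ⟫ ≡ ⟪ f , g′ ⟫
  ⟪⟫-congʳ f q = 𝔼.ap-cong (λ v → cong (f v *_) (q v))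

  ⟪⟫-comm : ∀ {n} (f g : Vec Ω n → ℚ) → ⟪ f , g ⟫ ≡ ⟪ g , f ⟫
  ⟪⟫-comm f g = 𝔼.ap-cong (λ v → ℚₚ.*-comm (f v) (g v))

  ⟪⟫-mean : ∀ {n} (g : Vec Ω (suc n) → ℚ) (h : Vec Ω n → ℚ) →
    P.ap (λ a → ⟪ (λ v → g (a ∷ v)) , h ⟫) ≡ ⟪ mean g , h ⟫
  ⟪⟫-mean g h = trans (P.ap-swap 𝔼.linear (λ a v → g (a ∷ v) * h v))
    (𝔼.ap-cong (λ v → P.ap-*ʳ (λ a → g (a ∷ v)) (h v)))

  ⟪⟫-noise-∷ : ∀ {n} α (αs : Vec ℚ n) g f → ⟪ g , noise (α ∷ αs) f ⟫
    ≡ α * P.ap (λ a → ⟪ (λ v → g (a ∷ v)) , noise αs (λ v → f (a ∷ v)) ⟫)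
      + (1ℚ - α) * ⟪ mean g , noise αs (mean f) ⟫
  ⟪⟫-noise-∷ α αs g f = trans
    (P.ap-cong (λ a → trans
      (𝔼.ap-cong (λ v → trans (cong (g (a ∷ v) *_) (noise-∷ α αs f a v))
        (distrib α (g (a ∷ v)) (noise αs (λ w → f (a ∷ w)) v) (noise αs (mean f) v))))
      (𝔼.ap-combination₂ α (λ v → g (a ∷ v) * noise αs (λ w → f (a ∷ w)) v)
        (1ℚ - α) (λ v → g (a ∷ v) * noise αs (mean f) v))))
    (trans (P.ap-combination₂ α (λ a → ⟪ (λ v → g (a ∷ v)) , noise αs (λ v → f (a ∷ v)) ⟫)
        (1ℚ - α) (λ a → ⟪ (λ v → g (a ∷ v)) , noise αs (mean f) ⟫))
      (cong (λ z → α * P.ap (λ a → ⟪ (λ v → g (a ∷ v)) , noise αs (λ v → f (a ∷ v)) ⟫) + (1ℚ - α) * z)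
        (⟪⟫-mean g (noise αs (mean f)))))
    where
    distrib : ∀ α g x y → g * (α * x + (1ℚ - α) * y) ≡ α * (g * x) + (1ℚ - α) * (g * y)
    distrib = solve-∀ ℚ-ring

  noise-symmetric : ∀ {n} (αs : Vec ℚ n) f g → ⟪ f , noise αs g ⟫ ≡ ⟪ noise αs f , g ⟫
  noise-symmetric αs f g = trans (symmetric αs f g) (⟪⟫-comm g (noise αs f))
    where
    symmetric : ∀ {n} (αs : Vec ℚ n) f g → ⟪ f , noise αs g ⟫ ≡ ⟪ g , noise αs f ⟫
    symmetric [] f g = ℚₚ.*-comm (f []) (g [])
    symmetric (α ∷ αs) f g = trans (⟪⟫-noise-∷ α αs f g) (trans
      (cong₂ (λ x y → α * x + (1ℚ - α) * y)
        (P.ap-cong (λ a → symmetric αs (λ v → f (a ∷ v)) (λ v → g (a ∷ v))))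
        (symmetric αs (mean f) (mean g)))
      (sym (⟪⟫-noise-∷ α αs g f)))

  𝔼-noise : ∀ {n} (αs : Vec ℚ n) f → 𝔼 (noise αs f) ≡ 𝔼 f
  𝔼-noise αs f = trans (𝔼.ap-cong (λ v → sym (ℚₚ.*-identityʳ (noise αs f v))))
    (trans (sym (noise-symmetric αs f (λ _ → 1ℚ)))
      (𝔼.ap-cong (λ v → trans (cong (f v *_) (noise-const αs 1ℚ v)) (ℚₚ.*-identityʳ (f v)))))

  noise-isometry : ∀ {n} (αs : Vec ℚ n) f → ⟪ noise αs f , noise αs f ⟫ ≡ ⟪ f , noise (αs ⊙ αs) f ⟫
  noise-isometry αs f = trans (sym (noise-symmetric αs f (noise αs f)))
    (⟪⟫-congʳ f (noise-noise αs αs f))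

  -- The quadratic form of 1 - T. For idempotent parameters it is the squared L² distance from f to
  -- its projection: with `except i` the influence of coordinate i, with `mask J` the distance to
  -- the functions of the coordinates in J.
  deficit : ∀ {n} → Vec ℚ n → (Vec Ω n → ℚ) → ℚ
  deficit αs f = ⟪ f , f ⟫ - ⟪ f , noise αs f ⟫

  residual : ∀ {n} → Vec ℚ n → (Vec Ω n → ℚ) → Vec Ω n → ℚ
  residual αs f v = f v - noise αs f v

  deficit-idempotent : ∀ {n} (αs : Vec ℚ n) → Idempotent αs → ∀ f → deficit αs f ≡ ⟪ residual αs f , residual αs f ⟫
  deficit-idempotent αs idem f = sym (trans
    (𝔼.ap-cong (λ v → expand (f v) (noise αs f v)))
    (trans (𝔼.ap-combination₃ 1ℚ (λ v → f v * f v) (- (1ℚ + 1ℚ)) (λ v → f v * noise αs f v)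
        1ℚ (λ v → noise αs f v * noise αs f v))
      (trans (cong (λ z → 1ℚ * ⟪ f , f ⟫ + (- (1ℚ + 1ℚ)) * ⟪ f , noise αs f ⟫ + 1ℚ * z)
          (trans (noise-isometry αs f) (cong (λ z → ⟪ f , noise z f ⟫) idem)))
        (collect ⟪ f , f ⟫ ⟪ f , noise αs f ⟫))))
    where
    expand : ∀ x y → (x - y) * (x - y) ≡ 1ℚ * (x * x) + (- (1ℚ + 1ℚ)) * (x * y) + 1ℚ * (y * y)
    expand = solve-∀ ℚ-ring
    collect : ∀ x y → 1ℚ * x + (- (1ℚ + 1ℚ)) * y + 1ℚ * y ≡ x - y
    collect = solve-∀ ℚ-ring

  -- Idempotency writes the deficit as the square of a residual; the residual commutes with
  -- averaging the first coordinate, and Jensen's inequality applies at each point.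
  deficit-mean : ∀ {n} (αs : Vec ℚ n) → Idempotent αs → ∀ f →
    deficit αs (mean f) ≤ℚ P.ap (λ a → deficit αs (λ v → f (a ∷ v)))
  deficit-mean αs idem f = ℚₚ.≤-trans
    (ℚₚ.≤-reflexive (trans (deficit-idempotent αs idem (mean f)) (⟪⟫-cong residual-mean residual-mean)))
    (ℚₚ.≤-trans (𝔼.ap-mono (λ v → P.jensen (λ a → residual αs (λ w → f (a ∷ w)) v)))
      (ℚₚ.≤-reflexive (trans
        (sym (P.ap-swap 𝔼.linear (λ a v → residual αs (λ w → f (a ∷ w)) v * residual αs (λ w → f (a ∷ w)) v)))
        (P.ap-cong (λ a → sym (deficit-idempotent αs idem (λ v → f (a ∷ v))))))))
    where
    residual-mean : ∀ v → residual αs (mean f) v ≡ P.ap (λ a → residual αs (λ w → f (a ∷ w)) v)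
    residual-mean v = trans (cong (λ z → mean f v - z) (sym (noise-mean αs f v)))
      (sym (P.ap-- (λ a → f (a ∷ v)) (λ a → noise αs (λ w → f (a ∷ w)) v)))

  deficit-∷ : ∀ {n} α (αs : Vec ℚ n) f → deficit (α ∷ αs) f
    ≡ α * P.ap (λ a → deficit αs (λ v → f (a ∷ v)))
      + (1ℚ - α) * (⟪ f , f ⟫ - ⟪ mean f , mean f ⟫ + deficit αs (mean f))
  deficit-∷ α αs f = trans (cong (λ z → ⟪ f , f ⟫ - z) (⟪⟫-noise-∷ α αs f f))
    (trans (collect α ⟪ f , f ⟫ _ ⟪ mean f , mean f ⟫ ⟪ mean f , noise αs (mean f) ⟫)
      (cong (λ z → α * z + (1ℚ - α) * (⟪ f , f ⟫ - ⟪ mean f , mean f ⟫ + deficit αs (mean f)))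
        (sym (P.ap-- (λ a → ⟪ (λ v → f (a ∷ v)) , (λ v → f (a ∷ v)) ⟫)
          (λ a → ⟪ (λ v → f (a ∷ v)) , noise αs (λ v → f (a ∷ v)) ⟫)))))
    where
    collect : ∀ α ff x mm y → ff - (α * x + (1ℚ - α) * y) ≡ α * (ff - x) + (1ℚ - α) * (ff - mm + (mm - y))
    collect = solve-∀ ℚ-ring

  deficit-ones : ∀ {n} (f : Vec Ω n → ℚ) → deficit (ones n) f ≡ 0ℚ
  deficit-ones f = trans (cong (λ z → ⟪ f , f ⟫ - z) (⟪⟫-congʳ f (noise-ones f))) (ℚₚ.+-inverseʳ ⟪ f , f ⟫)

  deficit-except-suc : ∀ {n} (i : Fin n) f →
    deficit (except (suc i)) f ≡ P.ap (λ a → deficit (except i) (λ v → f (a ∷ v)))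
  deficit-except-suc i f = trans (deficit-∷ 1ℚ (except i) f)
    (lemma (P.ap (λ a → deficit (except i) (λ v → f (a ∷ v))))
      (⟪ f , f ⟫ - ⟪ mean f , mean f ⟫ + deficit (except i) (mean f)))
    where
    lemma : ∀ x y → 1ℚ * x + (1ℚ - 1ℚ) * y ≡ x
    lemma = solve-∀ ℚ-ring

  -- 1 - ∏ αᵢ ≤ ∑ (1 - αᵢ), in operator form.
  deficit-≤-sum : ∀ {n} (αs : Vec ℚ n) → (∀ i → 0ℚ ≤ℚ lookup αs i × lookup αs i ≤ℚ 1ℚ) → ∀ f →
    deficit αs f ≤ℚ sum n (λ i → (1ℚ - lookup αs i) * deficit (except i) f)
  deficit-≤-sum [] bounds f = ℚₚ.≤-reflexive (ℚₚ.+-inverseʳ (f [] * f []))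
  deficit-≤-sum {suc n} (α ∷ αs) bounds f =
    ℚₚ.≤-trans (ℚₚ.≤-reflexive (deficit-∷ α αs f))
      -- Resampling the first coordinate costs (1 - α)·V; the others contribute at most `S`, whether
      -- they act on the slices or on `mean f`.
      (ℚₚ.≤-trans (certify (split α V (P.ap slices) S (deficit αs (mean f)))
        (0≤+ (0≤* 0≤α (≤⇒0≤ slices≤S)) (0≤* 0≤1-α (≤⇒0≤ mean≤S))))
        (ℚₚ.≤-reflexive (cong₂ (λ x y → (1ℚ - α) * x + y) (sym first) rest)))
    where
    0≤α = proj₁ (bounds zero)
    0≤1-α = ≤⇒0≤ (proj₂ (bounds zero))
    V = ⟪ f , f ⟫ - ⟪ mean f , mean f ⟫
    slices : Ω → ℚ
    slices a = deficit αs (λ v → f (a ∷ v))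
    S = sum n (λ i → (1ℚ - lookup αs i) * P.ap (λ a → deficit (except i) (λ v → f (a ∷ v))))
    split : ∀ α V x S y → (1ℚ - α) * V + S - (α * x + (1ℚ - α) * (V + y)) ≡ α * (S - x) + (1ℚ - α) * (S - y)
    split = solve-∀ ℚ-ring
    slices≤S : P.ap slices ≤ℚ S
    slices≤S = ℚₚ.≤-trans (P.ap-mono (λ a → deficit-≤-sum αs (bounds ∘ suc) (λ v → f (a ∷ v))))
      (ℚₚ.≤-reflexive (trans
        (sym (sum-swap n P.linear (λ i a → (1ℚ - lookup αs i) * deficit (except i) (λ v → f (a ∷ v)))))
        (sum-cong n (λ i → P.ap-* (1ℚ - lookup αs i) (λ a → deficit (except i) (λ v → f (a ∷ v)))))))
    mean≤S : deficit αs (mean f) ≤ℚ S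
    mean≤S = ℚₚ.≤-trans (deficit-≤-sum αs (bounds ∘ suc) (mean f))
      (sum-mono n (λ i → *-monoˡ (1ℚ - lookup αs i) (≤⇒0≤ (proj₂ (bounds (suc i))))
        (deficit-mean (except i) (except-idempotent i) f)))
    first : deficit (except zero) f ≡ V
    first = trans (deficit-∷ 0ℚ (ones n) f) (trans
      (cong (λ z → 0ℚ * P.ap (λ a → deficit (ones n) (λ v → f (a ∷ v))) + (1ℚ - 0ℚ) * (V + z)) (deficit-ones (mean f)))
      (lemma (P.ap (λ a → deficit (ones n) (λ v → f (a ∷ v)))) V))
      where
      lemma : ∀ x v → 0ℚ * x + (1ℚ - 0ℚ) * (v + 0ℚ) ≡ v
      lemma = solve-∀ ℚ-ring
    rest : S ≡ sum n (λ i → (1ℚ - lookup αs i) * deficit (except (suc i)) f)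
    rest = sum-cong n (λ i → cong ((1ℚ - lookup αs i) *_) (sym (deficit-except-suc i f)))

-- Indicators, repeated squaring and the constants of the junta theorem

𝟙 : Bool → ℚ
𝟙 true = 1ℚ
𝟙 false = 0ℚ

0≤𝟙 : ∀ b → 0ℚ ≤ℚ 𝟙 b
0≤𝟙 true = 0≤1
0≤𝟙 false = ℚₚ.≤-refl

𝟙≤1 : ∀ b → 𝟙 b ≤ℚ 1ℚ
𝟙≤1 true = ℚₚ.≤-refl
𝟙≤1 false = 0≤1

𝟙-idempotent : ∀ b → 𝟙 b * 𝟙 b ≡ 𝟙 b
𝟙-idempotent true = refl
𝟙-idempotent false = refl

mask : ∀ {n} → Vec Bool n → Vec ℚ n
mask = Vec.map 𝟙

mask-idempotent : ∀ {n} (J : Vec Bool n) → Idempotent (mask J)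
mask-idempotent [] = refl
mask-idempotent (j ∷ J) = cong₂ _∷_ (𝟙-idempotent j) (mask-idempotent J)

½ : ℚ
½ = + 1 / 2

-- The power x^(2^r). Each application of Cauchy-Schwarz to the noise operator accounts for one
-- squaring.
iteratedSquare : ℚ → ℕ → ℚ
iteratedSquare x zero = x
iteratedSquare x (suc r) = iteratedSquare x r * iteratedSquare x r

0<iteratedSquare : ∀ {x} → 0ℚ <ℚ x → ∀ r → 0ℚ <ℚ iteratedSquare x r
0<iteratedSquare p zero = p
0<iteratedSquare p (suc r) = 0<* (0<iteratedSquare p r) (0<iteratedSquare p r)

0≤iteratedSquare : ∀ {x} → 0ℚ ≤ℚ x → ∀ r → 0ℚ ≤ℚ iteratedSquare x r
0≤iteratedSquare p zero = p
0≤iteratedSquare {x} p (suc r) = 0≤square (iteratedSquare x r)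

iteratedSquare≤1 : ∀ {x} → 0ℚ ≤ℚ x → x ≤ℚ 1ℚ → ∀ r → iteratedSquare x r ≤ℚ 1ℚ
iteratedSquare≤1 p q zero = q
iteratedSquare≤1 p q (suc r) = *-mono-≤ (0≤iteratedSquare p r) (iteratedSquare≤1 p q r)
  (0≤iteratedSquare p r) (iteratedSquare≤1 p q r)

-- Squaring the bound for r suffices, since (1 + (1 + r)δ)² ≥ 1 + (2 + r)δ. Growth linear in r is
-- enough because r is chosen after δ.
iteratedSquare-decay : ∀ δ → 0ℚ ≤ℚ δ → δ ≤ℚ 1ℚ → ∀ r →
  iteratedSquare (1ℚ - δ) r * (1ℚ + (1ℚ + fromℕ r) * δ) ≤ℚ 1ℚ
iteratedSquare-decay δ p q zero = subst (λ z → (1ℚ - δ) * (1ℚ + (1ℚ + z) * δ) ≤ℚ 1ℚ) (sym (fromℕ-def 0))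
  (certify (lemma δ) (0≤square δ))
  where
  lemma : ∀ δ → 1ℚ - (1ℚ - δ) * (1ℚ + (1ℚ + 0ℚ) * δ) ≡ δ * δ
  lemma = solve-∀ ℚ-ring
iteratedSquare-decay δ p q (suc r) = ℚₚ.≤-trans
  (ℚₚ.≤-reflexive (cong (λ z → iteratedSquare (1ℚ - δ) (suc r) * (1ℚ + (1ℚ + z) * δ)) (fromℕ-suc r)))
  (certify (lemma δ k s)
    (0≤+ (0≤* (≤⇒0≤ (iteratedSquare-decay δ p q r)) (0≤+ 0≤1 (0≤* 0≤s (0≤+ 0≤1 (0≤* 0≤1+k p)))))
      (0≤* (0≤square s) (0≤+ (0≤* (0≤fromℕ r) p) (0≤square ((1ℚ + k) * δ))))))
  where
  k = fromℕ r
  s = iteratedSquare (1ℚ - δ) r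
  0≤1+k = 0≤+ 0≤1 (0≤fromℕ r)
  0≤s : 0ℚ ≤ℚ s
  0≤s = 0≤iteratedSquare (≤⇒0≤ q) r
  lemma : ∀ δ k s → 1ℚ - s * s * (1ℚ + (1ℚ + (1ℚ + k)) * δ)
    ≡ (1ℚ - s * (1ℚ + (1ℚ + k) * δ)) * (1ℚ + s * (1ℚ + (1ℚ + k) * δ)) + s * s * (k * δ + ((1ℚ + k) * δ) * ((1ℚ + k) * δ))
  lemma = solve-∀ ℚ-ring

-- The 2^r-th power ρ of the noise parameter 1 - δ is small enough for hypercontractivity;
-- τ² is the influence threshold.
record JuntaConstants (M η C : ℚ) : Set where
  no-eta-equality
  field
    δ : ℚ
    0≤δ : 0ℚ ≤ℚ δ
    δ≤1 : δ ≤ℚ 1ℚ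
    δ-small : (δ + δ) * C ≤ℚ η
    r : ℕ
  ρ = iteratedSquare (1ℚ - δ) r
  field
    ρ-small : ρ * ρ * M ≤ℚ 1ℚ
    τ : ℚ
    0<τ : 0ℚ <ℚ τ
    τ-small : τ * C ≤ℚ iteratedSquare ½ (suc r) * η

juntaConstants : ∀ M η C → 0ℚ <ℚ η → 0ℚ <ℚ C → JuntaConstants M η C
juntaConstants M η C 0<η 0<C = record
  { δ = δ
  ; 0≤δ = ℚₚ.<⇒≤ 0<δ
  ; δ≤1 = δ≤1
  ; δ-small = certify (trans (gap₁ η C w) (trans (cong (λ z → η * (1ℚ - z) + δ * η) ww) (gap₂ η δ)))
      (0≤* (ℚₚ.<⇒≤ 0<δ) (ℚₚ.<⇒≤ 0<η))
  ; r = r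
  ; ρ-small = ρ-small
  ; τ = c * η * C⁻¹
  ; 0<τ = 0<* (0<* 0<c 0<η) 0<C⁻¹
  ; τ-small = ℚₚ.≤-reflexive (trans (regroup (c * η) C⁻¹ C) (trans (cong (c * η *_) CC) (ℚₚ.*-identityʳ (c * η))))
  }
  where
  0<W : 0ℚ <ℚ C + C + η
  0<W = ℚₚ.+-mono-< (ℚₚ.+-mono-< 0<C 0<C) 0<η
  w = proj₁ (recip (C + C + η) 0<W)
  0<w = proj₁ (proj₂ (recip (C + C + η) 0<W))
  ww : (C + C + η) * w ≡ 1ℚ
  ww = proj₂ (proj₂ (recip (C + C + η) 0<W))
  -- δ = η/(2C + η) lies below both 1 and η/(2C).
  δ = η * w
  0<δ : 0ℚ <ℚ δ
  0<δ = 0<* 0<η 0<w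
  δ≤1 : δ ≤ℚ 1ℚ
  δ≤1 = certify (trans (cong (_- δ) (sym ww)) (lemma C η w)) (0≤* (ℚₚ.<⇒≤ (ℚₚ.+-mono-< 0<C 0<C)) (ℚₚ.<⇒≤ 0<w))
    where
    lemma : ∀ C η w → (C + C + η) * w - η * w ≡ (C + C) * w
    lemma = solve-∀ ℚ-ring
  gap₁ : ∀ η C w → η - (η * w + η * w) * C ≡ η * (1ℚ - (C + C + η) * w) + η * w * η
  gap₁ = solve-∀ ℚ-ring
  gap₂ : ∀ η d → η * (1ℚ - 1ℚ) + d * η ≡ d * η
  gap₂ = solve-∀ ℚ-ring
  δ⁻¹ = proj₁ (recip δ 0<δ)
  δδ : δ * δ⁻¹ ≡ 1ℚ
  δδ = proj₂ (proj₂ (recip δ 0<δ))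
  -- This r gives M ≤ rδ ≤ B, so the decay bound s·B ≤ 1 yields s·M ≤ 1, and s ≤ 1 does the rest.
  r = proj₁ (archimedean (M * δ⁻¹))
  M≤rδ : M ≤ℚ fromℕ r * δ
  M≤rδ = subst (_≤ℚ fromℕ r * δ)
    (trans (ℚₚ.*-assoc M δ⁻¹ δ) (trans (cong (M *_) (trans (ℚₚ.*-comm δ⁻¹ δ) δδ)) (ℚₚ.*-identityʳ M)))
    (ℚₚ.*-monoʳ-≤-nonNeg δ {{nonNegative (ℚₚ.<⇒≤ 0<δ)}} (proj₂ (archimedean (M * δ⁻¹))))
  s = iteratedSquare (1ℚ - δ) r
  0≤1-δ = ≤⇒0≤ δ≤1
  0≤s : 0ℚ ≤ℚ s
  0≤s = 0≤iteratedSquare 0≤1-δ r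
  s≤1 : s ≤ℚ 1ℚ
  s≤1 = iteratedSquare≤1 0≤1-δ (certify (lemma δ) (ℚₚ.<⇒≤ 0<δ)) r
    where
    lemma : ∀ δ → 1ℚ - (1ℚ - δ) ≡ δ
    lemma = solve-∀ ℚ-ring
  B = 1ℚ + (1ℚ + fromℕ r) * δ
  0≤B : 0ℚ ≤ℚ B
  0≤B = 0≤+ 0≤1 (0≤* (0≤+ 0≤1 (0≤fromℕ r)) (ℚₚ.<⇒≤ 0<δ))
  M≤B : M ≤ℚ B
  M≤B = ℚₚ.≤-trans M≤rδ (certify (lemma δ (fromℕ r)) (0≤+ 0≤1 (ℚₚ.<⇒≤ 0<δ)))
    where
    lemma : ∀ δ k → 1ℚ + (1ℚ + k) * δ - k * δ ≡ 1ℚ + δ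
    lemma = solve-∀ ℚ-ring
  ρ-small : s * s * M ≤ℚ 1ℚ
  ρ-small = certify (lemma s M B)
    (0≤+ (0≤+ (0≤* (0≤square s) (≤⇒0≤ M≤B)) (0≤* (0≤* 0≤s 0≤B) (≤⇒0≤ s≤1)))
      (≤⇒0≤ (iteratedSquare-decay δ (ℚₚ.<⇒≤ 0<δ) δ≤1 r)))
    where
    lemma : ∀ s M B → 1ℚ - s * s * M ≡ s * s * (B - M) + s * B * (1ℚ - s) + (1ℚ - s * B)
    lemma = solve-∀ ℚ-ring
  c = iteratedSquare ½ (suc r)
  0<c : 0ℚ <ℚ c
  0<c = 0<iteratedSquare (ℚₚ.positive⁻¹ ½) (suc r)
  C⁻¹ = proj₁ (recip C 0<C)
  0<C⁻¹ = proj₁ (proj₂ (recip C 0<C))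
  CC : C * C⁻¹ ≡ 1ℚ
  CC = proj₂ (proj₂ (recip C 0<C))
  regroup : ∀ a b c → a * b * c ≡ a * (c * b)
  regroup = solve-∀ ℚ-ring

-- Hypercontractivity and Friedgut's junta theorem

replicate-⊙ : ∀ n ρ → replicate n ρ ⊙ replicate n ρ ≡ replicate n (ρ * ρ)
replicate-⊙ n ρ = Vecₚ.zipWith-replicate _*_ ρ ρ

-- M bounds the inverse of the smallest atom of P.
module Junta {Ω : Set} (P : Expectation Ω) (M : ℚ) (4≤M : 4ℚ ≤ℚ M)
  (domination : ∀ {h} → (∀ a → 0ℚ ≤ℚ h a) → ∀ a → h a ≤ℚ M * Expectation.ap P h) where

  open Noise P public

  private
    module P = Expectation P
    module 𝔼 {n} = Expectation (𝔼ₙ n)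

  -- ‖noise ρ f‖₄ ≤ ‖f‖₂, by induction on the dimension: in the first coordinate split
  -- f into its mean and a mean-zero part.
  hypercontractive : ∀ ρ → ρ * ρ * M ≤ℚ 1ℚ → ∀ {n} (f : Vec Ω n → ℚ) →
    let h = noise (replicate n ρ) f in
    𝔼 (λ v → (h v * h v) * (h v * h v)) ≤ℚ ⟪ f , f ⟫ * ⟪ f , f ⟫
  hypercontractive ρ ρ-small {zero} f = ℚₚ.≤-refl
  hypercontractive ρ ρ-small {suc n} f = begin
    𝔼 (λ w → (h w * h w) * (h w * h w))
      ≤⟨ 𝔼.ap-mono pointwise ⟩
    𝔼 (λ w → 1ℚ * U⁴ w + 4ρ * U³V w + 8ρ² * U²V² w + 3ρ⁴ * V⁴ w)
      ≡⟨ 𝔼.ap-combination₄ 1ℚ U⁴ 4ρ U³V 8ρ² U²V² 3ρ⁴ V⁴ ⟩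
    1ℚ * 𝔼 U⁴ + 4ρ * 𝔼 U³V + 8ρ² * 𝔼 U²V² + 3ρ⁴ * 𝔼 V⁴
      ≡⟨ cong (λ z → 1ℚ * 𝔼 U⁴ + 4ρ * z + 8ρ² * 𝔼 U²V² + 3ρ⁴ * 𝔼 V⁴) 𝔼U³V ⟩
    1ℚ * 𝔼 U⁴ + 4ρ * 0ℚ + 8ρ² * 𝔼 U²V² + 3ρ⁴ * 𝔼 V⁴
      -- Comparison with (A + B)²: the term AB needs 8ρ² ≤ 2 and the term B² needs 3ρ⁴M ≤ 1. Both
      -- follow from ρ²M ≤ 1 and 4 ≤ M.
      ≤⟨ certify (balance ρ M A B (𝔼 U⁴) (𝔼 U²V²) (𝔼 V⁴)) (0≤+ (0≤+ (0≤+ (0≤+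
          (≤⇒0≤ 𝔼U⁴) (0≤* 0≤8ρ² (≤⇒0≤ 𝔼U²V²))) (0≤* 0≤3ρ⁴ (≤⇒0≤ 𝔼V⁴)))
          (0≤* (0≤* 0≤2 0≤1-4ρ²) (0≤* 0≤A 0≤B)))
          (0≤* (0≤+ (0≤+ (0≤* (0≤* 0≤3 (0≤square ρ)) (≤⇒0≤ ρ-small)) 0≤1-4ρ²) (0≤square ρ)) (0≤square B))) ⟩
    (A + B) * (A + B)
      ≡⟨ cong (λ z → z * z) pythagoras ⟨
    ⟪ f , f ⟫ * ⟪ f , f ⟫ ∎
    where
    open ℚₚ.≤-Reasoning
    ρs = replicate n ρ
    h = noise (ρ ∷ ρs) f
    4ρ = 4ℚ * ρ
    8ρ² = 8ℚ * (ρ * ρ)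
    3ρ⁴ = 3ℚ * (ρ * ρ * (ρ * ρ))
    u : Vec Ω n → ℚ
    u = noise ρs (mean f)
    d : Ω → Vec Ω n → ℚ
    d a v = f (a ∷ v) - mean f v
    u′ v′ : Vec Ω (suc n) → ℚ
    u′ w = u (Vec.tail w)
    v′ w = noise ρs (λ t → f (Vec.head w ∷ t)) (Vec.tail w) - u (Vec.tail w)
    U⁴ U³V U²V² V⁴ : Vec Ω (suc n) → ℚ
    U⁴ w = (u′ w * u′ w) * (u′ w * u′ w)
    U³V w = u′ w * u′ w * u′ w * v′ w
    U²V² w = (u′ w * u′ w) * (v′ w * v′ w)
    V⁴ w = (v′ w * v′ w) * (v′ w * v′ w)
    A = ⟪ mean f , mean f ⟫
    Bₐ : Ω → ℚ
    Bₐ a = ⟪ d a , d a ⟫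
    B = P.ap Bₐ
    0≤A : 0ℚ ≤ℚ A
    0≤A = 𝔼.ap-nonneg (λ v → 0≤square (mean f v))
    0≤Bₐ : ∀ a → 0ℚ ≤ℚ Bₐ a
    0≤Bₐ a = 𝔼.ap-nonneg (λ v → 0≤square (d a v))
    0≤B : 0ℚ ≤ℚ B
    0≤B = P.ap-nonneg 0≤Bₐ
    0≤2 = ℚₚ.nonNegative⁻¹ 2ℚ
    0≤3 = ℚₚ.nonNegative⁻¹ 3ℚ
    0≤8ρ² = 0≤* (ℚₚ.nonNegative⁻¹ 8ℚ) (0≤square ρ)
    0≤3ρ⁴ = 0≤* 0≤3 (0≤square (ρ * ρ))
    0≤1-4ρ² : 0ℚ ≤ℚ 1ℚ - ρ * ρ * 4ℚ
    0≤1-4ρ² = ≤⇒0≤ (ℚₚ.≤-trans (*-monoˡ (ρ * ρ) (0≤square ρ) 4≤M) ρ-small)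
    balance : ∀ ρ M A B x y z → (A + B) * (A + B)
      - (1ℚ * x + (+ 4 / 1) * ρ * 0ℚ + (+ 8 / 1) * (ρ * ρ) * y + (+ 3 / 1) * (ρ * ρ * (ρ * ρ)) * z)
      ≡ (A * A - x) + (+ 8 / 1) * (ρ * ρ) * (A * B - y) + (+ 3 / 1) * (ρ * ρ * (ρ * ρ)) * (M * B * B - z)
        + (+ 2 / 1) * (1ℚ - ρ * ρ * (+ 4 / 1)) * (A * B)
        + ((+ 3 / 1) * (ρ * ρ) * (1ℚ - ρ * ρ * M) + (1ℚ - ρ * ρ * (+ 4 / 1)) + ρ * ρ) * (B * B)
    balance = solve-∀ ℚ-ring
    h-split : ∀ w → h w ≡ u′ w + ρ * v′ w
    h-split (a ∷ v) = trans (noise-∷ ρ ρs f a v) (lemma ρ _ (u v))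
      where
      lemma : ∀ ρ x u → ρ * x + (1ℚ - ρ) * u ≡ u + ρ * (x - u)
      lemma = solve-∀ ℚ-ring
    -- The odd term 4ρ³uv³ is at most 2ρ²u²v² + 2ρ⁴v⁴, which raises the binomial coefficients 6 and
    -- 1 to 8 and 3.
    pointwise : ∀ w → (h w * h w) * (h w * h w) ≤ℚ 1ℚ * U⁴ w + 4ρ * U³V w + 8ρ² * U²V² w + 3ρ⁴ * V⁴ w
    pointwise w = subst (λ z → (z * z) * (z * z) ≤ℚ 1ℚ * U⁴ w + 4ρ * U³V w + 8ρ² * U²V² w + 3ρ⁴ * V⁴ w)
      (sym (h-split w))
      (certify (lemma ρ (u′ w) (v′ w)) (0≤* 0≤2 (0≤square (ρ * (u′ w * v′ w) - ρ * ρ * (v′ w * v′ w)))))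
      where
      lemma : ∀ ρ u v → 1ℚ * ((u * u) * (u * u)) + (+ 4 / 1) * ρ * (u * u * u * v)
        + (+ 8 / 1) * (ρ * ρ) * ((u * u) * (v * v)) + (+ 3 / 1) * (ρ * ρ * (ρ * ρ)) * ((v * v) * (v * v))
        - ((u + ρ * v) * (u + ρ * v)) * ((u + ρ * v) * (u + ρ * v))
        ≡ (+ 2 / 1) * ((ρ * (u * v) - ρ * ρ * (v * v)) * (ρ * (u * v) - ρ * ρ * (v * v)))
      lemma = solve-∀ ℚ-ring
    𝔼U³V : 𝔼 U³V ≡ 0ℚ
    𝔼U³V = trans (P.ap-swap 𝔼.linear (λ a v → U³V (a ∷ v)))
      (trans (𝔼.ap-cong (λ v → trans (P.ap-* (u v * u v * u v) (λ a → v′ (a ∷ v)))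
          (trans (cong (u v * u v * u v *_) (mean-zero v)) (ℚₚ.*-zeroʳ (u v * u v * u v)))))
        (𝔼.ap-const {n} 0ℚ))
      where
      mean-zero : ∀ v → P.ap (λ a → v′ (a ∷ v)) ≡ 0ℚ
      mean-zero v = trans (P.ap-- (λ a → noise ρs (λ t → f (a ∷ t)) v) (λ _ → u v))
        (trans (cong₂ _-_ (noise-mean ρs f v) (P.ap-const (u v))) (ℚₚ.+-inverseʳ (u v)))
    𝔼U⁴ : 𝔼 U⁴ ≤ℚ A * A
    𝔼U⁴ = P.ap-≤const (A * A) (λ _ → hypercontractive ρ ρ-small (mean f))
    v′-noise : ∀ a v → noise ρs (d a) v ≡ v′ (a ∷ v)
    v′-noise a v = K.ap-- ρs v (λ t → f (a ∷ t)) (mean f)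
    slice-V⁴ : ∀ a → 𝔼 (λ v → V⁴ (a ∷ v)) ≤ℚ Bₐ a * Bₐ a
    slice-V⁴ a = subst (_≤ℚ Bₐ a * Bₐ a)
      (𝔼.ap-cong (λ v → cong (λ z → (z * z) * (z * z)) (v′-noise a v)))
      (hypercontractive ρ ρ-small (d a))
    -- The smallest atom enters here: `domination` bounds one factor `Bₐ a` by M·B, and the other
    -- averages to B.
    𝔼V⁴ : 𝔼 V⁴ ≤ℚ M * B * B
    𝔼V⁴ = ℚₚ.≤-trans
      (P.ap-mono (λ a → ℚₚ.≤-trans (slice-V⁴ a)
        (ℚₚ.*-monoʳ-≤-nonNeg (Bₐ a) {{nonNegative (0≤Bₐ a)}} (domination 0≤Bₐ a))))
      (ℚₚ.≤-reflexive (P.ap-* (M * B) Bₐ))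
    slice-U²V² : ∀ a → 𝔼 (λ v → U²V² (a ∷ v)) ≤ℚ A * Bₐ a
    slice-U²V² a = square-cancel-≤ (0≤* 0≤A (0≤Bₐ a))
      (ℚₚ.≤-trans (𝔼.cauchy-schwarz (λ v → u v * u v) (λ v → v′ (a ∷ v) * v′ (a ∷ v)))
        (ℚₚ.≤-trans (*-mono-≤ (𝔼.ap-nonneg (λ v → 0≤square (u v * u v)))
            (hypercontractive ρ ρ-small (mean f))
            (𝔼.ap-nonneg (λ v → 0≤square (v′ (a ∷ v) * v′ (a ∷ v)))) (slice-V⁴ a))
          (ℚₚ.≤-reflexive (lemma A (Bₐ a)))))
      where
      lemma : ∀ x y → x * x * (y * y) ≡ x * y * (x * y)
      lemma = solve-∀ ℚ-ring
    𝔼U²V² : 𝔼 U²V² ≤ℚ A * B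
    𝔼U²V² = ℚₚ.≤-trans (P.ap-mono slice-U²V²) (ℚₚ.≤-reflexive (P.ap-* A Bₐ))
    pythagoras : ⟪ f , f ⟫ ≡ A + B
    pythagoras = trans (recover ⟪ f , f ⟫ A) (cong (λ z → A + z) (sym B-value))
      where
      recover : ∀ x a → x ≡ a + (1ℚ * x + (- (1ℚ + 1ℚ)) * a + 1ℚ * a)
      recover = solve-∀ ℚ-ring
      expand : ∀ x y → (x - y) * (x - y) ≡ 1ℚ * (x * x) + (- (1ℚ + 1ℚ)) * (x * y) + 1ℚ * (y * y)
      expand = solve-∀ ℚ-ring
      B-value : B ≡ 1ℚ * ⟪ f , f ⟫ + (- (1ℚ + 1ℚ)) * A + 1ℚ * A
      B-value = trans
        (P.ap-cong (λ a → trans (𝔼.ap-cong (λ v → expand (f (a ∷ v)) (mean f v)))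
          (𝔼.ap-combination₃ 1ℚ (λ v → f (a ∷ v) * f (a ∷ v)) (- (1ℚ + 1ℚ)) (λ v → f (a ∷ v) * mean f v)
            1ℚ (λ v → mean f v * mean f v))))
        (trans (P.ap-combination₃ 1ℚ (λ a → ⟪ (λ v → f (a ∷ v)) , (λ v → f (a ∷ v)) ⟫)
            (- (1ℚ + 1ℚ)) (λ a → ⟪ (λ v → f (a ∷ v)) , mean f ⟫) 1ℚ (λ _ → A))
          (cong₂ (λ x y → 1ℚ * ⟪ f , f ⟫ + (- (1ℚ + 1ℚ)) * x + 1ℚ * y)
            (⟪⟫-mean f (mean f)) (P.ap-const A)))

  -- By Cauchy-Schwarz ⟨g, Tg⟩² ≤ ‖g‖²‖Tg‖², and ‖Tg‖² = ⟨g, T²g⟩. So squaring the noise parameter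
  -- at worst squares the ratio ⟨g, Tg⟩/‖g‖², and no spectral decomposition is required.
  noise-iteratedSquare : ∀ {n} (g : Vec Ω n → ℚ) → 0ℚ <ℚ ⟪ g , g ⟫ → ∀ σ c → 0ℚ ≤ℚ c →
    c * ⟪ g , g ⟫ ≤ℚ ⟪ g , noise (replicate n σ) g ⟫ →
    ∀ r → iteratedSquare c r * ⟪ g , g ⟫ ≤ℚ ⟪ g , noise (replicate n (iteratedSquare σ r)) g ⟫
  noise-iteratedSquare g 0<γ σ c 0≤c p zero = p
  noise-iteratedSquare {n} g 0<γ σ c 0≤c p (suc r) = *-cancelˡ γ 0<γ (begin
    γ * (cᵣ * cᵣ * γ)             ≡⟨ regroup γ cᵣ ⟩
    (cᵣ * γ) * (cᵣ * γ)           ≤⟨ *-mono-≤ 0≤cγ ih 0≤cγ ih ⟩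
    ⟪ g , h ⟫ * ⟪ g , h ⟫         ≤⟨ 𝔼.cauchy-schwarz g h ⟩
    γ * ⟪ h , h ⟫                 ≡⟨ cong (γ *_) (noise-isometry (replicate n σᵣ) g) ⟩
    γ * ⟪ g , noise (replicate n σᵣ ⊙ replicate n σᵣ) g ⟫
                                  ≡⟨ cong (λ z → γ * ⟪ g , noise z g ⟫) (replicate-⊙ n σᵣ) ⟩
    γ * ⟪ g , noise (replicate n (σᵣ * σᵣ)) g ⟫ ∎)
    where
    open ℚₚ.≤-Reasoning
    γ = ⟪ g , g ⟫
    cᵣ = iteratedSquare c r
    σᵣ = iteratedSquare σ r
    h = noise (replicate n σᵣ) g
    ih = noise-iteratedSquare g 0<γ σ c 0≤c p r
    0≤cγ : 0ℚ ≤ℚ cᵣ * γ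
    0≤cγ = 0≤* (0≤iteratedSquare 0≤c r) (ℚₚ.<⇒≤ 0<γ)
    regroup : ∀ x y → x * (y * y * x) ≡ (y * x) * (y * x)
    regroup = solve-∀ ℚ-ring

  -- Hypercontractivity in the dual form L^{4/3} → L².
  noise-small-support : ∀ {n} ρ → ρ * ρ * M ≤ℚ 1ℚ → ∀ (D : Vec Ω n → ℚ) (p : Vec Ω n → Bool) →
    (∀ v → D v * D v ≤ℚ 𝟙 (p v)) → (∀ v → D v ≡ D v * 𝟙 (p v)) →
    ∀ τ → 0ℚ ≤ℚ τ → 𝔼 (𝟙 ∘ p) ≤ℚ τ * τ →
    ⟪ noise (replicate n ρ) D , noise (replicate n ρ) D ⟫ ≤ℚ τ * 𝔼 (𝟙 ∘ p)
  noise-small-support {n} ρ ρ-small D p D²≤p D-support τ 0≤τ p-small with κ ℚₚ.≤? 0ℚ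
    where κ = ⟪ noise (replicate n ρ) D , noise (replicate n ρ) D ⟫
  ... | yes κ≤0 = ℚₚ.≤-trans κ≤0 (0≤* 0≤τ (𝔼.ap-nonneg (λ v → 0≤𝟙 (p v))))
  -- Two applications of Cauchy-Schwarz give κ⁴ ≤ π²S² ≤ π³κ², hence κ² ≤ π³ ≤ (τπ)². Bounding π by
  -- the square τ² avoids taking a root.
  ... | no κ≰0 = square-cancel-≤ (0≤* 0≤τ 0≤π) (*-cancelˡ (κ * κ) (0<* 0<κ 0<κ) (begin
    κ * κ * (κ * κ)             ≤⟨ *-mono-≤ (0≤square κ) κ²≤ (0≤square κ) κ²≤ ⟩
    π * S * (π * S)             ≡⟨ regroup₁ π S ⟩
    π * π * (S * S)             ≤⟨ *-monoˡ (π * π) (0≤square π) S²≤ ⟩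
    π * π * (π * (κ * κ))       ≡⟨ regroup₂ π (κ * κ) ⟩
    κ * κ * (π * π * π)         ≤⟨ *-monoˡ (κ * κ) (0≤square κ) (*-monoˡ (π * π) (0≤square π) p-small) ⟩
    κ * κ * (π * π * (τ * τ))   ≡⟨ cong (κ * κ *_) (regroup₃ π τ) ⟩
    κ * κ * (τ * π * (τ * π))   ∎))
    where
    open ℚₚ.≤-Reasoning
    ρs = replicate n ρ
    κ = ⟪ noise ρs D , noise ρs D ⟫
    π = 𝔼 (𝟙 ∘ p)
    k = noise ρs (noise ρs D)
    pk : Vec Ω n → ℚ
    pk v = 𝟙 (p v) * k v
    S = 𝔼 (λ v → pk v * pk v)
    0<κ : 0ℚ <ℚ κ
    0<κ = ℚₚ.≰⇒> κ≰0
    0≤π : 0ℚ ≤ℚ π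
    0≤π = 𝔼.ap-nonneg (λ v → 0≤𝟙 (p v))
    κ≡ : κ ≡ ⟪ D , pk ⟫
    κ≡ = trans (sym (noise-symmetric ρs D (noise ρs D)))
      (𝔼.ap-cong (λ v → trans (cong (_* k v) (D-support v)) (ℚₚ.*-assoc (D v) (𝟙 (p v)) (k v))))
    κ²≤ : κ * κ ≤ℚ π * S
    κ²≤ = subst (λ z → z * z ≤ℚ π * S) (sym κ≡)
      (ℚₚ.≤-trans (𝔼.cauchy-schwarz D pk)
        (ℚₚ.*-monoʳ-≤-nonNeg S {{nonNegative (𝔼.ap-nonneg (λ v → 0≤square (pk v)))}} (𝔼.ap-mono D²≤p)))
    square-𝟙 : ∀ b x → (𝟙 b * x) * (𝟙 b * x) ≡ 𝟙 b * (x * x)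
    square-𝟙 b x = trans (lemma (𝟙 b) x) (cong (_* (x * x)) (𝟙-idempotent b))
      where
      lemma : ∀ y x → (y * x) * (y * x) ≡ y * y * (x * x)
      lemma = solve-∀ ℚ-ring
    S²≤ : S * S ≤ℚ π * (κ * κ)
    S²≤ = begin
      S * S
        ≡⟨ cong (λ z → z * z) (𝔼.ap-cong (λ v → square-𝟙 (p v) (k v))) ⟩
      ⟪ 𝟙 ∘ p , (λ v → k v * k v) ⟫ * ⟪ 𝟙 ∘ p , (λ v → k v * k v) ⟫
        ≤⟨ 𝔼.cauchy-schwarz (𝟙 ∘ p) (λ v → k v * k v) ⟩
      ⟪ 𝟙 ∘ p , 𝟙 ∘ p ⟫ * 𝔼 (λ v → (k v * k v) * (k v * k v))
        ≡⟨ cong (_* 𝔼 (λ v → (k v * k v) * (k v * k v))) (𝔼.ap-cong (λ v → 𝟙-idempotent (p v))) ⟩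
      π * 𝔼 (λ v → (k v * k v) * (k v * k v))
        ≤⟨ *-monoˡ π 0≤π (hypercontractive ρ ρ-small (noise ρs D)) ⟩
      π * (κ * κ) ∎
    regroup₁ : ∀ x y → x * y * (x * y) ≡ x * x * (y * y)
    regroup₁ = solve-∀ ℚ-ring
    regroup₂ : ∀ x y → x * x * (x * y) ≡ y * (x * x * x)
    regroup₂ = solve-∀ ℚ-ring
    regroup₃ : ∀ x y → x * x * (y * y) ≡ y * x * (y * x)
    regroup₃ = solve-∀ ℚ-ring

  residual-noise : ∀ {n} (αs βs : Vec ℚ n) f v → residual αs (noise βs f) v ≡ noise βs (residual αs f) v
  residual-noise αs βs f v = trans
    (cong (λ z → noise βs f v - z) (trans (noise-noise αs βs f v)
      (trans (cong (λ z → noise z f v) (⊙-comm αs βs)) (sym (noise-noise βs αs f v)))))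
    (sym (K.ap-- βs v f (noise αs f)))

  residual-residual : ∀ {n} (αs βs : Vec ℚ n) f v → residual αs (residual βs f) v ≡ residual βs (residual αs f) v
  residual-residual αs βs f v = trans (cong (λ z → residual βs f v - z) (sym (residual-noise βs αs f v)))
    (trans (exchange (f v) (noise βs f v) (noise αs f v) (noise βs (noise αs f) v))
      (cong (λ z → residual αs f v - z) (sym (K.ap-- βs v f (noise αs f)))))
    where
    exchange : ∀ x b a c → x - b - (a - c) ≡ x - a - (b - c)
    exchange = solve-∀ ℚ-ring

  residual-contraction : ∀ {n} (αs : Vec ℚ n) → Idempotent αs → ∀ h →
    ⟪ residual αs h , residual αs h ⟫ ≤ℚ ⟪ h , h ⟫
  residual-contraction αs idem h = subst (_≤ℚ ⟪ h , h ⟫) (deficit-idempotent αs idem h)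
    (certify (lemma ⟪ h , h ⟫ ⟪ h , noise αs h ⟫) (subst (0ℚ ≤ℚ_)
      (trans (noise-isometry αs h) (cong (λ z → ⟪ h , noise z h ⟫) idem))
      (𝔼.ap-nonneg (λ v → 0≤square (noise αs h v)))))
    where
    lemma : ∀ x y → x - (x - y) ≡ y
    lemma = solve-∀ ℚ-ring

  -- Residuals commute and, being complementary projections, contract; so subtracting the projection
  -- of f raises no influence.
  deficit-residual : ∀ {n} (αs βs : Vec ℚ n) → Idempotent αs → Idempotent βs → ∀ f →
    deficit αs (residual βs f) ≤ℚ deficit αs f
  deficit-residual αs βs idem-α idem-β f = begin
    deficit αs (residual βs f)
      ≡⟨ deficit-idempotent αs idem-α (residual βs f) ⟩
    ⟪ residual αs (residual βs f) , residual αs (residual βs f) ⟫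
      ≡⟨ ⟪⟫-cong (residual-residual αs βs f) (residual-residual αs βs f) ⟩
    ⟪ residual βs (residual αs f) , residual βs (residual αs f) ⟫
      ≤⟨ residual-contraction βs idem-β (residual αs f) ⟩
    ⟪ residual αs f , residual αs f ⟫
      ≡⟨ deficit-idempotent αs idem-α f ⟨
    deficit αs f ∎
    where open ℚₚ.≤-Reasoning

  -- Friedgut's junta theorem. If g = residual (mask J) f were large, the small total influence
  -- would make it stable under tiny noise, hence (Cauchy–Schwarz, squaring) not too small
  -- after strong noise; but the strongly noised g is a sum of contributions from
  -- coordinates of small influence.
  junta : ∀ {η C} → 0ℚ <ℚ η → (c : JuntaConstants M η C) → let open JuntaConstants c in
    ∀ {n} (f : Vec Ω n → ℚ) (p : Fin n → Vec Ω n → Bool) →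
    (∀ i v → residual (except i) f v * residual (except i) f v ≤ℚ 𝟙 (p i v)) →
    (∀ i v → residual (except i) f v ≡ residual (except i) f v * 𝟙 (p i v)) →
    sum n (λ i → 𝔼 (𝟙 ∘ p i)) ≤ℚ C →
    (J : Vec Bool n) → (∀ i → lookup J i ≡ false → 𝔼 (𝟙 ∘ p i) ≤ℚ τ * τ) →
    deficit (mask J) f ≤ℚ η
  junta {η} {C} 0<η c {n} f p D²≤p D-support total J small = ℚₚ.≮⇒≥ λ η<γ′ →
    ℚₚ.<-irrefl refl (ℚₚ.<-≤-trans
      (ℚₚ.*-monoʳ-<-pos cᵣ {{positive (0<iteratedSquare (ℚₚ.positive⁻¹ ½) (suc r))}}
        (subst (η <ℚ_) (deficit-idempotent (mask J) idem f) η<γ′))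
      (ℚₚ.≤-trans (lower (subst (η <ℚ_) (deficit-idempotent (mask J) idem f) η<γ′))
        (ℚₚ.≤-trans upper τ-small)))
    where
    open JuntaConstants c
    cᵣ = iteratedSquare ½ (suc r)
    idem = mask-idempotent J
    g = residual (mask J) f
    γ = ⟪ g , g ⟫
    ρs = replicate n ρ
    σs = replicate n (1ℚ - δ)
    influence : Fin n → ℚ
    influence i = 𝔼 (𝟙 ∘ p i)
    0≤influence : ∀ i → 0ℚ ≤ℚ influence i
    0≤influence i = 𝔼.ap-nonneg (λ v → 0≤𝟙 (p i v))
    deficit≤influence : ∀ i → deficit (except i) f ≤ℚ influence i
    deficit≤influence i = subst (_≤ℚ influence i)
      (sym (deficit-idempotent (except i) (except-idempotent i) f)) (𝔼.ap-mono (D²≤p i))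
    σ-lookup : ∀ i → 1ℚ - lookup σs i ≡ δ
    σ-lookup i = trans (cong (λ z → 1ℚ - z) (Vecₚ.lookup-replicate i (1ℚ - δ))) (lemma δ)
      where
      lemma : ∀ δ → 1ℚ - (1ℚ - δ) ≡ δ
      lemma = solve-∀ ℚ-ring
    σ-bounds : ∀ i → 0ℚ ≤ℚ lookup σs i × lookup σs i ≤ℚ 1ℚ
    σ-bounds i = subst (0ℚ ≤ℚ_) (sym (Vecₚ.lookup-replicate i (1ℚ - δ))) (≤⇒0≤ δ≤1)
      , 0≤⇒≤ (subst (0ℚ ≤ℚ_) (sym (σ-lookup i)) 0≤δ)
    stable : deficit σs g ≤ℚ δ * C
    stable = begin
      deficit σs g
        ≤⟨ deficit-≤-sum σs σ-bounds g ⟩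
      sum n (λ i → (1ℚ - lookup σs i) * deficit (except i) g)
        ≡⟨ sum-cong n (λ i → cong (_* deficit (except i) g) (σ-lookup i)) ⟩
      sum n (λ i → δ * deficit (except i) g)
        ≤⟨ sum-mono n (λ i → *-monoˡ δ 0≤δ (ℚₚ.≤-trans
            (deficit-residual (except i) (mask J) (except-idempotent i) idem f) (deficit≤influence i))) ⟩
      sum n (λ i → δ * influence i)
        ≡⟨ sum-* n δ influence ⟩
      δ * sum n influence
        ≤⟨ *-monoˡ δ 0≤δ total ⟩
      δ * C ∎
      where open ℚₚ.≤-Reasoning
    lower : η <ℚ γ → cᵣ * γ ≤ℚ ⟪ noise ρs g , noise ρs g ⟫
    -- One squaring more than in ρ, because ‖Tg‖² for noise ρ is ⟨g, Tg⟩ for noise ρ².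
    lower η<γ = subst (cᵣ * γ ≤ℚ_)
      (trans (cong (λ z → ⟪ g , noise z g ⟫) (sym (replicate-⊙ n ρ))) (sym (noise-isometry ρs g)))
      (noise-iteratedSquare g (ℚₚ.<-trans 0<η η<γ) (1ℚ - δ) ½ (ℚₚ.nonNegative⁻¹ ½) start (suc r))
      where
      half : ∀ γ x δ C η → x - (+ 1 / 2) * γ ≡ (δ * C - (γ - x)) + (+ 1 / 2) * (γ - η) + (+ 1 / 2) * (η - (δ + δ) * C)
      half = solve-∀ ℚ-ring
      -- Weak noise loses at most δC ≤ η/2, which is less than γ/2.
      start : ½ * γ ≤ℚ ⟪ g , noise σs g ⟫
      start = certify (half γ ⟪ g , noise σs g ⟫ δ C η)
        (0≤+ (0≤+ (≤⇒0≤ stable) (0≤* (ℚₚ.nonNegative⁻¹ ½) (≤⇒0≤ (ℚₚ.<⇒≤ η<γ))))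
          (0≤* (ℚₚ.nonNegative⁻¹ ½) (≤⇒0≤ δ-small)))
    J-bounds : ∀ i → 0ℚ ≤ℚ lookup (mask J) i × lookup (mask J) i ≤ℚ 1ℚ
    J-bounds i = subst (0ℚ ≤ℚ_) (sym (Vecₚ.lookup-map i 𝟙 J)) (0≤𝟙 (lookup J i))
      , subst (_≤ℚ 1ℚ) (sym (Vecₚ.lookup-map i 𝟙 J)) (𝟙≤1 (lookup J i))
    h = noise ρs f
    noised-residual : ∀ i → deficit (except i) h ≡ ⟪ noise ρs (residual (except i) f) , noise ρs (residual (except i) f) ⟫
    noised-residual i = trans (deficit-idempotent (except i) (except-idempotent i) h)
      (⟪⟫-cong (residual-noise (except i) ρs f) (residual-noise (except i) ρs f))
    term : ∀ i → (1ℚ - lookup (mask J) i) * deficit (except i) h ≤ℚ τ * influence i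
    term i = subst (λ z → (1ℚ - z) * deficit (except i) h ≤ℚ τ * influence i) (sym (Vecₚ.lookup-map i 𝟙 J))
      (cases (lookup J i) refl)
      where
      cases : ∀ b → lookup J i ≡ b → (1ℚ - 𝟙 b) * deficit (except i) h ≤ℚ τ * influence i
      cases true e = ℚₚ.≤-trans (ℚₚ.≤-reflexive (ℚₚ.*-zeroˡ (deficit (except i) h)))
        (0≤* (ℚₚ.<⇒≤ 0<τ) (0≤influence i))
      cases false e = ℚₚ.≤-trans (ℚₚ.≤-reflexive (trans (ℚₚ.*-identityˡ (deficit (except i) h)) (noised-residual i)))
        (noise-small-support ρ ρ-small (residual (except i) f) (p i) (D²≤p i) (D-support i) τ (ℚₚ.<⇒≤ 0<τ) (small i e))
    upper : ⟪ noise ρs g , noise ρs g ⟫ ≤ℚ τ * C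
    upper = begin
      ⟪ noise ρs g , noise ρs g ⟫
        ≡⟨ ⟪⟫-cong (residual-noise (mask J) ρs f) (residual-noise (mask J) ρs f) ⟨
      ⟪ residual (mask J) h , residual (mask J) h ⟫
        ≡⟨ deficit-idempotent (mask J) idem h ⟨
      deficit (mask J) h
        ≤⟨ deficit-≤-sum (mask J) J-bounds h ⟩
      sum n (λ i → (1ℚ - lookup (mask J) i) * deficit (except i) h)
        ≤⟨ sum-mono n term ⟩
      sum n (λ i → τ * influence i)
        ≡⟨ sum-* n τ influence ⟩
      τ * sum n influence
        ≤⟨ *-monoˡ τ (ℚₚ.<⇒≤ 0<τ) total ⟩
      τ * C ∎
      where open ℚₚ.≤-Reasoning

-- Biased product measures and a discrete Russo inequality

pow : ℚ → ℕ → ℚ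
pow x zero = 1ℚ
pow x (suc n) = x * pow x n

0≤pow : ∀ {x} → 0ℚ ≤ℚ x → ∀ n → 0ℚ ≤ℚ pow x n
0≤pow p zero = 0≤1
0≤pow p (suc n) = 0≤* p (0≤pow p n)

pow≤1 : ∀ {x} → 0ℚ ≤ℚ x → x ≤ℚ 1ℚ → ∀ n → pow x n ≤ℚ 1ℚ
pow≤1 p q zero = ℚₚ.≤-refl
pow≤1 p q (suc n) = *-mono-≤ p q (0≤pow p n) (pow≤1 p q n)

pow-suc-≤ : ∀ {x} → 0ℚ ≤ℚ x → x ≤ℚ 1ℚ → ∀ n → pow x (suc n) ≤ℚ pow x n
pow-suc-≤ {x} p q n = certify (lemma x (pow x n)) (0≤* (≤⇒0≤ q) (0≤pow p n))
  where
  lemma : ∀ x y → y - x * y ≡ (1ℚ - x) * y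
  lemma = solve-∀ ℚ-ring

bernoulli : ∀ {x} → 0ℚ ≤ℚ x → x ≤ℚ 1ℚ → ∀ n → 1ℚ - fromℕ n * x ≤ℚ pow (1ℚ - x) n
bernoulli {x} p q zero = ℚₚ.≤-reflexive (trans (cong (λ z → 1ℚ - z * x) (fromℕ-def 0)) (lemma x))
  where
  lemma : ∀ x → 1ℚ - 0ℚ * x ≡ 1ℚ
  lemma = solve-∀ ℚ-ring
bernoulli {x} p q (suc n) = ℚₚ.≤-trans (ℚₚ.≤-reflexive (cong (λ z → 1ℚ - z * x) (fromℕ-suc n)))
  (certify (lemma x (fromℕ n) y)
    (0≤+ (≤⇒0≤ (bernoulli p q n)) (0≤* p (≤⇒0≤ (pow≤1 (≤⇒0≤ q) (certify (shift x) p) n)))))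
  where
  y = pow (1ℚ - x) n
  shift : ∀ x → 1ℚ - (1ℚ - x) ≡ x
  shift = solve-∀ ℚ-ring
  lemma : ∀ x k y → (1ℚ - x) * y - (1ℚ - (1ℚ + k) * x) ≡ (y - (1ℚ - k * x)) + x * (1ℚ - y)
  lemma = solve-∀ ℚ-ring

¼ ¾ : ℚ
¼ = + 1 / 4
¾ = + 3 / 4

record Rate : Set where
  no-eta-equality
  field
    rate : ℚ
    ¼≤rate : ¼ ≤ℚ rate
    rate≤¾ : rate ≤ℚ ¾
  0≤rate : 0ℚ ≤ℚ rate
  0≤rate = ℚₚ.≤-trans (ℚₚ.nonNegative⁻¹ ¼) ¼≤rate
  rate≤1 : rate ≤ℚ 1ℚ
  rate≤1 = ℚₚ.≤-trans rate≤¾ (0≤⇒≤ (ℚₚ.nonNegative⁻¹ (1ℚ - ¾)))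

open Rate public

module Coordinates (k : ℕ) where

  m : ℚ
  m = fromℕ (suc k)

  -- A coordinate pairs its membership in W with its value in G, so that one noise operator
  -- resamples both.
  Ω : Set
  Ω = Bool × Fin (suc k)

  𝕌 : Expectation (Fin (suc k))
  𝕌 = uniform k

  coordinate : Rate → Expectation Ω
  coordinate q = bit (rate q) (0≤rate q) (rate≤1 q) ⊗ 𝕌

  module U = Expectation 𝕌

  𝔼[_] : Rate → ∀ {n} → (Vec Ω n → ℚ) → ℚ
  𝔼[ q ] {n} = Expectation.ap (power (coordinate q) n)

  M : ℚ
  M = 4ℚ * m

  4≤M : 4ℚ ≤ℚ M
  4≤M = subst (_≤ℚ M) (ℚₚ.*-identityʳ (4ℚ))
    (*-monoˡ (4ℚ) (ℚₚ.nonNegative⁻¹ 4ℚ) (1≤fromℕ-suc k))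

  ≤m*𝕌 : ∀ {g : Fin (suc k) → ℚ} → (∀ x → 0ℚ ≤ℚ g x) → ∀ x → g x ≤ℚ m * U.ap g
  ≤m*𝕌 {g} p x = ℚₚ.≤-trans (term≤sum (suc k) p x) (ℚₚ.≤-reflexive (sym
    (trans (sym (ℚₚ.*-assoc m (1/suc k) (sum (suc k) g)))
      (trans (cong (_* sum (suc k) g) (suc*1/suc k)) (ℚₚ.*-identityˡ (sum (suc k) g))))))

  domination : ∀ (q : Rate) {h : Ω → ℚ} → (∀ a → 0ℚ ≤ℚ h a) → ∀ a → h a ≤ℚ M * Expectation.ap (coordinate q) h
  domination q {h} p (s , x) = ℚₚ.≤-trans (≤m*𝕌 (λ y → p (s , y)) x) (scale s)
    where
    A = U.ap (λ y → h (true , y))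
    B = U.ap (λ y → h (false , y))
    0≤A : 0ℚ ≤ℚ A
    0≤A = U.ap-nonneg (λ y → p (true , y))
    0≤B : 0ℚ ≤ℚ B
    0≤B = U.ap-nonneg (λ y → p (false , y))
    0≤m = 0≤fromℕ (suc k)
    lemma₁ : ∀ m q a b → (+ 4 / 1) * m * (q * a + (1ℚ - q) * b) - m * a
      ≡ (+ 4 / 1) * m * ((q - + 1 / 4) * a) + (+ 4 / 1) * m * ((1ℚ - q) * b)
    lemma₁ = solve-∀ ℚ-ring
    lemma₂ : ∀ m q a b → (+ 4 / 1) * m * (q * a + (1ℚ - q) * b) - m * b
      ≡ (+ 4 / 1) * m * ((+ 3 / 4 - q) * b) + (+ 4 / 1) * m * (q * a)
    lemma₂ = solve-∀ ℚ-ring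
    0≤4m = 0≤* (ℚₚ.nonNegative⁻¹ 4ℚ) 0≤m
    scale : ∀ s → m * U.ap (λ y → h (s , y)) ≤ℚ M * (rate q * A + (1ℚ - rate q) * B)
    scale true = certify (lemma₁ m (rate q) A B)
      (0≤+ (0≤* 0≤4m (0≤* (≤⇒0≤ (¼≤rate q)) 0≤A)) (0≤* 0≤4m (0≤* (≤⇒0≤ (rate≤1 q)) 0≤B)))
    scale false = certify (lemma₂ m (rate q) A B)
      (0≤+ (0≤* 0≤4m (0≤* (≤⇒0≤ (rate≤¾ q)) 0≤B)) (0≤* 0≤4m (0≤* (0≤rate q) 0≤A)))

  setBit : ∀ {n} → Fin n → Bool → Vec Ω n → Vec Ω n
  setBit i s v = v [ i ]≔ (s , proj₂ (lookup v i))

  ∂ : ∀ {n} → Fin n → (Vec Ω n → ℚ) → Vec Ω n → ℚ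
  ∂ i f v = f (setBit i true v) - f (setBit i false v)

  Monotone : ∀ {n} → (Vec Ω n → ℚ) → Set
  Monotone f = ∀ i v → 0ℚ ≤ℚ ∂ i f v

  -- In each coordinate the density of rate q′ relative to rate q is at least θ, hence at least θⁿ
  -- on the product. This replaces continuity in the rate.
  change-of-measure : ∀ (q q′ : Rate) θ → 0ℚ ≤ℚ θ →
    θ * rate q ≤ℚ rate q′ → θ * (1ℚ - rate q) ≤ℚ 1ℚ - rate q′ →
    ∀ {n} (g : Vec Ω n → ℚ) → (∀ v → 0ℚ ≤ℚ g v) → pow θ n * 𝔼[ q ] g ≤ℚ 𝔼[ q′ ] g
  change-of-measure q q′ θ 0≤θ p₁ p₀ {zero} g 0≤g = ℚₚ.≤-reflexive (ℚₚ.*-identityˡ (g []))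
  change-of-measure q q′ θ 0≤θ p₁ p₀ {suc n} g 0≤g = begin
    θ * pow θ n * Q.ap (λ a → 𝔼[ q ] (λ v → g (a ∷ v)))
      ≡⟨ ℚₚ.*-assoc θ (pow θ n) (Q.ap (λ a → 𝔼[ q ] (λ v → g (a ∷ v)))) ⟩
    θ * (pow θ n * Q.ap (λ a → 𝔼[ q ] (λ v → g (a ∷ v))))
      ≡⟨ cong (θ *_) (Q.ap-* (pow θ n) (λ a → 𝔼[ q ] (λ v → g (a ∷ v)))) ⟨
    θ * Q.ap (λ a → pow θ n * 𝔼[ q ] (λ v → g (a ∷ v)))
      ≤⟨ *-monoˡ θ 0≤θ (Q.ap-mono (λ a → change-of-measure q q′ θ 0≤θ p₁ p₀ (λ v → g (a ∷ v)) (λ v → 0≤g (a ∷ v)))) ⟩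
    θ * Q.ap G
      ≤⟨ certify (lemma θ (rate q) (rate q′) (U.ap (λ x → G (true , x))) (U.ap (λ x → G (false , x))))
          (0≤+ (0≤* (≤⇒0≤ p₁) (U.ap-nonneg (λ x → 0≤G (true , x)))) (0≤* (≤⇒0≤ p₀) (U.ap-nonneg (λ x → 0≤G (false , x))))) ⟩
    Expectation.ap (coordinate q′) G ∎
    where
    open ℚₚ.≤-Reasoning
    module Q = Expectation (coordinate q)
    G : Ω → ℚ
    G a = 𝔼[ q′ ] (λ v → g (a ∷ v))
    0≤G : ∀ a → 0ℚ ≤ℚ G a
    0≤G a = Expectation.ap-nonneg (power (coordinate q′) n) (λ v → 0≤g (a ∷ v))
    lemma : ∀ θ q q′ x y → q′ * x + (1ℚ - q′) * y - θ * (q * x + (1ℚ - q) * y)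
      ≡ (q′ - θ * q) * x + (1ℚ - q′ - θ * (1ℚ - q)) * y
    lemma = solve-∀ ℚ-ring

  -- The coordinates are moved from q to q′ one at a time. Moving coordinate i gains (q′ - q) times
  -- the mean of ∂ᵢf, taken with the earlier coordinates at q and the later ones at q′;
  -- `change-of-measure` returns the later ones to q at the price of the factor c.
  russo : ∀ (q q′ : Rate) → rate q ≤ℚ rate q′ → ∀ θ → 0ℚ ≤ℚ θ → θ ≤ℚ 1ℚ →
    θ * (1ℚ - rate q) ≤ℚ 1ℚ - rate q′ →
    ∀ {n} (f : Vec Ω n → ℚ) → Monotone f → ∀ c → 0ℚ ≤ℚ c → c ≤ℚ pow θ n →
    c * (rate q′ - rate q) * sum n (λ i → 𝔼[ q ] (∂ i f)) ≤ℚ 𝔼[ q′ ] f - 𝔼[ q ] f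
  russo q q′ q≤q′ θ 0≤θ θ≤1 p₀ {zero} f mono c 0≤c c≤ =
    ℚₚ.≤-reflexive (trans (ℚₚ.*-zeroʳ (c * (rate q′ - rate q))) (sym (ℚₚ.+-inverseʳ (f []))))
  russo q q′ q≤q′ θ 0≤θ θ≤1 p₀ {suc n} f mono c 0≤c c≤ = begin
    c * h * (𝔼[ q ] (∂ zero f) + sum n (λ i → 𝔼[ q ] (∂ (suc i) f)))
      ≡⟨ cong₂ (λ x y → c * h * (x + y)) first (sum-swap n Q.linear (λ i a → 𝔼[ q ] (∂ i (slice a)))) ⟩
    c * h * (U.ap (λ x → 𝔼[ q ] (g x)) + Q.ap (λ a → sum n (λ i → 𝔼[ q ] (∂ i (slice a)))))
      ≡⟨ distrib c h (U.ap (λ x → 𝔼[ q ] (g x))) (Q.ap (λ a → sum n (λ i → 𝔼[ q ] (∂ i (slice a))))) ⟩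
    h * (c * U.ap (λ x → 𝔼[ q ] (g x))) + c * h * Q.ap (λ a → sum n (λ i → 𝔼[ q ] (∂ i (slice a))))
      ≤⟨ ℚₚ.+-mono-≤ (*-monoˡ h 0≤h left) right ⟩
    h * (U.ap (λ x → G (true , x)) - U.ap (λ x → G (false , x))) + (Q.ap G - Q.ap F)
      ≡⟨ recombine (rate q) (rate q′) (U.ap (λ x → G (true , x))) (U.ap (λ x → G (false , x))) (Q.ap F) ⟨
    𝔼[ q′ ] f - 𝔼[ q ] f ∎
    where
    open ℚₚ.≤-Reasoning
    module Q = Expectation (coordinate q)
    module 𝔼q = Expectation (power (coordinate q) n)
    module 𝔼q′ = Expectation (power (coordinate q′) n)
    h = rate q′ - rate q
    0≤h = ≤⇒0≤ q≤q′
    slice : Ω → Vec Ω n → ℚ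
    slice a v = f (a ∷ v)
    g : Fin (suc k) → Vec Ω n → ℚ
    g x v = f ((true , x) ∷ v) - f ((false , x) ∷ v)
    0≤g : ∀ x v → 0ℚ ≤ℚ g x v
    0≤g x v = mono zero ((true , x) ∷ v)
    F G : Ω → ℚ
    F a = 𝔼[ q ] (slice a)
    G a = 𝔼[ q′ ] (slice a)
    first : 𝔼[ q ] (∂ zero f) ≡ U.ap (λ x → 𝔼[ q ] (g x))
    first = lemma (rate q) (U.ap (λ x → 𝔼[ q ] (g x)))
      where
      lemma : ∀ q x → q * x + (1ℚ - q) * x ≡ x
      lemma = solve-∀ ℚ-ring
    distrib : ∀ c h x y → c * h * (x + y) ≡ h * (c * x) + c * h * y
    distrib = solve-∀ ℚ-ring
    recombine : ∀ q q′ a b z → q′ * a + (1ℚ - q′) * b - z ≡ (q′ - q) * (a - b) + (q * a + (1ℚ - q) * b - z)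
    recombine = solve-∀ ℚ-ring
    c≤pow : c ≤ℚ pow θ n
    c≤pow = ℚₚ.≤-trans c≤ (pow-suc-≤ 0≤θ θ≤1 n)
    θq≤q′ : θ * rate q ≤ℚ rate q′
    θq≤q′ = ℚₚ.≤-trans (subst (θ * rate q ≤ℚ_) (ℚₚ.*-identityˡ (rate q))
      (ℚₚ.*-monoʳ-≤-nonNeg (rate q) {{nonNegative (0≤rate q)}} θ≤1)) q≤q′
    left : c * U.ap (λ x → 𝔼[ q ] (g x)) ≤ℚ U.ap (λ x → G (true , x)) - U.ap (λ x → G (false , x))
    left = begin
      c * U.ap (λ x → 𝔼[ q ] (g x))
        ≡⟨ U.ap-* c (λ x → 𝔼[ q ] (g x)) ⟨
      U.ap (λ x → c * 𝔼[ q ] (g x))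
        ≤⟨ U.ap-mono (λ x → ℚₚ.≤-trans
            (ℚₚ.*-monoʳ-≤-nonNeg (𝔼[ q ] (g x)) {{nonNegative (𝔼q.ap-nonneg (0≤g x))}} c≤pow)
            (change-of-measure q q′ θ 0≤θ θq≤q′ p₀ (g x) (0≤g x))) ⟩
      U.ap (λ x → 𝔼[ q′ ] (g x))
        ≡⟨ U.ap-cong (λ x → 𝔼q′.ap-- (slice (true , x)) (slice (false , x))) ⟩
      U.ap (λ x → G (true , x) - G (false , x))
        ≡⟨ U.ap-- (λ x → G (true , x)) (λ x → G (false , x)) ⟩
      U.ap (λ x → G (true , x)) - U.ap (λ x → G (false , x)) ∎
    right : c * h * Q.ap (λ a → sum n (λ i → 𝔼[ q ] (∂ i (slice a)))) ≤ℚ Q.ap G - Q.ap F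
    right = begin
      c * h * Q.ap (λ a → sum n (λ i → 𝔼[ q ] (∂ i (slice a))))
        ≡⟨ Q.ap-* (c * h) (λ a → sum n (λ i → 𝔼[ q ] (∂ i (slice a)))) ⟨
      Q.ap (λ a → c * h * sum n (λ i → 𝔼[ q ] (∂ i (slice a))))
        ≤⟨ Q.ap-mono (λ a → russo q q′ q≤q′ θ 0≤θ θ≤1 p₀ (slice a) (λ i v → mono (suc i) (a ∷ v)) c 0≤c c≤pow) ⟩
      Q.ap (λ a → G a - F a)
        ≡⟨ Q.ap-- G F ⟩
      Q.ap G - Q.ap F ∎

  𝔼-monotone : ∀ (q q′ : Rate) → rate q ≤ℚ rate q′ → ∀ {n} (f : Vec Ω n → ℚ) → Monotone f →
    𝔼[ q ] f ≤ℚ 𝔼[ q′ ] f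
  𝔼-monotone q q′ q≤q′ {n} f mono = 0≤⇒≤ (subst (_≤ℚ 𝔼[ q′ ] f - 𝔼[ q ] f)
    (lemma (rate q′ - rate q) (sum n (λ i → 𝔼[ q ] (∂ i f))))
    -- With θ = c = 0 the side conditions are trivial and only the sign of the increment is left.
    (russo q q′ q≤q′ 0ℚ ℚₚ.≤-refl 0≤1 (ℚₚ.≤-trans (ℚₚ.≤-reflexive (ℚₚ.*-zeroˡ (1ℚ - rate q))) (≤⇒0≤ (rate≤1 q′)))
      f mono 0ℚ ℚₚ.≤-refl (0≤pow ℚₚ.≤-refl n)))
    where
    lemma : ∀ x y → 0ℚ * x * y ≡ 0ℚ
    lemma = solve-∀ ℚ-ring

-- Choosing a rate with small total influence

split-average : ∀ x y z k c → z - x ≤ℚ (1ℚ + k) * c → z - y ≤ℚ c ⊎ y - x ≤ℚ k * c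
split-average x y z k c p with (z - y) ℚₚ.≤? c
... | yes q = inj₁ q
... | no ¬q = inj₂ (certify (lemma x y z k c) (0≤+ (≤⇒0≤ p) (≤⇒0≤ (ℚₚ.<⇒≤ (ℚₚ.≰⇒> ¬q)))))
  where
  lemma : ∀ x y z k c → k * c - (y - x) ≡ ((1ℚ + k) * c - (z - x)) + ((z - y) - c)
  lemma = solve-∀ ℚ-ring

averaging : ∀ N (a : ℕ → ℚ) c → a (suc N) - a 0 ≤ℚ fromℕ (suc N) * c →
  ∃ λ j → j ≤ N × a (suc j) - a j ≤ℚ c
averaging zero a c p = 0 , z≤n ,
  ℚₚ.≤-trans p (ℚₚ.≤-reflexive (trans (cong (_* c) (fromℕ-def 1)) (ℚₚ.*-identityˡ c)))
averaging (suc N) a c p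
  with split-average (a 0) (a (suc N)) (a (suc (suc N))) (fromℕ (suc N)) c
    (subst (λ z → a (suc (suc N)) - a 0 ≤ℚ z * c) (fromℕ-suc (suc N)) p)
... | inj₁ q = suc N , ℕₚ.≤-refl , q
... | inj₂ q with averaging N a c q
...   | j , j≤N , r = j , ℕₚ.m≤n⇒m≤1+n j≤N , r

-- Pigeonhole on two scales: the flat step is found inside a flat cell, so that values at the step
-- can later be compared with those at the boundaries of its cell.
averaging₂ : ∀ L W (b : ℕ → ℚ) c w → b (suc L ℕ.* suc W) - b 0 ≤ℚ fromℕ (suc L) * c → fromℕ (suc W) * w ≡ c →
  ∃ λ l → ∃ λ j → l ≤ L × j ≤ W × b (suc l ℕ.* suc W) - b (l ℕ.* suc W) ≤ℚ c
    × b (suc (j ℕ.+ l ℕ.* suc W)) - b (j ℕ.+ l ℕ.* suc W) ≤ℚ w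
averaging₂ L W b c w total W*w with averaging L (λ l → b (l ℕ.* suc W)) c total
... | l , l≤L , rise with averaging W (λ j → b (j ℕ.+ l ℕ.* suc W)) w
  (subst (b (suc l ℕ.* suc W) - b (l ℕ.* suc W) ≤ℚ_) (sym W*w) rise)
...   | j , j≤W , step = l , j , l≤L , j≤W , rise , step

-- The rates from ¼ to ¾ are divided into suc L cells of suc W steps each.
module Grid (n L W : ℕ) (1≤n : 1 ≤ n) (W≡4n : suc W ≡ 4 ℕ.* n) where

  cap : ℕ
  cap = suc L ℕ.* suc W

  w : ℚ
  w = 1/suc L * 1/suc W

  0<w : 0ℚ <ℚ w
  0<w = 0<* (0<1/suc L) (0<1/suc W)

  0≤w : 0ℚ ≤ℚ w
  0≤w = ℚₚ.<⇒≤ 0<w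

  cap*w : fromℕ cap * w ≡ 1ℚ
  cap*w = trans (cong (_* w) (fromℕ-* (suc L) (suc W)))
    (trans (lemma (fromℕ (suc L)) (fromℕ (suc W)) (1/suc L) (1/suc W))
      (cong₂ _*_ (suc*1/suc L) (suc*1/suc W)))
    where
    lemma : ∀ a b c d → a * b * (c * d) ≡ a * c * (b * d)
    lemma = solve-∀ ℚ-ring

  W*w : fromℕ (suc W) * w ≡ 1/suc L
  W*w = trans (lemma (fromℕ (suc W)) (1/suc L) (1/suc W))
    (trans (cong (1/suc L *_) (suc*1/suc W)) (ℚₚ.*-identityʳ (1/suc L)))
    where
    lemma : ∀ a b c → a * (b * c) ≡ b * (a * c)
    lemma = solve-∀ ℚ-ring

  1/suc≤1 : 1/suc L ≤ℚ 1ℚ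
  1/suc≤1 = subst (1/suc L ≤ℚ_) (suc*1/suc L)
    (subst (_≤ℚ fromℕ (suc L) * 1/suc L) (ℚₚ.*-identityˡ (1/suc L))
      (ℚₚ.*-monoʳ-≤-nonNeg (1/suc L) {{nonNegative (ℚₚ.<⇒≤ (0<1/suc L))}} (1≤fromℕ-suc L)))

  abstract
    -- Truncation at `cap` makes every natural number a valid index, so `grid` needs no bound on its
    -- argument.
    gridRate : ℕ → ℚ
    gridRate t = ¼ + ½ * (fromℕ (t ℕ.⊓ cap) * w)

    ¼≤gridRate : ∀ t → ¼ ≤ℚ gridRate t
    ¼≤gridRate t = certify (lemma (fromℕ (t ℕ.⊓ cap) * w)) (0≤* (ℚₚ.nonNegative⁻¹ ½) (0≤* (0≤fromℕ (t ℕ.⊓ cap)) 0≤w))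
      where
      lemma : ∀ x → + 1 / 4 + (+ 1 / 2) * x - + 1 / 4 ≡ (+ 1 / 2) * x
      lemma = solve-∀ ℚ-ring

    gridRate≤¾ : ∀ t → gridRate t ≤ℚ ¾
    gridRate≤¾ t = certify (lemma (fromℕ (t ℕ.⊓ cap) * w)) (0≤* (ℚₚ.nonNegative⁻¹ ½) (≤⇒0≤
      (ℚₚ.≤-trans (ℚₚ.*-monoʳ-≤-nonNeg w {{nonNegative 0≤w}} (fromℕ-mono (ℕₚ.m⊓n≤n t cap)))
        (ℚₚ.≤-reflexive cap*w))))
      where
      lemma : ∀ x → + 3 / 4 - (+ 1 / 4 + (+ 1 / 2) * x) ≡ (+ 1 / 2) * (1ℚ - x)
      lemma = solve-∀ ℚ-ring

    gridRate-mono : ∀ {t t′} → t ≤ t′ → gridRate t ≤ℚ gridRate t′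
    gridRate-mono {t} {t′} p = ℚₚ.+-monoʳ-≤ ¼ (*-monoˡ ½ (ℚₚ.nonNegative⁻¹ ½)
      (ℚₚ.*-monoʳ-≤-nonNeg w {{nonNegative 0≤w}} (fromℕ-mono (ℕₚ.⊓-monoˡ-≤ cap p))))

    gridRate-step : ∀ {t} → t < cap → gridRate (suc t) ≡ gridRate t + ½ * w
    gridRate-step {t} p = trans
      (cong (λ z → ¼ + ½ * (fromℕ z * w)) (ℕₚ.m≤n⇒m⊓n≡m p))
      (trans (cong (λ z → ¼ + ½ * (z * w)) (fromℕ-suc t))
        (trans (lemma (fromℕ t) w)
          (cong (λ z → ¼ + ½ * (fromℕ z * w) + ½ * w) (sym (ℕₚ.m≤n⇒m⊓n≡m (ℕₚ.<⇒≤ p))))))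
      where
      lemma : ∀ x w → + 1 / 4 + (+ 1 / 2) * ((1ℚ + x) * w) ≡ + 1 / 4 + (+ 1 / 2) * (x * w) + (+ 1 / 2) * w
      lemma = solve-∀ ℚ-ring

  grid : ℕ → Rate
  grid t = record { rate = gridRate t ; ¼≤rate = ¼≤gridRate t ; rate≤¾ = gridRate≤¾ t }

  module _ (k : ℕ) where

    open Coordinates k

    step-influence : ∀ t → t < cap → ∀ (f : Vec Ω n → ℚ) → Monotone f →
      𝔼[ grid (suc t) ] f - 𝔼[ grid t ] f ≤ℚ w → sum n (λ i → 𝔼[ grid t ] (∂ i f)) ≤ℚ 4ℚ
    step-influence t t<cap f mono rise = *-cancelˡ w 0<w
      (ℚₚ.≤-trans (ℚₚ.≤-reflexive (scale w S)) (ℚₚ.≤-trans (*-monoˡ (4ℚ) (ℚₚ.nonNegative⁻¹ 4ℚ) bound)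
        (ℚₚ.≤-reflexive (ℚₚ.*-comm (4ℚ) w))))
      where
      q = rate (grid t)
      S = sum n (λ i → 𝔼[ grid t ] (∂ i f))
      scale : ∀ w s → w * s ≡ (+ 4 / 1) * ((+ 1 / 2) * ((+ 1 / 2) * w) * s)
      scale = solve-∀ ℚ-ring
      -- A step raises the rate by w/2 while 1 - q ≥ ¼, so 1 - q shrinks at most by the factor 1 -
      -- 2w. As `suc W` is 4n, Bernoulli's inequality gives θⁿ ≥ 1 - 2nw ≥ ½.
      θ = 1ℚ - (w + w)
      4nw≤1 : 4ℚ * fromℕ n * w ≤ℚ 1ℚ
      4nw≤1 = subst (_≤ℚ 1ℚ) (trans (sym W*w) (cong (_* w) (trans (cong fromℕ W≡4n) (trans (fromℕ-* 4 n) (cong (_* fromℕ n) (fromℕ-def 4)))))) 1/suc≤1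
      4w≤1 : 4ℚ * w ≤ℚ 1ℚ
      4w≤1 = ℚₚ.≤-trans (certify (lemma w (fromℕ n)) (0≤* (0≤* (ℚₚ.nonNegative⁻¹ 4ℚ)
          (≤⇒0≤ (subst (_≤ℚ fromℕ n) (fromℕ-def 1) (fromℕ-mono 1≤n)))) 0≤w)) 4nw≤1
        where
        lemma : ∀ w x → (+ 4 / 1) * x * w - (+ 4 / 1) * w ≡ (+ 4 / 1) * (x - 1ℚ) * w
        lemma = solve-∀ ℚ-ring
      0≤2w = 0≤+ 0≤w 0≤w
      2w≤1 : w + w ≤ℚ 1ℚ
      2w≤1 = certify (lemma w) (0≤+ (≤⇒0≤ 4w≤1) 0≤2w)
        where
        lemma : ∀ w → 1ℚ - (w + w) ≡ (1ℚ - (+ 4 / 1) * w) + (w + w)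
        lemma = solve-∀ ℚ-ring
      ½≤pow : ½ ≤ℚ pow θ n
      ½≤pow = ℚₚ.≤-trans (certify (lemma w (fromℕ n)) (0≤* (ℚₚ.nonNegative⁻¹ ½) (≤⇒0≤ 4nw≤1)))
        (bernoulli 0≤2w 2w≤1 n)
        where
        lemma : ∀ w x → 1ℚ - x * (w + w) - + 1 / 2 ≡ (+ 1 / 2) * (1ℚ - (+ 4 / 1) * x * w)
        lemma = solve-∀ ℚ-ring
      rate-gap : θ * (1ℚ - q) ≤ℚ 1ℚ - rate (grid (suc t))
      rate-gap = subst (λ z → θ * (1ℚ - q) ≤ℚ 1ℚ - z) (sym (gridRate-step t<cap))
        (certify (lemma q w) (0≤* 0≤2w (≤⇒0≤ (rate≤¾ (grid t)))))
        where
        lemma : ∀ q w → 1ℚ - (q + (+ 1 / 2) * w) - (1ℚ - (w + w)) * (1ℚ - q) ≡ (w + w) * (+ 3 / 4 - q)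
        lemma = solve-∀ ℚ-ring
      h≡ : rate (grid (suc t)) - q ≡ ½ * w
      h≡ = trans (cong (_- q) (gridRate-step t<cap)) (lemma q (½ * w))
        where
        lemma : ∀ x y → x + y - x ≡ y
        lemma = solve-∀ ℚ-ring
      -- One ½ bounds θⁿ and the other comes from the width w/2 of a step; together they account for
      -- the 4 in the conclusion.
      bound : ½ * (½ * w) * S ≤ℚ w
      bound = ℚₚ.≤-trans
        (subst (λ z → ½ * z * S ≤ℚ 𝔼[ grid (suc t) ] f - 𝔼[ grid t ] f) h≡
          (russo (grid t) (grid (suc t)) (gridRate-mono (ℕₚ.n≤1+n t)) θ (≤⇒0≤ 2w≤1)
            (certify (lemma w) 0≤2w) rate-gap f mono ½ (ℚₚ.nonNegative⁻¹ ½) ½≤pow))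
        rise
        where
        lemma : ∀ w → 1ℚ - (1ℚ - (w + w)) ≡ w + w
        lemma = solve-∀ ℚ-ring

    low-influence : ∀ (f : Vec Ω n → ℚ) → Monotone f → (∀ v → 0ℚ ≤ℚ f v) → (∀ v → f v ≤ℚ 1ℚ) →
      ∃ λ l → ∃ λ j → l ≤ L × j ≤ W
        × 𝔼[ grid (suc l ℕ.* suc W) ] f - 𝔼[ grid (l ℕ.* suc W) ] f ≤ℚ 1/suc L
        × sum n (λ i → 𝔼[ grid (j ℕ.+ l ℕ.* suc W) ] (∂ i f)) ≤ℚ 4ℚ
    low-influence f mono 0≤f f≤1 = conclude (averaging₂ L W (λ t → 𝔼[ grid t ] f) (1/suc L) w total W*w)
      where
      lemma : ∀ x y → 1ℚ - (x - y) ≡ (1ℚ - x) + y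
      lemma = solve-∀ ℚ-ring
      total : 𝔼[ grid (suc L ℕ.* suc W) ] f - 𝔼[ grid 0 ] f ≤ℚ fromℕ (suc L) * 1/suc L
      total = subst (𝔼[ grid (suc L ℕ.* suc W) ] f - 𝔼[ grid 0 ] f ≤ℚ_) (sym (suc*1/suc L))
        (certify (lemma (𝔼[ grid (suc L ℕ.* suc W) ] f) (𝔼[ grid 0 ] f))
          (0≤+ (≤⇒0≤ (Expectation.ap-≤const (power (coordinate (grid (suc L ℕ.* suc W))) n) 1ℚ f≤1))
            (Expectation.ap-nonneg (power (coordinate (grid 0)) n) 0≤f)))
      conclude : (∃ λ l → ∃ λ j → l ≤ L × j ≤ W
          × 𝔼[ grid (suc l ℕ.* suc W) ] f - 𝔼[ grid (l ℕ.* suc W) ] f ≤ℚ 1/suc L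
          × 𝔼[ grid (suc (j ℕ.+ l ℕ.* suc W)) ] f - 𝔼[ grid (j ℕ.+ l ℕ.* suc W) ] f ≤ℚ w) →
        ∃ λ l → ∃ λ j → l ≤ L × j ≤ W
          × 𝔼[ grid (suc l ℕ.* suc W) ] f - 𝔼[ grid (l ℕ.* suc W) ] f ≤ℚ 1/suc L
          × sum n (λ i → 𝔼[ grid (j ℕ.+ l ℕ.* suc W) ] (∂ i f)) ≤ℚ 4ℚ
      conclude (l , j , l≤L , j≤W , rise , step) = l , j , l≤L , j≤W , rise ,
        step-influence (j ℕ.+ l ℕ.* suc W)
          (ℕₚ.<-≤-trans (s≤s (ℕₚ.+-monoˡ-≤ (l ℕ.* suc W) j≤W)) (ℕₚ.*-monoˡ-≤ (suc W) (s≤s l≤L))) f mono step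

-- The set reached through the free coordinates

dec-sound : ∀ {A : Set} (d : Dec A) → does d ≡ true → A
dec-sound (yes a) _ = a

dec-refute : ∀ {A : Set} (d : Dec A) → does d ≡ false → ¬ A
dec-refute (no ¬a) _ = ¬a

bool-antisym : ∀ b c → (b ≡ true → c ≡ true) → (c ≡ true → b ≡ true) → b ≡ c
bool-antisym true c f g = sym (f refl)
bool-antisym false true f g = g refl
bool-antisym false false f g = refl

∨-false : ∀ b c → b ∨ c ≡ false → b ≡ false × c ≡ false
∨-false false false e = refl , refl

𝟙-mono : ∀ b c → (b ≡ true → c ≡ true) → 𝟙 b ≤ℚ 𝟙 c
𝟙-mono true c p = subst (λ z → 1ℚ ≤ℚ 𝟙 z) (sym (p refl)) ℚₚ.≤-refl
𝟙-mono false c p = 0≤𝟙 c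

searchVec : ∀ {k n} {Q : Vec (Fin k) n → Set} → (∀ v → Dec (Q v)) → Dec (∃ Q)
searchVec {n = zero} Q? with Q? []
... | yes q = yes ([] , q)
... | no ¬q = no λ { ([] , q) → ¬q q }
searchVec {n = suc n} Q? with Finₚ.any? (λ a → searchVec (λ v → Q? (a ∷ v)))
... | yes (a , v , q) = yes (a ∷ v , q)
... | no ¬q = no λ { (a ∷ v , q) → ¬q (a , v , q) }

-- Two features of Z = z₀ - Z₀ are abstracted: it contains 0, and a nonempty set closed under adding
-- its elements is all of G, which is how the generation of G by Z is expressed.
module Reachability (k : ℕ) (R : Fin (suc k) → Fin (suc k) → Bool)
  (R-refl : ∀ x → R x x ≡ true)
  (R-connected : ∀ (Y : Fin (suc k) → Bool) → (∀ b x → Y b ≡ true → R b x ≡ true → Y x ≡ true) →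
    ∀ x y → Y x ≡ true → Y y ≡ true) where

  open Coordinates k

  Step : Bool → Fin (suc k) → Fin (suc k) → Set
  Step true b x = R b x ≡ true
  Step false b x = b ≡ x

  step? : ∀ s b x → Dec (Step s b x)
  step? true b x = R b x Boolₚ.≟ true
  step? false b x = b Finₚ.≟ x

  step-refl : ∀ s x → Step s x x
  step-refl true x = R-refl x
  step-refl false x = refl

  free : ∀ {n} → Vec Bool n → Vec Ω n → Fin n → Bool
  free J ω i = not (lookup J i) ∧ proj₁ (lookup ω i)

  point : ∀ {n} → Vec Ω n → Fin n → Fin (suc k)
  point ω i = proj₂ (lookup ω i)

  Reaches : ∀ {n} → Vec Bool n → (Vec (Fin (suc k)) n → Bool) → Vec Ω n → Vec (Fin (suc k)) n → Set
  Reaches J B ω b = B b ≡ true × (∀ i → Step (free J ω i) (lookup b i) (point ω i))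

  reaches? : ∀ {n} (J : Vec Bool n) B (ω : Vec Ω n) → Dec (∃ (Reaches J B ω))
  reaches? J B ω = searchVec (λ b → (B b Boolₚ.≟ true) ×-dec Finₚ.all? (λ i → step? (free J ω i) (lookup b i) (point ω i)))

  -- In the paper's terms, with R b x meaning x ∈ b + z₀ - Z₀: the indicator of
  -- B + (z₀ - Z₀)^{W \ J}, where W is the set of coordinates whose bit is true.
  reach : ∀ {n} → Vec Bool n → (Vec (Fin (suc k)) n → Bool) → Vec Ω n → Bool
  reach J B ω = does (reaches? J B ω)

  reach-sound : ∀ {n} (J : Vec Bool n) B ω → reach J B ω ≡ true → ∃ (Reaches J B ω)
  reach-sound J B ω = dec-sound (reaches? J B ω)

  reach-complete : ∀ {n} (J : Vec Bool n) B ω → ∃ (Reaches J B ω) → reach J B ω ≡ true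
  reach-complete J B ω r = dec-true (reaches? J B ω) r

  _⊆_ : ∀ {n} → Vec Bool n → Vec Bool n → Set
  J ⊆ J′ = ∀ i → lookup J i ≡ true → lookup J′ i ≡ true

  -- A coordinate that is freed by shrinking J may keep its value, by `R-refl`; the same witness
  -- therefore works.
  reach-antitone : ∀ {n} (J J′ : Vec Bool n) → J ⊆ J′ → ∀ B ω → reach J′ B ω ≡ true → reach J B ω ≡ true
  reach-antitone J J′ J⊆J′ B ω r with reach-sound J′ B ω r
  ... | b , Bb , steps = reach-complete J B ω (b , Bb , λ i →
    weaken (lookup J i) (lookup J′ i) (proj₁ (lookup ω i)) (J⊆J′ i) (steps i))
    where
    weaken : ∀ j j′ s {b x} → (j ≡ true → j′ ≡ true) → Step (not j′ ∧ s) b x → Step (not j ∧ s) b x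
    weaken true true s p q = q
    weaken true false s p q with p refl
    ... | ()
    weaken false false s p q = q
    weaken false true true {x = x} p q = subst (λ z → Step true z x) (sym q) (step-refl true x)
    weaken false true false p q = q

  transport-steps : ∀ {n} (J : Vec Bool n) i (ω : Vec Ω n) c c′ (b : Vec (Fin (suc k)) n) →
    Step (not (lookup J i) ∧ proj₁ c′) (lookup b i) (proj₂ c′) →
    (∀ j → Step (free J (ω [ i ]≔ c) j) (lookup b j) (point (ω [ i ]≔ c) j)) →
    ∀ j → Step (free J (ω [ i ]≔ c′) j) (lookup b j) (point (ω [ i ]≔ c′) j)
  transport-steps J i ω c c′ b at-i steps j with i Finₚ.≟ j
  ... | yes refl = subst (λ z → Step (not (lookup J i) ∧ proj₁ z) (lookup b i) (proj₂ z))
    (sym (Vecₚ.lookup∘updateAt i ω)) at-i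
  ... | no i≢j = subst (λ z → Step (not (lookup J j) ∧ proj₁ z) (lookup b j) (proj₂ z))
    (trans (Vecₚ.lookup∘updateAt′ j i (i≢j ∘ sym) ω) (sym (Vecₚ.lookup∘updateAt′ j i (i≢j ∘ sym) ω))) (steps j)

  step-at : ∀ {n} (J : Vec Bool n) i (ω : Vec Ω n) c (b : Vec (Fin (suc k)) n) →
    (∀ j → Step (free J (ω [ i ]≔ c) j) (lookup b j) (point (ω [ i ]≔ c) j)) →
    Step (not (lookup J i) ∧ proj₁ c) (lookup b i) (proj₂ c)
  step-at J i ω c b steps = subst (λ z → Step (not (lookup J i) ∧ proj₁ z) (lookup b i) (proj₂ z))
    (Vecₚ.lookup∘updateAt i ω) (steps i)

  -- With bit `false` the witness must equal b at i, so once the bit is `true` a single R-step leads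
  -- to x.
  fibre-grow : ∀ {n} (J : Vec Bool n) B i (ω : Vec Ω n) b x → lookup J i ≡ false →
    reach J B (ω [ i ]≔ (false , b)) ≡ true → R b x ≡ true → reach J B (ω [ i ]≔ (true , x)) ≡ true
  fibre-grow J B i ω b x J∌i r Rbx with reach-sound J B (ω [ i ]≔ (false , b)) r
  ... | c , Bc , steps = reach-complete J B (ω [ i ]≔ (true , x)) (c , Bc ,
    transport-steps J i ω (false , b) (true , x) c (subst (λ j → Step (not j ∧ true) (lookup c i) x) (sym J∌i)
      (subst (λ z → R z x ≡ true) (sym c≡b) Rbx)) steps)
    where
    c≡b : lookup c i ≡ b
    c≡b = subst (λ j → Step (not j ∧ false) (lookup c i) b) J∌i (step-at J i ω (false , b) c steps)

  fibre-shrink : ∀ {n} (J : Vec Bool n) B i (ω : Vec Ω n) x → lookup J i ≡ false →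
    reach J B (ω [ i ]≔ (true , x)) ≡ true → ∃ λ b → reach J B (ω [ i ]≔ (false , b)) ≡ true
  fibre-shrink J B i ω x J∌i r with reach-sound J B (ω [ i ]≔ (true , x)) r
  ... | c , Bc , steps = lookup c i , reach-complete J B (ω [ i ]≔ (false , lookup c i)) (c , Bc ,
    transport-steps J i ω (true , x) (false , lookup c i) c
      (subst (λ j → Step (not j ∧ false) (lookup c i) (lookup c i)) (sym J∌i) refl) steps)

  raise : ∀ {n} (J : Vec Bool n) B i (ω : Vec Ω n) x →
    reach J B (ω [ i ]≔ (false , x)) ≡ true → reach J B (ω [ i ]≔ (true , x)) ≡ true
  raise J B i ω x r with reach-sound J B (ω [ i ]≔ (false , x)) r
  ... | c , Bc , steps = reach-complete J B (ω [ i ]≔ (true , x)) (c , Bc ,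
    transport-steps J i ω (false , x) (true , x) c
      (step-up (lookup J i) (step-at J i ω (false , x) c steps)) steps)
    where
    step-up : ∀ j → Step (not j ∧ false) (lookup c i) x → Step (not j ∧ true) (lookup c i) x
    step-up true e = e
    step-up false e = subst (λ z → Step true z x) (sym e) (step-refl true x)

  𝟏 : ∀ {n} → Vec Bool n → (Vec (Fin (suc k)) n → Bool) → Vec Ω n → ℚ
  𝟏 J B ω = 𝟙 (reach J B ω)

  𝟏-monotone : ∀ {n} (J : Vec Bool n) B → Monotone (𝟏 J B)
  𝟏-monotone J B i ω = ≤⇒0≤ (𝟙-mono _ _ (raise J B i ω (point ω i)))

  𝟏-antitone : ∀ {n} (J J′ : Vec Bool n) → J ⊆ J′ → ∀ B ω → 𝟏 J′ B ω ≤ℚ 𝟏 J B ω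
  𝟏-antitone J J′ J⊆J′ B ω = 𝟙-mono _ _ (reach-antitone J J′ J⊆J′ B ω)

  jump? : ∀ {n} (J : Vec Bool n) B i (ω : Vec Ω n) →
    Dec (∃ λ x → reach J B (ω [ i ]≔ (true , x)) ≡ true × reach J B (ω [ i ]≔ (false , x)) ≡ false)
  jump? J B i ω = Finₚ.any? (λ x → (reach J B (ω [ i ]≔ (true , x)) Boolₚ.≟ true)
    ×-dec (reach J B (ω [ i ]≔ (false , x)) Boolₚ.≟ false))

  -- On J the bit is inert, so the absence of a jump says nothing about how the value matters; these
  -- coordinates are declared pivotal by fiat.
  pivotal : ∀ {n} → Vec Bool n → (Vec (Fin (suc k)) n → Bool) → Fin n → Vec Ω n → Bool
  pivotal J B i ω = lookup J i ∨ does (jump? J B i ω)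

  -- By connectedness a fibre that does not grow is empty or full.
  fibre-constant : ∀ {n} (J : Vec Bool n) B i (ω : Vec Ω n) → pivotal J B i ω ≡ false →
    ∀ a a′ → reach J B (ω [ i ]≔ a) ≡ reach J B (ω [ i ]≔ a′)
  fibre-constant J B i ω p a a′ = bool-antisym _ _ (spread a a′) (spread a′ a)
    where
    J∌i : lookup J i ≡ false
    J∌i = proj₁ (∨-false (lookup J i) _ p)
    no-jump : ∀ x → reach J B (ω [ i ]≔ (true , x)) ≡ true → reach J B (ω [ i ]≔ (false , x)) ≡ true
    no-jump x r = Boolₚ.¬-not (λ e → dec-refute (jump? J B i ω) (proj₂ (∨-false (lookup J i) _ p)) (x , r , e))
    Y : Fin (suc k) → Bool
    Y x = reach J B (ω [ i ]≔ (false , x))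
    Y-full : ∀ x y → Y x ≡ true → Y y ≡ true
    Y-full = R-connected Y (λ b x Yb Rbx → no-jump x (fibre-grow J B i ω b x J∌i Yb Rbx))
    to-false : ∀ c → reach J B (ω [ i ]≔ c) ≡ true → ∃ λ b → Y b ≡ true
    to-false (true , x) r = fibre-shrink J B i ω x J∌i r
    to-false (false , x) r = x , r
    from-false : ∀ c b → Y b ≡ true → reach J B (ω [ i ]≔ c) ≡ true
    from-false (true , x) b Yb = raise J B i ω x (Y-full b x Yb)
    from-false (false , x) b Yb = Y-full b x Yb
    spread : ∀ c c′ → reach J B (ω [ i ]≔ c) ≡ true → reach J B (ω [ i ]≔ c′) ≡ true
    spread c c′ r = from-false c′ (proj₁ (to-false c r)) (proj₂ (to-false c r))

-- Influences and junta approximation of the reached set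

fromℕ-∣∣ : ∀ {n} (J : Subset n) → fromℕ ∣ J ∣ ≡ sum n (λ i → 𝟙 (lookup J i))
fromℕ-∣∣ [] = fromℕ-def 0
fromℕ-∣∣ (true ∷ J) = trans (fromℕ-suc ∣ J ∣) (cong (λ z → 1ℚ + z) (fromℕ-∣∣ J))
fromℕ-∣∣ {suc n} (false ∷ J) = trans (fromℕ-∣∣ J) (sym (ℚₚ.+-identityˡ (sum n (λ i → 𝟙 (lookup J i)))))

enlarge : ∀ {n} → Vec Bool n → ℚ → (Fin n → ℚ) → Vec Bool n
enlarge J c π = tabulate (λ i → lookup J i ∨ does (c ℚₚ.<? π i))

enlarge-small : ∀ {n} (J : Vec Bool n) c π i → lookup (enlarge J c π) i ≡ false → π i ≤ℚ c
enlarge-small J c π i e = ℚₚ.≮⇒≥ (dec-refute (c ℚₚ.<? π i)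
  (proj₂ (∨-false (lookup J i) (does (c ℚₚ.<? π i)) (trans (sym (Vecₚ.lookup∘tabulate _ i)) e))))

enlarge-⊇ : ∀ {n} (J : Vec Bool n) c π i → lookup J i ≡ true → lookup (enlarge J c π) i ≡ true
enlarge-⊇ J c π i e = trans (Vecₚ.lookup∘tabulate _ i) (cong (_∨ does (c ℚₚ.<? π i)) e)

-- Markov's inequality: each added coordinate has π i > c and so contributes at least 1 to c⁻¹ times
-- the sum.
enlarge-size : ∀ {n} (J : Vec Bool n) c c⁻¹ π → 0ℚ ≤ℚ c⁻¹ → c * c⁻¹ ≡ 1ℚ → (∀ i → 0ℚ ≤ℚ π i) →
  fromℕ ∣ enlarge J c π ∣ ≤ℚ fromℕ ∣ J ∣ + c⁻¹ * sum n π
enlarge-size {n} J c c⁻¹ π 0≤c⁻¹ cc 0≤π = begin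
  fromℕ ∣ enlarge J c π ∣
    ≡⟨ fromℕ-∣∣ (enlarge J c π) ⟩
  sum n (λ i → 𝟙 (lookup (enlarge J c π) i))
    ≤⟨ sum-mono n (λ i → subst (λ z → 𝟙 z ≤ℚ 𝟙 (lookup J i) + c⁻¹ * π i)
        (sym (Vecₚ.lookup∘tabulate (λ i → lookup J i ∨ does (c ℚₚ.<? π i)) i)) (term i (lookup J i) (c ℚₚ.<? π i))) ⟩
  sum n (λ i → 𝟙 (lookup J i) + c⁻¹ * π i)
    ≡⟨ sum-+ n (λ i → 𝟙 (lookup J i)) (λ i → c⁻¹ * π i) ⟩
  sum n (λ i → 𝟙 (lookup J i)) + sum n (λ i → c⁻¹ * π i)
    ≡⟨ cong₂ _+_ (sym (fromℕ-∣∣ J)) (sum-* n c⁻¹ π) ⟩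
  fromℕ ∣ J ∣ + c⁻¹ * sum n π ∎
  where
  open ℚₚ.≤-Reasoning
  0≤extra : ∀ i → 0ℚ ≤ℚ c⁻¹ * π i
  0≤extra i = 0≤* 0≤c⁻¹ (0≤π i)
  cancel : ∀ x y → x + y - x ≡ y
  cancel = solve-∀ ℚ-ring
  term : ∀ i b (d : Dec (c <ℚ π i)) → 𝟙 (b ∨ does d) ≤ℚ 𝟙 b + c⁻¹ * π i
  term i true d = certify (cancel 1ℚ (c⁻¹ * π i)) (0≤extra i)
  term i false (no _) = certify (cancel 0ℚ (c⁻¹ * π i)) (0≤extra i)
  term i false (yes p) = ℚₚ.≤-trans (ℚₚ.≤-reflexive (trans (sym cc) (ℚₚ.*-comm c c⁻¹)))
    (ℚₚ.≤-trans (*-monoˡ c⁻¹ 0≤c⁻¹ (ℚₚ.<⇒≤ p)) (ℚₚ.≤-reflexive (sym (ℚₚ.+-identityˡ (c⁻¹ * π i)))))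

module Influences (k : ℕ) (R : Fin (suc k) → Fin (suc k) → Bool)
  (R-refl : ∀ x → R x x ≡ true)
  (R-connected : ∀ (Y : Fin (suc k) → Bool) → (∀ b x → Y b ≡ true → R b x ≡ true → Y x ≡ true) →
    ∀ x y → Y x ≡ true → Y y ≡ true)
  (q : Rate) where

  open Coordinates k public
  open Reachability k R R-refl R-connected public
  open Junta (coordinate q) M 4≤M (domination q) public

  private
    module P = Expectation (coordinate q)
    module 𝔼 {n} = Expectation (𝔼ₙ n)

  0≤𝟏 : ∀ {n} (J : Vec Bool n) B ω → 0ℚ ≤ℚ 𝟏 J B ω
  0≤𝟏 J B ω = 0≤𝟙 (reach J B ω)

  𝟏≤1 : ∀ {n} (J : Vec Bool n) B ω → 𝟏 J B ω ≤ℚ 1ℚ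
  𝟏≤1 J B ω = 𝟙≤1 (reach J B ω)

  noise-except : ∀ {n} (i : Fin n) f (v : Vec Ω n) → noise (except i) f v ≡ P.ap (λ a → f (v [ i ]≔ a))
  noise-except {suc n} zero f (a ∷ v) = trans
    (lemma (noise (ones n) (λ w → f (a ∷ w)) v) (P.ap (λ b → noise (ones n) (λ w → f (b ∷ w)) v)))
    (P.ap-cong (λ b → noise-ones (λ w → f (b ∷ w)) v))
    where
    lemma : ∀ x y → 0ℚ * x + (1ℚ - 0ℚ) * y ≡ y
    lemma = solve-∀ ℚ-ring
  noise-except {suc n} (suc i) f (a ∷ v) = trans
    (lemma (noise (except i) (λ w → f (a ∷ w)) v) (P.ap (λ b → noise (except i) (λ w → f (b ∷ w)) v)))
    (noise-except i (λ w → f (a ∷ w)) v)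
    where
    lemma : ∀ x y → 1ℚ * x + (1ℚ - 1ℚ) * y ≡ x
    lemma = solve-∀ ℚ-ring

  module _ {n} (J : Vec Bool n) (B : Vec (Fin (suc k)) n → Bool) where

    residual≡0 : ∀ i ω → pivotal J B i ω ≡ false → residual (except i) (𝟏 J B) ω ≡ 0ℚ
    residual≡0 i ω p = trans (cong (λ z → 𝟏 J B ω - z) (trans (noise-except i (𝟏 J B) ω)
      (trans (P.ap-cong (λ a → cong 𝟙 (trans (fibre-constant J B i ω p a (lookup ω i))
          (cong (reach J B) (Vecₚ.[]≔-lookup ω i)))))
        (P.ap-const (𝟏 J B ω))))) (ℚₚ.+-inverseʳ (𝟏 J B ω))

    residual²≤1 : ∀ i ω → residual (except i) (𝟏 J B) ω * residual (except i) (𝟏 J B) ω ≤ℚ 1ℚ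
    residual²≤1 i ω = certify (lemma (𝟏 J B ω) N) (0≤* (0≤+ (≤⇒0≤ (𝟏≤1 J B ω)) 0≤N) (0≤+ (≤⇒0≤ N≤1) (0≤𝟏 J B ω)))
      where
      N = noise (except i) (𝟏 J B) ω
      0≤N : 0ℚ ≤ℚ N
      0≤N = subst (0ℚ ≤ℚ_) (sym (noise-except i (𝟏 J B) ω)) (P.ap-nonneg (λ a → 0≤𝟏 J B (ω [ i ]≔ a)))
      N≤1 : N ≤ℚ 1ℚ
      N≤1 = subst (_≤ℚ 1ℚ) (sym (noise-except i (𝟏 J B) ω)) (P.ap-≤const 1ℚ (λ a → 𝟏≤1 J B (ω [ i ]≔ a)))
      lemma : ∀ f N → 1ℚ - (f - N) * (f - N) ≡ ((1ℚ - f) + N) * ((1ℚ - N) + f)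
      lemma = solve-∀ ℚ-ring

    residual²≤pivotal : ∀ i ω → residual (except i) (𝟏 J B) ω * residual (except i) (𝟏 J B) ω ≤ℚ 𝟙 (pivotal J B i ω)
    residual²≤pivotal i ω = cases (pivotal J B i ω) refl
      where
      D = residual (except i) (𝟏 J B) ω
      cases : ∀ b → pivotal J B i ω ≡ b → D * D ≤ℚ 𝟙 b
      cases true e = residual²≤1 i ω
      cases false e = ℚₚ.≤-reflexive (trans (cong (_* D) (residual≡0 i ω e)) (ℚₚ.*-zeroˡ D))

    residual-support : ∀ i ω →
      residual (except i) (𝟏 J B) ω ≡ residual (except i) (𝟏 J B) ω * 𝟙 (pivotal J B i ω)
    residual-support i ω = cases (pivotal J B i ω) refl
      where
      D = residual (except i) (𝟏 J B) ω
      cases : ∀ b → pivotal J B i ω ≡ b → D ≡ D * 𝟙 b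
      cases true e = sym (ℚₚ.*-identityʳ D)
      cases false e = trans (residual≡0 i ω e) (sym (ℚₚ.*-zeroʳ D))

    -- A jump at a single value x already makes the mean rise over uniform values at least 1/m. This
    -- is where influences of values are paid for by influences of bits.
    pivotal≤ : ∀ i ω → 𝟙 (pivotal J B i ω) ≤ℚ 𝟙 (lookup J i) + m * noise (except i) (∂ i (𝟏 J B)) ω
    pivotal≤ i ω = cases (lookup J i) (jump? J B i ω)
      where
      N = noise (except i) (∂ i (𝟏 J B)) ω
      rise : Fin (suc k) → ℚ
      rise x = 𝟏 J B (ω [ i ]≔ (true , x)) - 𝟏 J B (ω [ i ]≔ (false , x))
      0≤rise : ∀ x → 0ℚ ≤ℚ rise x
      0≤rise x = ≤⇒0≤ (𝟙-mono _ _ (raise J B i ω x))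
      ∂-update : ∀ s x → ∂ i (𝟏 J B) (ω [ i ]≔ (s , x)) ≡ rise x
      ∂-update s x = cong₂ (λ z z′ → 𝟏 J B z - 𝟏 J B z′) (update true) (update false)
        where
        update : ∀ s′ → (ω [ i ]≔ (s , x)) [ i ]≔ (s′ , proj₂ (lookup (ω [ i ]≔ (s , x)) i)) ≡ ω [ i ]≔ (s′ , x)
        update s′ = trans (Vecₚ.[]≔-idempotent ω i)
          (cong (λ z → ω [ i ]≔ (s′ , proj₂ z)) (Vecₚ.lookup∘updateAt i ω))
      N≡ : N ≡ U.ap rise
      N≡ = trans (noise-except i (∂ i (𝟏 J B)) ω)
        (trans (P.ap-cong {g = λ a → rise (proj₂ a)} (λ { (s , x) → ∂-update s x })) (lemma (rate q) (U.ap rise)))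
        where
        lemma : ∀ q x → q * x + (1ℚ - q) * x ≡ x
        lemma = solve-∀ ℚ-ring
      0≤mN : 0ℚ ≤ℚ m * N
      0≤mN = 0≤* (0≤fromℕ (suc k)) (subst (0ℚ ≤ℚ_) (sym N≡) (U.ap-nonneg 0≤rise))
      cancel : ∀ x y → x + y - x ≡ y
      cancel = solve-∀ ℚ-ring
      cases : ∀ b (d : Dec (∃ λ x → reach J B (ω [ i ]≔ (true , x)) ≡ true × reach J B (ω [ i ]≔ (false , x)) ≡ false)) →
        𝟙 (b ∨ does d) ≤ℚ 𝟙 b + m * N
      cases true d = certify (cancel 1ℚ (m * N)) 0≤mN
      cases false (no _) = certify (cancel 0ℚ (m * N)) 0≤mN
      cases false (yes (x , e₁ , e₀)) = ℚₚ.≤-trans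
        (subst (_≤ℚ m * U.ap rise) (cong₂ (λ b c → 𝟙 b - 𝟙 c) e₁ e₀) (≤m*𝕌 0≤rise x))
        (ℚₚ.≤-reflexive (trans (cong (m *_) (sym N≡)) (sym (ℚₚ.+-identityˡ (m * N)))))

    influence : Fin n → ℚ
    influence i = 𝔼 (𝟙 ∘ pivotal J B i)

    0≤influence : ∀ i → 0ℚ ≤ℚ influence i
    0≤influence i = 𝔼.ap-nonneg (λ ω → 0≤𝟙 (pivotal J B i ω))

    influence≤ : ∀ i → influence i ≤ℚ 𝟙 (lookup J i) + m * 𝔼 (∂ i (𝟏 J B))
    influence≤ i = begin
      influence i
        ≤⟨ 𝔼.ap-mono (pivotal≤ i) ⟩
      𝔼 (λ ω → 𝟙 (lookup J i) + m * noise (except i) (∂ i (𝟏 J B)) ω)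
        ≡⟨ 𝔼.ap-+ {n} (λ _ → 𝟙 (lookup J i)) (λ ω → m * noise (except i) (∂ i (𝟏 J B)) ω) ⟩
      𝔼 {n} (λ _ → 𝟙 (lookup J i)) + 𝔼 (λ ω → m * noise (except i) (∂ i (𝟏 J B)) ω)
        ≡⟨ cong₂ _+_ (𝔼.ap-const {n} (𝟙 (lookup J i)))
            (trans (𝔼.ap-* m (noise (except i) (∂ i (𝟏 J B)))) (cong (m *_) (𝔼-noise (except i) (∂ i (𝟏 J B))))) ⟩
      𝟙 (lookup J i) + m * 𝔼 (∂ i (𝟏 J B)) ∎
      where open ℚₚ.≤-Reasoning

    total-influence : ∀ s → ∣ J ∣ ≤ s → sum n (λ i → 𝔼 (∂ i (𝟏 J B))) ≤ℚ 4ℚ →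
      sum n influence ≤ℚ fromℕ s + m * 4ℚ
    total-influence s ∣J∣≤s low = begin
      sum n influence
        ≤⟨ sum-mono n influence≤ ⟩
      sum n (λ i → 𝟙 (lookup J i) + m * 𝔼 (∂ i (𝟏 J B)))
        ≡⟨ sum-+ n (λ i → 𝟙 (lookup J i)) (λ i → m * 𝔼 (∂ i (𝟏 J B))) ⟩
      sum n (λ i → 𝟙 (lookup J i)) + sum n (λ i → m * 𝔼 (∂ i (𝟏 J B)))
        ≡⟨ cong₂ _+_ (sym (fromℕ-∣∣ J)) (sum-* n m (λ i → 𝔼 (∂ i (𝟏 J B)))) ⟩
      fromℕ ∣ J ∣ + m * sum n (λ i → 𝔼 (∂ i (𝟏 J B)))
        ≤⟨ ℚₚ.+-mono-≤ (fromℕ-mono ∣J∣≤s) (*-monoˡ m (0≤fromℕ (suc k)) low) ⟩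
      fromℕ s + m * 4ℚ ∎
      where open ℚₚ.≤-Reasoning

  junta-approximation : ∀ {η s} → 0ℚ <ℚ η → (c : JuntaConstants M η (fromℕ s + m * 4ℚ)) →
    let open JuntaConstants c in ∀ {n} (J : Vec Bool n) B → ∣ J ∣ ≤ s →
    sum n (λ i → 𝔼 (∂ i (𝟏 J B))) ≤ℚ 4ℚ →
    deficit (mask (enlarge J (τ * τ) (influence J B))) (𝟏 J B) ≤ℚ η
  junta-approximation {s = s} 0<η c J B ∣J∣≤s low = junta 0<η c (𝟏 J B) (pivotal J B)
    (residual²≤pivotal J B) (residual-support J B) (total-influence J B s ∣J∣≤s low)
    (enlarge J (τ * τ) (influence J B)) (enlarge-small J (τ * τ) (influence J B))
    where open JuntaConstants c

  -- The residual of f′ is that of f minus that of f - f′, and (x - y)² ≤ 2x² + 2y². Since f - f′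
  -- takes values in [0, 1], its square is at most itself.
  deficit-perturb : ∀ {n} (αs : Vec ℚ n) → Idempotent αs → ∀ f f′ →
    (∀ v → f′ v ≤ℚ f v) → (∀ v → f v - f′ v ≤ℚ 1ℚ) →
    deficit αs f′ ≤ℚ 2ℚ * deficit αs f + 2ℚ * (𝔼 f - 𝔼 f′)
  deficit-perturb αs idem f f′ f′≤f gap≤1 = begin
    deficit αs f′
      ≡⟨ deficit-idempotent αs idem f′ ⟩
    𝔼 (λ v → residual αs f′ v * residual αs f′ v)
      ≤⟨ 𝔼.ap-mono pointwise ⟩
    𝔼 (λ v → 2ℚ * (residual αs f v * residual αs f v) + 2ℚ * (residual αs g v * residual αs g v))
      ≡⟨ 𝔼.ap-combination₂ 2ℚ (λ v → residual αs f v * residual αs f v) 2ℚ (λ v → residual αs g v * residual αs g v) ⟩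
    2ℚ * ⟪ residual αs f , residual αs f ⟫ + 2ℚ * ⟪ residual αs g , residual αs g ⟫
      ≤⟨ ℚₚ.+-mono-≤ (ℚₚ.≤-reflexive (cong (2ℚ *_) (sym (deficit-idempotent αs idem f))))
          (*-monoˡ 2ℚ (ℚₚ.nonNegative⁻¹ 2ℚ) (ℚₚ.≤-trans (residual-contraction αs idem g) g²≤)) ⟩
    2ℚ * deficit αs f + 2ℚ * (𝔼 f - 𝔼 f′) ∎
    where
    open ℚₚ.≤-Reasoning
    g : Vec Ω _ → ℚ
    g v = f v - f′ v
    g²≤ : ⟪ g , g ⟫ ≤ℚ 𝔼 f - 𝔼 f′
    g²≤ = subst (⟪ g , g ⟫ ≤ℚ_) (𝔼.ap-- f f′)
      (𝔼.ap-mono (λ v → certify (lemma (g v)) (0≤* (≤⇒0≤ (f′≤f v)) (≤⇒0≤ (gap≤1 v)))))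
      where
      lemma : ∀ x → x - x * x ≡ x * (1ℚ - x)
      lemma = solve-∀ ℚ-ring
    residual-g : ∀ v → residual αs f v - residual αs g v ≡ residual αs f′ v
    residual-g v = trans (cong (λ z → residual αs f v - (g v - z)) (K.ap-- αs v f f′))
      (lemma (f v) (f′ v) (noise αs f v) (noise αs f′ v))
      where
      lemma : ∀ a b c d → a - c - (a - b - (c - d)) ≡ b - d
      lemma = solve-∀ ℚ-ring
    pointwise : ∀ v → residual αs f′ v * residual αs f′ v
      ≤ℚ 2ℚ * (residual αs f v * residual αs f v) + 2ℚ * (residual αs g v * residual αs g v)
    pointwise v = subst (λ z → z * z ≤ℚ 2ℚ * (residual αs f v * residual αs f v) + 2ℚ * (residual αs g v * residual αs g v))
      (residual-g v)
      (certify (lemma (residual αs f v) (residual αs g v)) (0≤square (residual αs f v + residual αs g v)))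
      where
      lemma : ∀ x y → (+ 2 / 1) * (x * x) + (+ 2 / 1) * (y * y) - (x - y) * (x - y) ≡ (x + y) * (x + y)
      lemma = solve-∀ ℚ-ring

-- Size bounds and the energy decrement

module Bounds (k L : ℕ) where

  open Coordinates k using (m; M)

  η : ℚ
  η = 1/suc L

  0<η : 0ℚ <ℚ η
  0<η = 0<1/suc L

  -- s pays for the coordinates of J, pivotal by definition, and 4m for the rest at a rate where the
  -- derivatives sum to at most 4.
  sumBound : ℕ → ℚ
  sumBound s = fromℕ s + m * 4ℚ

  constants : ∀ s → JuntaConstants M η (sumBound s)
  constants s = juntaConstants M η (sumBound s) 0<η
    (ℚₚ.+-mono-≤-< (0≤fromℕ s) (0<* (0<fromℕ k) (ℚₚ.positive⁻¹ 4ℚ)))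

  thresholdInverse : ∀ {s} (c : JuntaConstants M η (sumBound s)) → let open JuntaConstants c in
    ∃ λ τ⁻² → 0ℚ <ℚ τ⁻² × τ * τ * τ⁻² ≡ 1ℚ
  thresholdInverse c = recip (τ * τ) (0<* 0<τ 0<τ)
    where open JuntaConstants c using (τ; 0<τ)

  stepSize : ℕ → ℕ
  stepSize s = proj₁ (archimedean (fromℕ s + proj₁ (thresholdInverse (constants s)) * sumBound s))

  -- The sum, rather than the last size alone, is a bound whichever round the process stops in. It
  -- does not involve n.
  regularSize : ℕ → ℕ → ℕ
  regularSize zero s = stepSize s
  regularSize (suc r) s = stepSize s ℕ.+ regularSize r (stepSize s)

sum-- : ∀ n (f g : Fin n → ℚ) → sum n (λ i → f i - g i) ≡ sum n f - sum n g
sum-- n f g = trans (recover (sum n (λ i → f i - g i)) (sum n g))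
  (cong (_- sum n g) (trans (sym (sum-+ n (λ i → f i - g i) g)) (sum-cong n (λ i → restore (f i) (g i)))))
  where
  recover : ∀ x y → x ≡ x + y - y
  recover = solve-∀ ℚ-ring
  restore : ∀ x y → x - y + y ≡ x
  restore = solve-∀ ℚ-ring

term≤sum-difference : ∀ L (f g : ℕ → ℚ) → (∀ l → g l ≤ℚ f l) → ∀ l → l ≤ L →
  f l - g l ≤ℚ sum (suc L) (λ i → f (Fin.toℕ i)) - sum (suc L) (λ i → g (Fin.toℕ i))
term≤sum-difference L f g g≤f l l≤L = ℚₚ.≤-trans
  (subst (λ z → f z - g z ≤ℚ sum (suc L) (λ i → f (Fin.toℕ i) - g (Fin.toℕ i))) (Finₚ.toℕ-fromℕ< (s≤s l≤L))
    (term≤sum (suc L) {λ i → f (Fin.toℕ i) - g (Fin.toℕ i)} (λ i → ≤⇒0≤ (g≤f (Fin.toℕ i))) (Fin.fromℕ< (s≤s l≤L))))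
  (ℚₚ.≤-reflexive (sum-- (suc L) (λ i → f (Fin.toℕ i)) (λ i → g (Fin.toℕ i))))

-- Energy decrement. The energy of J adds up the densities of B + (z₀ - Z₀)^{W \ J} over the cell
-- boundaries; if enlarging J by the influential coordinates does not lower it much, then the
-- junta approximation for J survives the removal of the new coordinates from W.
module Regularity (k : ℕ) (R : Fin (suc k) → Fin (suc k) → Bool)
  (R-refl : ∀ x → R x x ≡ true)
  (R-connected : ∀ (Y : Fin (suc k) → Bool) → (∀ b x → Y b ≡ true → R b x ≡ true → Y x ≡ true) →
    ∀ x y → Y x ≡ true → Y y ≡ true)
  (L : ℕ) where

  open Bounds k L
  open Coordinates k
  open Reachability k R R-refl R-connected

  private module I (q : Rate) = Influences k R R-refl R-connected q

  -- The bound is that of `deficit-perturb`: η from the junta approximation, and η + η for the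
  -- density lost by freezing the new coordinates (one η for the rise over a cell, one for the drop
  -- at its lower boundary).
  Regular : ∀ {n} → Vec Bool n → (Vec (Fin (suc k)) n → Bool) → Rate → Set
  Regular J B q = I.deficit q (mask J) (𝟏 J B) ≤ℚ 2ℚ * η + 2ℚ * (η + η)

  module Energy {n W : ℕ} (1≤n : 1 ≤ n) (W≡4n : suc W ≡ 4 ℕ.* n) (B : Vec (Fin (suc k)) n → Bool) where

    open Grid n L W 1≤n W≡4n

    density : Vec Bool n → ℕ → ℚ
    density J l = 𝔼[ grid (l ℕ.* suc W) ] (𝟏 J B)

    abstract
      energy : Vec Bool n → ℚ
      energy J = sum (suc L) (λ l → density J (Fin.toℕ l))

      energy-def : ∀ J → energy J ≡ sum (suc L) (λ l → density J (Fin.toℕ l))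
      energy-def J = refl

    0≤density : ∀ J l → 0ℚ ≤ℚ density J l
    0≤density J l = Expectation.ap-nonneg (power (coordinate (grid (l ℕ.* suc W))) n) {𝟏 J B} (λ ω → 0≤𝟙 (reach J B ω))

    density≤1 : ∀ J l → density J l ≤ℚ 1ℚ
    density≤1 J l = Expectation.ap-≤const (power (coordinate (grid (l ℕ.* suc W))) n) {𝟏 J B} 1ℚ (λ ω → 𝟙≤1 (reach J B ω))

    density-antitone : ∀ J J′ → J ⊆ J′ → ∀ l → density J′ l ≤ℚ density J l
    density-antitone J J′ J⊆J′ l = Expectation.ap-mono (power (coordinate (grid (l ℕ.* suc W))) n) {𝟏 J′ B} {𝟏 J B}
      (𝟏-antitone J J′ J⊆J′ B)

    0≤energy : ∀ J → 0ℚ ≤ℚ energy J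
    0≤energy J = subst (0ℚ ≤ℚ_) (sym (energy-def J)) (0≤sum (suc L) (λ l → 0≤density J (Fin.toℕ l)))

    energy≤ : ∀ J → energy J ≤ℚ fromℕ (suc L) * 1ℚ
    energy≤ J = ℚₚ.≤-trans (ℚₚ.≤-reflexive (energy-def J))
      (ℚₚ.≤-trans (sum-mono (suc L) (λ l → density≤1 J (Fin.toℕ l))) (ℚₚ.≤-reflexive (sum-const (suc L) 1ℚ)))

    energy-drop : ∀ J J′ → J ⊆ J′ → ∀ l → l ≤ L → density J l - density J′ l ≤ℚ energy J - energy J′
    energy-drop J J′ J⊆J′ l l≤L = ℚₚ.≤-trans
      (term≤sum-difference L (density J) (density J′) (density-antitone J J′ J⊆J′) l l≤L)
      (ℚₚ.≤-reflexive (cong₂ _-_ (sym (energy-def J)) (sym (energy-def J′))))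

    Outcome : Vec Bool n → ℕ → Vec Bool n → Set
    Outcome J S J′ = J ⊆ J′ × ∣ J′ ∣ ≤ S × (∃ (Regular J′ B) ⊎ η ≤ℚ energy J - energy J′)

    step : ∀ s (c : JuntaConstants M η (sumBound s)) S τ⁻² → 0ℚ ≤ℚ τ⁻² →
      JuntaConstants.τ c * JuntaConstants.τ c * τ⁻² ≡ 1ℚ →
      fromℕ s + τ⁻² * sumBound s ≤ℚ fromℕ S →
      ∀ J → ∣ J ∣ ≤ s → ∃ (Outcome J S)
    step s c S τ⁻² 0≤τ⁻² ττ S-large J ∣J∣≤s =
      conclude (low-influence k (𝟏 J B) (𝟏-monotone J B) (λ ω → 0≤𝟙 (reach J B ω)) (λ ω → 𝟙≤1 (reach J B ω)))
      where
      open JuntaConstants c using (τ)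
      conclude : (∃ λ l → ∃ λ j → l ≤ L × j ≤ W
          × 𝔼[ grid (suc l ℕ.* suc W) ] (𝟏 J B) - 𝔼[ grid (l ℕ.* suc W) ] (𝟏 J B) ≤ℚ 1/suc L
          × sum n (λ i → 𝔼[ grid (j ℕ.+ l ℕ.* suc W) ] (∂ i (𝟏 J B))) ≤ℚ 4ℚ) →
        ∃ (Outcome J S)
      conclude (l , j , l≤L , j≤W , rise , low) = J′ , J⊆J′ , size , decide (density J l - density J′ l ℚₚ.≤? η)
        where
        q = grid (j ℕ.+ l ℕ.* suc W)
        J′ = enlarge J (τ * τ) (I.influence q J B)
        J⊆J′ : J ⊆ J′
        J⊆J′ = enlarge-⊇ J (τ * τ) (I.influence q J B)
        size : ∣ J′ ∣ ≤ S
        size = fromℕ-cancel (ℚₚ.≤-trans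
          (enlarge-size J (τ * τ) τ⁻² (I.influence q J B) 0≤τ⁻² ττ (I.0≤influence q J B))
          (ℚₚ.≤-trans (ℚₚ.+-mono-≤ (fromℕ-mono ∣J∣≤s)
            (*-monoˡ τ⁻² 0≤τ⁻² (I.total-influence q J B s ∣J∣≤s low))) S-large))
        above : 𝔼[ q ] (𝟏 J B) ≤ℚ 𝔼[ grid (suc l ℕ.* suc W) ] (𝟏 J B)
        above = 𝔼-monotone q (grid (suc l ℕ.* suc W))
          (gridRate-mono (ℕₚ.+-monoˡ-≤ (l ℕ.* suc W) (ℕₚ.m≤n⇒m≤1+n j≤W))) (𝟏 J B) (𝟏-monotone J B)
        below : density J′ l ≤ℚ 𝔼[ q ] (𝟏 J′ B)
        below = 𝔼-monotone (grid (l ℕ.* suc W)) q (gridRate-mono (ℕₚ.m≤n+m (l ℕ.* suc W) j)) (𝟏 J′ B) (𝟏-monotone J′ B)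
        collect : ∀ x x′ a a⁺ b η → η + η - (x - x′) ≡ (a⁺ - x) + (x′ - b) + (η - (a⁺ - a)) + (η - (a - b))
        collect = solve-∀ ℚ-ring
        -- At q the density for J is at most its value at the upper end of the cell, and that for J′
        -- at least its value at the lower end. The gap is thus at most the rise over the cell plus
        -- the drop at the lower end.
        close : density J l - density J′ l ≤ℚ η → 𝔼[ q ] (𝟏 J B) - 𝔼[ q ] (𝟏 J′ B) ≤ℚ η + η
        close drop = certify
          (collect (𝔼[ q ] (𝟏 J B)) (𝔼[ q ] (𝟏 J′ B)) (𝔼[ grid (l ℕ.* suc W) ] (𝟏 J B))
            (𝔼[ grid (suc l ℕ.* suc W) ] (𝟏 J B)) (𝔼[ grid (l ℕ.* suc W) ] (𝟏 J′ B)) η)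
          (0≤+ (0≤+ (0≤+ (≤⇒0≤ above) (≤⇒0≤ below)) (≤⇒0≤ rise)) (≤⇒0≤ drop))
        gap≤1 : ∀ ω → 𝟏 J B ω - 𝟏 J′ B ω ≤ℚ 1ℚ
        gap≤1 ω = certify (lemma (𝟏 J B ω) (𝟏 J′ B ω)) (0≤+ (≤⇒0≤ (𝟙≤1 (reach J B ω))) (0≤𝟙 (reach J′ B ω)))
          where
          lemma : ∀ x y → 1ℚ - (x - y) ≡ (1ℚ - x) + y
          lemma = solve-∀ ℚ-ring
        regular : density J l - density J′ l ≤ℚ η → Regular J′ B q
        regular drop = ℚₚ.≤-trans
          (I.deficit-perturb q (mask J′) (mask-idempotent J′) (𝟏 J B) (𝟏 J′ B) (𝟏-antitone J J′ J⊆J′ B) gap≤1)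
          (ℚₚ.+-mono-≤ (*-monoˡ 2ℚ (ℚₚ.nonNegative⁻¹ 2ℚ) (I.junta-approximation q 0<η c J B ∣J∣≤s low))
            (*-monoˡ 2ℚ (ℚₚ.nonNegative⁻¹ 2ℚ) (close drop)))
        decide : Dec (density J l - density J′ l ≤ℚ η) → ∃ (Regular J′ B) ⊎ η ≤ℚ energy J - energy J′
        decide (yes drop) = inj₁ (q , regular drop)
        decide (no ¬drop) = inj₂ (ℚₚ.≤-trans (ℚₚ.<⇒≤ (ℚₚ.≰⇒> ¬drop)) (energy-drop J J′ J⊆J′ l l≤L))

  enlargement : ∀ s {n W} (1≤n : 1 ≤ n) (W≡4n : suc W ≡ 4 ℕ.* n) B J → ∣ J ∣ ≤ s →
    ∃ (Energy.Outcome 1≤n W≡4n B J (stepSize s))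
  enlargement s 1≤n W≡4n B = Energy.step 1≤n W≡4n B s (constants s) (stepSize s) (proj₁ inverse)
    (ℚₚ.<⇒≤ (proj₁ (proj₂ inverse))) (proj₂ (proj₂ inverse))
    (proj₂ (archimedean (fromℕ s + proj₁ inverse * sumBound s)))
    where inverse = thresholdInverse (constants s)

  regularity : ∀ r s {n W} (1≤n : 1 ≤ n) (W≡4n : suc W ≡ 4 ℕ.* n) B J → ∣ J ∣ ≤ s →
    Energy.energy 1≤n W≡4n B J ≤ℚ fromℕ r * η →
    ∃ λ J′ → J ⊆ J′ × ∣ J′ ∣ ≤ regularSize r s × ∃ (Regular J′ B)
  regularity r s 1≤n W≡4n B J ∣J∣≤s bound = continue r bound (enlargement s 1≤n W≡4n B J ∣J∣≤s)
    where
    open Energy 1≤n W≡4n B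
    S = stepSize s
    lemma₀ : ∀ x y η → 0ℚ - η ≡ (0ℚ * η - x) + y + (x - y - η)
    lemma₀ = solve-∀ ℚ-ring
    lemma₁ : ∀ x y η r → r * η - y ≡ ((1ℚ + r) * η - x) + (x - y - η)
    lemma₁ = solve-∀ ℚ-ring
    continue : ∀ r → energy J ≤ℚ fromℕ r * η → ∃ (Outcome J S) →
      ∃ λ J′ → J ⊆ J′ × ∣ J′ ∣ ≤ regularSize r s × ∃ (Regular J′ B)
    continue zero bound (J′ , J⊆J′ , size , inj₁ regular) = J′ , J⊆J′ , size , regular
    -- With no rounds left the energy of J is at most 0, and a further drop would make that of J′
    -- negative.
    continue zero bound (J′ , J⊆J′ , size , inj₂ drop) = ⊥-elim (ℚₚ.<-irrefl refl (ℚₚ.<-≤-trans 0<η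
      (certify (lemma₀ (energy J) (energy J′) η)
        (0≤+ (0≤+ (≤⇒0≤ (subst (λ z → energy J ≤ℚ z * η) (fromℕ-def 0) bound)) (0≤energy J′)) (≤⇒0≤ drop)))))
    continue (suc r) bound (J′ , J⊆J′ , size , inj₁ regular) =
      J′ , J⊆J′ , ℕₚ.≤-trans size (ℕₚ.m≤m+n S (regularSize r S)) , regular
    continue (suc r) bound (J′ , J⊆J′ , size , inj₂ drop) = extend
      (regularity r S 1≤n W≡4n B J′ size
        (certify (lemma₁ (energy J) (energy J′) η (fromℕ r))
          (0≤+ (≤⇒0≤ (subst (λ z → energy J ≤ℚ z * η) (fromℕ-suc r) bound)) (≤⇒0≤ drop))))
      where
      extend : (∃ λ J″ → J′ ⊆ J″ × ∣ J″ ∣ ≤ regularSize r S × ∃ (Regular J″ B)) →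
        ∃ λ J″ → J ⊆ J″ × ∣ J″ ∣ ≤ S ℕ.+ regularSize r S × ∃ (Regular J″ B)
      extend (J″ , J′⊆J″ , size′ , regular) =
        J″ , (λ i e → J′⊆J″ i (J⊆J′ i e)) , ℕₚ.≤-trans size′ (ℕₚ.m≤n+m (regularSize r S) S) , regular

  -- The energy starts at no more than L + 1 and each failed round costs η = 1/(L + 1), whence (L +
  -- 1)² rounds.
  regularity-lemma : ∀ {n} → 1 ≤ n → ∀ B (J : Vec Bool n) → ∣ J ∣ ≤ 1 →
    ∃ λ J′ → J ⊆ J′ × ∣ J′ ∣ ≤ regularSize (suc L ℕ.* suc L) 1 × ∃ (Regular J′ B)
  regularity-lemma {suc n} 1≤n B J ∣J∣≤1 = regularity (suc L ℕ.* suc L) 1 1≤n refl B J ∣J∣≤1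
    (ℚₚ.≤-trans (Energy.energy≤ 1≤n refl B J) (ℚₚ.≤-reflexive total))
    where
    total : fromℕ (suc L) * 1ℚ ≡ fromℕ (suc L ℕ.* suc L) * η
    total = trans (cong (fromℕ (suc L) *_) (sym (suc*1/suc L)))
      (trans (sym (ℚₚ.*-assoc (fromℕ (suc L)) (fromℕ (suc L)) η)) (cong (_* η) (sym (fromℕ-* (suc L) (suc L)))))

-- From a regular J to the pair of sets on J

merge : ∀ {A : Set} {n} → Vec Bool n → Vec A n → Vec A n → Vec A n
merge [] [] [] = []
merge (true ∷ J) (a ∷ v) (b ∷ w) = a ∷ merge J v w
merge (false ∷ J) (a ∷ v) (b ∷ w) = b ∷ merge J v w

lookup-merge-in : ∀ {A : Set} {n} (J : Vec Bool n) (v w : Vec A n) i → lookup J i ≡ true →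
  lookup (merge J v w) i ≡ lookup v i
lookup-merge-in (true ∷ J) (a ∷ v) (b ∷ w) zero e = refl
lookup-merge-in (true ∷ J) (a ∷ v) (b ∷ w) (suc i) e = lookup-merge-in J v w i e
lookup-merge-in (false ∷ J) (a ∷ v) (b ∷ w) (suc i) e = lookup-merge-in J v w i e

lookup-merge-out : ∀ {A : Set} {n} (J : Vec Bool n) (v w : Vec A n) i → lookup J i ≡ false →
  lookup (merge J v w) i ≡ lookup w i
lookup-merge-out (false ∷ J) (a ∷ v) (b ∷ w) zero e = refl
lookup-merge-out (true ∷ J) (a ∷ v) (b ∷ w) (suc i) e = lookup-merge-out J v w i e
lookup-merge-out (false ∷ J) (a ∷ v) (b ∷ w) (suc i) e = lookup-merge-out J v w i e

Agree : ∀ {A : Set} {n} → Vec Bool n → Vec A n → Vec A n → Set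
Agree J x y = ∀ i → lookup J i ≡ true → lookup x i ≡ lookup y i

points : ∀ {A B : Set} {n} → Vec (A × B) n → Vec B n
points = Vec.map proj₂

-- In the application `A y b` says y + b ∈ Z₀ and σ x = z₀ - x, so the step relation `A (σ x) b`
-- says x ∈ b + z₀ - Z₀.
module Structure (k : ℕ) (A : Fin (suc k) → Fin (suc k) → Bool) (σ : Fin (suc k) → Fin (suc k))
  (σ-invariant : ∀ g → Expectation.ap (uniform k) (g ∘ σ) ≡ Expectation.ap (uniform k) g)
  (R-refl : ∀ x → A (σ x) x ≡ true)
  (R-connected : ∀ (Y : Fin (suc k) → Bool) → (∀ b x → Y b ≡ true → A (σ x) b ≡ true → Y x ≡ true) →
    ∀ x y → Y x ≡ true → Y y ≡ true)
  (q : Rate) where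

  open Influences k (λ b x → A (σ x) b) R-refl R-connected q public

  private
    module P = Expectation (coordinate q)
    module 𝔼 {n} = Expectation (𝔼ₙ n)

  noise-mask : ∀ {n} (J : Vec Bool n) f (v : Vec Ω n) → noise (mask J) f v ≡ 𝔼 (λ w → f (merge J v w))
  noise-mask [] f [] = refl
  noise-mask (true ∷ J) f (a ∷ v) = trans
    (lemma (noise (mask J) (λ w → f (a ∷ w)) v) (P.ap (λ b → noise (mask J) (λ w → f (b ∷ w)) v)))
    (trans (noise-mask J (λ w → f (a ∷ w)) v) (sym (P.ap-const (𝔼 (λ w → f (a ∷ merge J v w))))))
    where
    lemma : ∀ x y → 1ℚ * x + (1ℚ - 1ℚ) * y ≡ x
    lemma = solve-∀ ℚ-ring
  noise-mask (false ∷ J) f (a ∷ v) = trans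
    (lemma (noise (mask J) (λ w → f (a ∷ w)) v) (P.ap (λ b → noise (mask J) (λ w → f (b ∷ w)) v)))
    (P.ap-cong (λ b → noise-mask J (λ w → f (b ∷ w)) v))
    where
    lemma : ∀ x y → 0ℚ * x + (1ℚ - 0ℚ) * y ≡ y
    lemma = solve-∀ ℚ-ring

  reflect : ∀ {n} → Vec Ω n → Vec Ω n
  reflect = Vec.map (λ a → proj₁ a , σ (proj₂ a))

  𝔼-reflect : ∀ {n} (f : Vec Ω n → ℚ) → 𝔼 (f ∘ reflect) ≡ 𝔼 f
  𝔼-reflect {zero} f = refl
  𝔼-reflect {suc n} f = trans
    (P.ap-cong (λ a → 𝔼-reflect (λ v → f ((proj₁ a , σ (proj₂ a)) ∷ v))))
    (cong₂ (λ x y → rate q * x + (1ℚ - rate q) * y)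
      (σ-invariant (λ x → 𝔼 (λ v → f ((true , x) ∷ v)))) (σ-invariant (λ x → 𝔼 (λ v → f ((false , x) ∷ v)))))

  point-points : ∀ {n} (ω : Vec Ω n) i → lookup (points ω) i ≡ point ω i
  point-points ω i = Vecₚ.lookup-map i proj₂ ω

  base : ∀ {n} → Vec (Fin (suc k)) n → Vec Ω n
  base = Vec.map (false ,_)

  points-base : ∀ {n} (x : Vec (Fin (suc k)) n) → points (base x) ≡ x
  points-base [] = refl
  points-base (a ∷ x) = cong (a ∷_) (points-base x)

  module _ {n} (J : Vec Bool n) (B : Vec (Fin (suc k)) n → Bool) where

    -- Bits on J are ignored because no coordinate of J is free. Hence the junta depends on group
    -- elements only and defines a subset of G^J.
    𝟏-local : ∀ ω ω′ → Agree J (points ω) (points ω′) → ∀ w → 𝟏 J B (merge J ω w) ≡ 𝟏 J B (merge J ω′ w)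
    𝟏-local ω ω′ agree w = cong 𝟙 (bool-antisym (reach J B (merge J ω w)) (reach J B (merge J ω′ w))
      (transfer ω ω′ agree) (transfer ω′ ω (λ i e → sym (agree i e))))
      where
      transfer : ∀ ω ω′ → Agree J (points ω) (points ω′) →
        reach J B (merge J ω w) ≡ true → reach J B (merge J ω′ w) ≡ true
      transfer ω ω′ agree r with reach-sound J B (merge J ω w) r
      ... | b , Bb , steps = reach-complete J B (merge J ω′ w) (b , Bb , λ i → at i (lookup J i) refl (steps i))
        where
        at : ∀ i j → lookup J i ≡ j → Step (free J (merge J ω w) i) (lookup b i) (point (merge J ω w) i) →
          Step (free J (merge J ω′ w) i) (lookup b i) (point (merge J ω′ w) i)
        at i true e s = subst (λ z → Step (not z ∧ proj₁ (lookup (merge J ω′ w) i)) (lookup b i) (point (merge J ω′ w) i))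
          (sym e) (trans (subst (λ z → Step (not z ∧ proj₁ (lookup (merge J ω w) i)) (lookup b i) (point (merge J ω w) i)) e s)
            (trans (cong proj₂ (lookup-merge-in J ω w i e)) (trans (sym (point-points ω i)) (trans (agree i e)
              (trans (point-points ω′ i) (cong proj₂ (sym (lookup-merge-in J ω′ w i e))))))))
        at i false e s = subst (λ z → Step (not (lookup J i) ∧ proj₁ z) (lookup b i) (proj₂ z))
          (trans (lookup-merge-out J ω w i e) (sym (lookup-merge-out J ω′ w i e))) s

    ψ : Vec Ω n → ℚ
    ψ = noise (mask J) (𝟏 J B)

    ψ-local : ∀ ω ω′ → Agree J (points ω) (points ω′) → ψ ω ≡ ψ ω′
    ψ-local ω ω′ agree = trans (noise-mask J (𝟏 J B) ω)
      (trans (𝔼.ap-cong (𝟏-local ω ω′ agree)) (sym (noise-mask J (𝟏 J B) ω′)))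

    0≤ψ : ∀ ω → 0ℚ ≤ℚ ψ ω
    0≤ψ ω = subst (0ℚ ≤ℚ_) (sym (noise-mask J (𝟏 J B) ω)) (𝔼.ap-nonneg (λ w → 0≤𝟏 J B (merge J ω w)))

    ψ≤1 : ∀ ω → ψ ω ≤ℚ 1ℚ
    ψ≤1 ω = subst (_≤ℚ 1ℚ) (sym (noise-mask J (𝟏 J B) ω)) (𝔼.ap-≤const 1ℚ (λ w → 𝟏≤1 J B (merge J ω w)))

    -- `ψ` is the conditional probability of the reached set given the coordinates in J: its mean is
    -- that of the indicator, which is its own square, and ‖ψ‖² = ⟨𝟏, ψ⟩.
    𝔼ψ[1-ψ] : 𝔼 (λ ω → ψ ω * (1ℚ - ψ ω)) ≡ deficit (mask J) (𝟏 J B)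
    𝔼ψ[1-ψ] = trans (𝔼.ap-cong (λ ω → expand (ψ ω)))
      (trans (𝔼.ap-- ψ (λ ω → ψ ω * ψ ω))
        (cong₂ _-_ (trans (𝔼-noise (mask J) (𝟏 J B)) (𝔼.ap-cong (λ ω → sym (𝟙-idempotent (reach J B ω)))))
          (trans (noise-isometry (mask J) (𝟏 J B)) (cong (λ z → ⟪ 𝟏 J B , noise z (𝟏 J B) ⟫) (mask-idempotent J)))))
      where
      expand : ∀ x → x * (1ℚ - x) ≡ x - x * x
      expand = solve-∀ ℚ-ring

    module _ (ε : ℚ) where

      -- The bits supplied by `base` are placeholders, as `ψ` does not see them.
      large : Vec (Fin (suc k)) n → Bool
      large u = does ((1ℚ - ε) ℚₚ.≤? ψ (base u))

      large-local : ∀ x y → Agree J x y → large x ≡ large y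
      large-local x y agree = cong (λ z → does ((1ℚ - ε) ℚₚ.≤? z)) (ψ-local (base x) (base y)
        (λ i e → trans (cong (λ z → lookup z i) (points-base x))
          (trans (agree i e) (cong (λ z → lookup z i) (sym (points-base y))))))

      bad? : ∀ y → Dec (∃ λ u → large u ≡ true × (∀ i → lookup J i ≡ true → A (lookup y i) (lookup u i) ≡ true))
      bad? y = searchVec (λ u → (large u Boolₚ.≟ true)
        ×-dec Finₚ.all? (λ i → (lookup J i Boolₚ.≟ true) →-dec (A (lookup y i) (lookup u i) Boolₚ.≟ true)))

      bad : Vec (Fin (suc k)) n → Bool
      bad y = does (bad? y)

      bad-transfer : ∀ x y → Agree J x y → bad x ≡ true → bad y ≡ true
      bad-transfer x y agree e = dec-true (bad? y) (move (dec-sound (bad? x) e))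
        where
        move : (∃ λ u → large u ≡ true × (∀ i → lookup J i ≡ true → A (lookup x i) (lookup u i) ≡ true)) →
          ∃ λ u → large u ≡ true × (∀ i → lookup J i ≡ true → A (lookup y i) (lookup u i) ≡ true)
        move (u , Lu , adj) = u , Lu , λ i Ji → subst (λ z → A z (lookup u i) ≡ true) (agree i Ji) (adj i Ji)

      bad-local : ∀ x y → Agree J x y → bad x ≡ bad y
      bad-local x y agree = bool-antisym (bad x) (bad y) (bad-transfer x y agree)
        (bad-transfer y x (λ i e → sym (agree i e)))

      agree-merge : ∀ ω w → Agree J (points (merge J ω w)) (points ω)
      agree-merge ω w i e = trans (point-points (merge J ω w) i)
        (trans (cong proj₂ (lookup-merge-in J ω w i e)) (sym (point-points ω i)))

      noise-local : ∀ (χ : Vec (Fin (suc k)) n → ℚ) → (∀ x y → Agree J x y → χ x ≡ χ y) →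
        ∀ ω → noise (mask J) (χ ∘ points) ω ≡ χ (points ω)
      noise-local χ local ω = trans (noise-mask J (χ ∘ points) ω)
        (trans (𝔼.ap-cong (λ w → local (points (merge J ω w)) (points ω) (agree-merge ω w)))
          (𝔼.ap-const {n} (χ (points ω))))

      B⊆reach : ∀ ω → B (points ω) ≡ true → reach J B ω ≡ true
      B⊆reach ω e = reach-complete J B ω (points ω , e , λ i →
        subst (λ z → Step (free J ω i) z (point ω i)) (sym (point-points ω i)) (step-refl (free J ω i) (point ω i)))

      small : Vec (Fin (suc k)) n → ℚ
      small x = 𝟙 (not (large x))

      threshold : ∀ p → 0ℚ ≤ℚ p → p ≤ℚ 1ℚ → (d : Dec (1ℚ - ε ≤ℚ p)) → ε * (p * 𝟙 (not (does d))) ≤ℚ p * (1ℚ - p)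
      threshold p 0≤p p≤1 (yes _) = certify (lemma ε p) (0≤* 0≤p (≤⇒0≤ p≤1))
        where
        lemma : ∀ ε p → p * (1ℚ - p) - ε * (p * 0ℚ) ≡ p * (1ℚ - p)
        lemma = solve-∀ ℚ-ring
      threshold p 0≤p p≤1 (no p≱) = certify (lemma ε p) (0≤* 0≤p (≤⇒0≤ (ℚₚ.<⇒≤ (ℚₚ.≰⇒> p≱))))
        where
        lemma : ∀ ε p → p * (1ℚ - p) - ε * (p * 1ℚ) ≡ p * ((1ℚ - ε) - p)
        lemma = solve-∀ ℚ-ring

      -- B lies in the reached set. As `small` depends on J only, the projection may be moved from
      -- it to the indicator, which becomes `ψ`; and where ψ < 1 - ε, ε·ψ ≤ ψ(1 - ψ).
      B-defect : 0ℚ ≤ℚ ε → ε * 𝔼 (λ ω → 𝟙 (B (points ω) ∧ not (large (points ω)))) ≤ℚ deficit (mask J) (𝟏 J B)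
      B-defect 0≤ε = begin
        ε * 𝔼 (λ ω → 𝟙 (B (points ω) ∧ not (large (points ω))))
          ≤⟨ *-monoˡ ε 0≤ε (𝔼.ap-mono (λ ω → cover ω (B (points ω)) refl)) ⟩
        ε * ⟪ 𝟏 J B , small ∘ points ⟫
          ≡⟨ cong (ε *_) (⟪⟫-congʳ (𝟏 J B) (λ ω → sym (noise-local small (λ x y a → cong (𝟙 ∘ not) (large-local x y a)) ω))) ⟩
        ε * ⟪ 𝟏 J B , noise (mask J) (small ∘ points) ⟫
          ≡⟨ cong (ε *_) (noise-symmetric (mask J) (𝟏 J B) (small ∘ points)) ⟩
        ε * ⟪ ψ , small ∘ points ⟫
          ≡⟨ 𝔼.ap-* ε (λ ω → ψ ω * small (points ω)) ⟨
        𝔼 (λ ω → ε * (ψ ω * small (points ω)))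
          ≤⟨ 𝔼.ap-mono below ⟩
        𝔼 (λ ω → ψ ω * (1ℚ - ψ ω))
          ≡⟨ 𝔼ψ[1-ψ] ⟩
        deficit (mask J) (𝟏 J B) ∎
        where
        open ℚₚ.≤-Reasoning
        cover : ∀ ω b → B (points ω) ≡ b → 𝟙 (b ∧ not (large (points ω))) ≤ℚ 𝟏 J B ω * small (points ω)
        cover ω true e = ℚₚ.≤-reflexive (sym (trans (cong (λ z → 𝟙 z * small (points ω)) (B⊆reach ω e))
          (ℚₚ.*-identityˡ (small (points ω)))))
        cover ω false e = 0≤* (0≤𝟏 J B ω) (0≤𝟙 (not (large (points ω))))
        below : ∀ ω → ε * (ψ ω * small (points ω)) ≤ℚ ψ ω * (1ℚ - ψ ω)
        below ω = subst (λ z → ε * (z * small (points ω)) ≤ℚ z * (1ℚ - z))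
          (ψ-local (base (points ω)) ω (λ i e → cong (λ z → lookup z i) (points-base (points ω))))
          (threshold (ψ (base (points ω))) (0≤ψ (base (points ω))) (ψ≤1 (base (points ω)))
            ((1ℚ - ε) ℚₚ.≤? ψ (base (points ω))))

      -- Reflecting the free coordinates by σ turns E into a set disjoint from the one reached from B.
      E-defect : 0ℚ ≤ℚ ε → (E : Vec (Fin (suc k)) n → Bool) →
        (∀ y b → E y ≡ true → B b ≡ true → ¬ (∀ i → A (lookup y i) (lookup b i) ≡ true)) →
        𝔼 (λ ω → 𝟙 (E (points ω) ∧ bad (points ω))) ≤ℚ ε
      E-defect 0≤ε E avoid = begin
        𝔼 (λ ω → 𝟙 (E (points ω) ∧ bad (points ω)))
          ≡⟨ 𝔼.ap-cong (λ ω → 𝟙-∧ (E (points ω)) (bad (points ω))) ⟩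
        ⟪ e , β ∘ points ⟫
          ≡⟨ ⟪⟫-congʳ e (λ ω → sym (noise-local β (λ x y a → cong 𝟙 (bad-local x y a)) ω)) ⟩
        ⟪ e , noise (mask J) (β ∘ points) ⟫
          ≡⟨ noise-symmetric (mask J) e (β ∘ points) ⟩
        ⟪ noise (mask J) e , β ∘ points ⟫
          ≤⟨ 𝔼.ap-≤const ε (λ ω → cases ω (bad? (points ω))) ⟩
        ε ∎
        where
        open ℚₚ.≤-Reasoning
        𝟙-∧ : ∀ b c → 𝟙 (b ∧ c) ≡ 𝟙 b * 𝟙 c
        𝟙-∧ true c = sym (ℚₚ.*-identityˡ (𝟙 c))
        𝟙-∧ false c = sym (ℚₚ.*-zeroˡ (𝟙 c))
        e : Vec Ω n → ℚ
        e ω = 𝟙 (E (points ω))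
        β : Vec (Fin (suc k)) n → ℚ
        β y = 𝟙 (bad y)
        Witness : Vec Ω n → Vec (Fin (suc k)) n → Set
        Witness ω u = large u ≡ true × (∀ i → lookup J i ≡ true → A (lookup (points ω) i) (lookup u i) ≡ true)
        -- A b reaching the point equals u on J, where `adj` applies. Outside J each step from b to
        -- x says that σ x and b are related by `A`; an unmoved coordinate is covered by `R-refl`.
        -- So b and the reflected point contradict `avoid`.
        disjoint : ∀ ω u → Witness ω u → ∀ w → E (points (merge J ω (reflect w))) ≡ true →
          ¬ (∃ (Reaches J B (merge J (base u) w)))
        disjoint ω u (_ , adj) w Ey (b , Bb , steps) = avoid (points (merge J ω (reflect w))) b Ey Bb
          (λ i → subst (λ z → A z (lookup b i) ≡ true) (sym (point-points (merge J ω (reflect w)) i))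
            (at i (lookup J i) refl (steps i)))
          where
          free-step : ∀ s {b x} → Step s b x → A (σ x) b ≡ true
          free-step true p = p
          free-step false {b} p = subst (λ z → A (σ z) b ≡ true) p (R-refl b)
          at : ∀ i j → lookup J i ≡ j → Step (free J (merge J (base u) w) i) (lookup b i) (point (merge J (base u) w) i) →
            A (point (merge J ω (reflect w)) i) (lookup b i) ≡ true
          at i true Ji s = trans (cong₂ A
              (trans (cong proj₂ (lookup-merge-in J ω (reflect w) i Ji)) (sym (point-points ω i)))
              (trans (subst (λ z → Step (not z ∧ proj₁ (lookup (merge J (base u) w) i)) (lookup b i) (point (merge J (base u) w) i)) Ji s)
                (trans (cong proj₂ (lookup-merge-in J (base u) w i Ji))
                  (cong proj₂ (Vecₚ.lookup-map i (false ,_) u)))))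
            (adj i Ji)
          at i false Ji s = trans (cong (λ z → A z (lookup b i))
              (trans (cong proj₂ (lookup-merge-out J ω (reflect w) i Ji))
                (trans (cong proj₂ (Vecₚ.lookup-map i (λ a → proj₁ a , σ (proj₂ a)) w))
                  (cong (σ ∘ proj₂) (sym (lookup-merge-out J (base u) w i Ji))))))
            (free-step (free J (merge J (base u) w) i) s)
        complement : ∀ b (d : Dec (∃ (Reaches J B b))) c → (c ≡ true → ¬ (∃ (Reaches J B b))) → 𝟙 c ≤ℚ 1ℚ - 𝟙 (does d)
        complement b (yes p) true h = ⊥-elim (h refl p)
        complement b (no _) true h = ℚₚ.≤-refl
        complement b d false h = ≤⇒0≤ (𝟙≤1 (does d))
        few : ∀ ω → ∃ (Witness ω) → noise (mask J) e ω ≤ℚ ε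
        few ω (u , wit) = begin
          noise (mask J) e ω
            ≡⟨ noise-mask J e ω ⟩
          𝔼 (λ w → e (merge J ω w))
            ≡⟨ 𝔼-reflect (λ w → e (merge J ω w)) ⟨
          𝔼 (λ w → e (merge J ω (reflect w)))
            ≤⟨ 𝔼.ap-mono (λ w → complement (merge J (base u) w) (reaches? J B (merge J (base u) w))
                (E (points (merge J ω (reflect w)))) (disjoint ω u wit w)) ⟩
          𝔼 (λ w → 1ℚ - 𝟏 J B (merge J (base u) w))
            ≡⟨ 𝔼.ap-- {n} (λ _ → 1ℚ) (λ w → 𝟏 J B (merge J (base u) w)) ⟩
          𝔼 {n} (λ _ → 1ℚ) - 𝔼 (λ w → 𝟏 J B (merge J (base u) w))
            ≡⟨ cong₂ _-_ (𝔼.ap-const {n} 1ℚ) (sym (noise-mask J (𝟏 J B) (base u))) ⟩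
          1ℚ - ψ (base u)
            ≤⟨ certify (swap ε (ψ (base u))) (≤⇒0≤ (dec-sound ((1ℚ - ε) ℚₚ.≤? ψ (base u)) (proj₁ wit))) ⟩
          ε ∎
          where
          swap : ∀ ε x → ε - (1ℚ - x) ≡ x - (1ℚ - ε)
          swap = solve-∀ ℚ-ring
        cases : ∀ ω (d : Dec (∃ (Witness ω))) → noise (mask J) e ω * 𝟙 (does d) ≤ℚ ε
        cases ω (yes p) = ℚₚ.≤-trans (ℚₚ.≤-reflexive (ℚₚ.*-identityʳ (noise (mask J) e ω))) (few ω p)
        cases ω (no _) = ℚₚ.≤-trans (ℚₚ.≤-reflexive (ℚₚ.*-zeroʳ (noise (mask J) e ω))) 0≤ε

-- Stabilisers and the strict coset hypothesis

private module Sum = SumProperties ℚₚ.+-0-commutativeMonoid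

sum≡library : ∀ n (f : Fin n → ℚ) → sum n f ≡ Sum.sum f
sum≡library zero f = refl
sum≡library (suc n) f = cong (λ z → f zero + z) (sum≡library n (f ∘ suc))

sum-permute : ∀ n (f : Fin n → ℚ) (π π⁻¹ : Fin n → Fin n) → (∀ x → π (π⁻¹ x) ≡ x) → (∀ x → π⁻¹ (π x) ≡ x) →
  sum n (f ∘ π) ≡ sum n f
sum-permute n f π π⁻¹ r l = trans (sum≡library n (f ∘ π))
  (trans (sym (Sum.sum-permute f (Perm.permutation π π⁻¹ r l))) (sym (sum≡library n f)))

-- The nonnegative terms g i - f i sum to 0. Through this lemma the finiteness of G closes
-- stabilisers under inverses.
sum-rigid : ∀ n (f g : Fin n → ℚ) → (∀ i → f i ≤ℚ g i) → sum n f ≡ sum n g → ∀ i → g i ≤ℚ f i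
sum-rigid n f g f≤g e i = certify (flip (f i) (g i))
  (≤⇒0≤ (ℚₚ.≤-trans (term≤sum n {λ i → g i - f i} (λ i → ≤⇒0≤ (f≤g i)) i)
    (ℚₚ.≤-reflexive (trans (sum-- n g f) (trans (cong (λ z → sum n g - z) e) (ℚₚ.+-inverseʳ (sum n g)))))))
  where
  flip : ∀ x y → x - y ≡ 0ℚ - (y - x)
  flip = solve-∀ ℚ-ring

𝟙-reflects-≤ : ∀ b c → 𝟙 b ≤ℚ 𝟙 c → b ≡ true → c ≡ true
𝟙-reflects-≤ true true p e = refl
𝟙-reflects-≤ true false p e = ⊥-elim (ℚₚ.<-irrefl refl (ℚₚ.<-≤-trans 0<1 p))

module Translation (k : ℕ) (_⊕_ : Fin (suc k) → Fin (suc k) → Fin (suc k)) (e : Fin (suc k))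
  (⊝ : Fin (suc k) → Fin (suc k)) (G : IsAbelianGroup _≡_ _⊕_ e ⊝) where

  open IsAbelianGroup G using (assoc; comm; identityˡ; identityʳ; inverseˡ; inverseʳ)

  cancel-left : ∀ a b → ⊝ a ⊕ (a ⊕ b) ≡ b
  cancel-left a b = trans (sym (assoc (⊝ a) a b)) (trans (cong (_⊕ b) (inverseˡ a)) (identityˡ b))

  cancel-right : ∀ a b → (a ⊕ ⊝ b) ⊕ b ≡ a
  cancel-right a b = trans (assoc a (⊝ b) b) (trans (cong (a ⊕_) (inverseˡ b)) (identityʳ a))

  cancel-right′ : ∀ a b → (a ⊕ b) ⊕ ⊝ b ≡ a
  cancel-right′ a b = trans (assoc a b (⊝ b)) (trans (cong (a ⊕_) (inverseʳ b)) (identityʳ a))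

  reflection-involutive : ∀ z x → z ⊕ ⊝ (z ⊕ ⊝ x) ≡ x
  reflection-involutive z x = trans (comm z (⊝ w)) (trans (cong (⊝ w ⊕_) (sym (cancel-right z x))) (cancel-left w x))
    where w = z ⊕ ⊝ x

  uniform-invariant : ∀ z (g : Fin (suc k) → ℚ) →
    Expectation.ap (uniform k) (λ x → g (z ⊕ ⊝ x)) ≡ Expectation.ap (uniform k) g
  uniform-invariant z g = cong (1/suc k *_) (sum-permute (suc k) g (λ x → z ⊕ ⊝ x) (λ x → z ⊕ ⊝ x)
    (reflection-involutive z) (reflection-involutive z))

  module _ (Y : Fin (suc k) → Bool) where

    stable? : ∀ h → Dec (∀ b → Y b ≡ true → Y (b ⊕ h) ≡ true)
    stable? h = Finₚ.all? (λ b → (Y b Boolₚ.≟ true) →-dec (Y (b ⊕ h) Boolₚ.≟ true))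

    stabiliser : Fin (suc k) → Bool
    stabiliser h = does (stable? h)

    stable : ∀ h → stabiliser h ≡ true → ∀ b → Y b ≡ true → Y (b ⊕ h) ≡ true
    stable h = dec-sound (stable? h)

    stabilise : ∀ h → (∀ b → Y b ≡ true → Y (b ⊕ h) ≡ true) → stabiliser h ≡ true
    stabilise h s = dec-true (stable? h) s

    -- Y + h ⊆ Y forces Y + h = Y, both having the same size.
    stable-reflect : ∀ h → stabiliser h ≡ true → ∀ b → Y (b ⊕ h) ≡ true → Y b ≡ true
    stable-reflect h s b = 𝟙-reflects-≤ (Y (b ⊕ h)) (Y b)
      (sum-rigid (suc k) (λ b → 𝟙 (Y b)) (λ b → 𝟙 (Y (b ⊕ h))) (λ b → 𝟙-mono (Y b) (Y (b ⊕ h)) (stable h s b))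
        (sym (sum-permute (suc k) (λ b → 𝟙 (Y b)) (_⊕ h) (_⊕ ⊝ h) (λ x → cancel-right x h) (λ x → cancel-right′ x h))) b)

    stabiliser-subgroup : IsSubgroup _⊕_ e ⊝ stabiliser
    stabiliser-subgroup =
      stabilise e (λ b Yb → subst (λ z → Y z ≡ true) (sym (identityʳ b)) Yb)
      , (λ a b sa sb → stabilise (a ⊕ b) (λ c Yc → subst (λ z → Y z ≡ true) (assoc c a b) (stable b sb (c ⊕ a) (stable a sa c Yc))))
      , (λ a sa → stabilise (⊝ a) (λ c Yc → stable-reflect a sa (c ⊕ ⊝ a) (subst (λ z → Y z ≡ true) (sym (cancel-right c a)) Yc)))

  -- Closure of Y puts z₀ - Z₀ into its stabiliser H, so Z₀ lies in H + z₀. As this is not a strict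
  -- coset, H = G, and a translation-invariant Y is empty or everything.
  connected : ∀ (Z₀ : Fin (suc k) → Bool) z₀ → ¬ InStrictCoset _⊕_ e ⊝ Z₀ →
    ∀ (Y : Fin (suc k) → Bool) → (∀ b x → Y b ≡ true → Z₀ ((z₀ ⊕ ⊝ x) ⊕ b) ≡ true → Y x ≡ true) →
    ∀ x y → Y x ≡ true → Y y ≡ true
  connected Z₀ z₀ not-coset Y closed x y Yx = subst (λ z → Y z ≡ true) shift
    (stable Y (⊝ x ⊕ y) (everything (⊝ x ⊕ y)) x Yx)
    where
    shift : x ⊕ (⊝ x ⊕ y) ≡ y
    shift = trans (sym (assoc x (⊝ x) y)) (trans (cong (_⊕ y) (inverseʳ x)) (identityˡ y))
    subgroup = stabiliser-subgroup Y
    recover : ∀ z b → (z₀ ⊕ ⊝ (b ⊕ (z₀ ⊕ ⊝ z))) ⊕ b ≡ z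
    recover z b = begin
      (z₀ ⊕ ⊝ w) ⊕ b            ≡⟨ cong (_⊕ b) (comm z₀ (⊝ w)) ⟩
      (⊝ w ⊕ z₀) ⊕ b            ≡⟨ assoc (⊝ w) z₀ b ⟩
      ⊝ w ⊕ (z₀ ⊕ b)            ≡⟨ cong (⊝ w ⊕_) (comm z₀ b) ⟩
      ⊝ w ⊕ (b ⊕ z₀)            ≡⟨ cong (λ t → ⊝ w ⊕ (b ⊕ t)) (cancel-right z₀ z) ⟨
      ⊝ w ⊕ (b ⊕ ((z₀ ⊕ ⊝ z) ⊕ z)) ≡⟨ cong (⊝ w ⊕_) (assoc b (z₀ ⊕ ⊝ z) z) ⟨
      ⊝ w ⊕ (w ⊕ z)             ≡⟨ cancel-left w z ⟩
      z                         ∎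
      where
      open ≡-Reasoning
      w = b ⊕ (z₀ ⊕ ⊝ z)
    difference : ∀ z → Z₀ z ≡ true → stabiliser Y (z₀ ⊕ ⊝ z) ≡ true
    difference z Zz = stabilise Y (z₀ ⊕ ⊝ z) (λ b Yb →
      closed b (b ⊕ (z₀ ⊕ ⊝ z)) Yb (subst (λ t → Z₀ t ≡ true) (sym (recover z b)) Zz))
    coset : ∀ z → Z₀ z ≡ true → ∃ λ h → stabiliser Y h ≡ true × z ≡ h ⊕ z₀
    coset z Zz = ⊝ (z₀ ⊕ ⊝ z) , proj₂ (proj₂ subgroup) (z₀ ⊕ ⊝ z) (difference z Zz)
      , sym (trans (cong (⊝ (z₀ ⊕ ⊝ z) ⊕_) (sym (cancel-right z₀ z))) (cancel-left (z₀ ⊕ ⊝ z) z))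
    everything : ∀ g → stabiliser Y g ≡ true
    everything g = Boolₚ.¬-not (λ f → not-coset (stabiliser Y , subgroup , (g , f) , (z₀ , coset)))

-- Counting, and passage between vectors and functions

-- Taken from `allVecs`, because a second empty function could be told apart by a predicate on
-- functions: extensionality is not assumed. Thus `canonical` produces exactly the functions that
-- `card` enumerates.
origin : ∀ m → Vecᴳ m 0
origin m = Data.List.lookup (allVecs m 0) zero

canonical : ∀ {m n} → Vec (Fin m) n → Vecᴳ m n
canonical [] = origin _
canonical (a ∷ v) = consF a (canonical v)

canonical-lookup : ∀ {m n} (v : Vec (Fin m) n) i → canonical v i ≡ lookup v i
canonical-lookup (a ∷ v) zero = refl
canonical-lookup (a ∷ v) (suc i) = canonical-lookup v i

count : ∀ {A : Set} → (A → Bool) → List A → ℚ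
count S xs = fromℕ (length (filterᵇ S xs))

count-++ : ∀ {A : Set} (S : A → Bool) xs ys → count S (xs Data.List.++ ys) ≡ count S xs + count S ys
count-++ S xs ys = trans (cong (fromℕ ∘ length) (Listₚ.filter-++ (Boolₚ.T? ∘ S) xs ys))
  (trans (cong fromℕ (Listₚ.length-++ (filterᵇ S xs))) (fromℕ-+ (length (filterᵇ S xs)) (length (filterᵇ S ys))))

count-map : ∀ {A B : Set} (S : B → Bool) (h : A → B) xs → count S (map h xs) ≡ count (S ∘ h) xs
count-map S h xs = cong fromℕ (lengths xs)
  where
  lengths : ∀ xs → length (filterᵇ S (map h xs)) ≡ length (filterᵇ (S ∘ h) xs)
  lengths [] = refl
  lengths (x ∷ xs) with S (h x)
  ... | true = cong suc (lengths xs)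
  ... | false = lengths xs

count-concatMap : ∀ {A B : Set} (S : B → Bool) (h : A → List B) n (g : Fin n → A) →
  count S (concatMap h (Data.List.tabulate g)) ≡ sum n (λ i → count S (h (g i)))
count-concatMap S h zero g = fromℕ-def 0
count-concatMap S h (suc n) g = trans (count-++ S (h (g zero)) (concatMap h (Data.List.tabulate (g ∘ suc))))
  (cong (λ z → count S (h (g zero)) + z) (count-concatMap S h n (g ∘ suc)))

module Counting (k : ℕ) (q : Rate) where

  open Coordinates k

  -- S ignores the bits, so at every rate the expectation is the normalised count; `mixture` removes
  -- the bit of each coordinate.
  card-𝔼 : ∀ n (S : Vecᴳ (suc k) n → Bool) →
    fromℕ (card (suc k) n S) ≡ fromℕ (suc k ^ n) * 𝔼[ q ] (λ ω → 𝟙 (S (canonical (points ω))))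
  card-𝔼 zero S with S (origin (suc k))
  ... | true = trans (fromℕ-def 1) (sym (trans (cong (_* 1ℚ) (fromℕ-def 1)) (ℚₚ.*-identityʳ 1ℚ)))
  ... | false = trans (fromℕ-def 0) (sym (ℚₚ.*-zeroʳ (fromℕ 1)))
  card-𝔼 (suc n) S = begin
    count S (concatMap (λ a → map (consF a) (allVecs (suc k) n)) (allFin (suc k)))
      ≡⟨ count-concatMap S (λ a → map (consF a) (allVecs (suc k) n)) (suc k) (λ a → a) ⟩
    sum (suc k) (λ a → count S (map (consF a) (allVecs (suc k) n)))
      ≡⟨ sum-cong (suc k) (λ a → trans (count-map S (consF a) (allVecs (suc k) n)) (card-𝔼 n (S ∘ consF a))) ⟩
    sum (suc k) (λ a → N * slice a)
      ≡⟨ sum-* (suc k) N slice ⟩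
    N * sum (suc k) slice
      ≡⟨ cong (N *_) average ⟨
    N * (m * U.ap slice)
      ≡⟨ regroup N m (U.ap slice) ⟩
    m * N * U.ap slice
      ≡⟨ cong₂ _*_ (sym (fromℕ-* (suc k) (suc k ^ n))) (mixture (rate q) (U.ap slice)) ⟩
    fromℕ (suc k ^ suc n) * 𝔼[ q ] (λ ω → 𝟙 (S (canonical (points ω)))) ∎
    where
    open ≡-Reasoning
    N = fromℕ (suc k ^ n)
    slice : Fin (suc k) → ℚ
    slice a = 𝔼[ q ] (λ ω → 𝟙 (S (consF a (canonical (points ω)))))
    average : m * U.ap slice ≡ sum (suc k) slice
    average = trans (sym (ℚₚ.*-assoc m (1/suc k) (sum (suc k) slice)))
      (trans (cong (_* sum (suc k) slice) (suc*1/suc k)) (ℚₚ.*-identityˡ (sum (suc k) slice)))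
    regroup : ∀ x y z → x * (y * z) ≡ y * x * z
    regroup = solve-∀ ℚ-ring
    mixture : ∀ q x → x ≡ q * x + (1ℚ - q) * x
    mixture = solve-∀ ℚ-ring

  card-≤ : ∀ n (S : Vecᴳ (suc k) n → Bool) ε → 𝔼[ q ] (λ ω → 𝟙 (S (canonical (points ω)))) ≤ℚ ε →
    (+ card (suc k) n S) / 1 ≤ℚ ε * ((+ (suc k ^ n)) / 1)
  card-≤ n S ε p = subst (λ x → x ≤ℚ ε * ((+ (suc k ^ n)) / 1)) (fromℕ-def (card (suc k) n S))
    (subst (λ x → fromℕ (card (suc k) n S) ≤ℚ ε * x) (fromℕ-def (suc k ^ n))
      (ℚₚ.≤-trans (ℚₚ.≤-reflexive (card-𝔼 n S))
        (ℚₚ.≤-trans (*-monoˡ (fromℕ (suc k ^ n)) (0≤fromℕ (suc k ^ n)) p)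
          (ℚₚ.≤-reflexive (ℚₚ.*-comm (fromℕ (suc k ^ n)) ε)))))

-- The value `zero` outside I is an arbitrary default: extensions are passed only to predicates that
-- depend on the coordinates in I.
extendAt : ∀ {k n} (I : Subset n) → Vecᴵ (suc k) I → ∀ i → Dec (i ∈ₛ I) → Fin (suc k)
extendAt I y i (yes p) = y (i , p)
extendAt I y i (no _) = zero

extend : ∀ {k n} (I : Subset n) → Vecᴵ (suc k) I → Vec (Fin (suc k)) n
extend I y = tabulate (λ i → extendAt I y i (i Subsetₚ.∈? I))

extend-restrict : ∀ {k n} (I : Subset n) (v : Vec (Fin (suc k)) n) → Agree I (extend I (restrict I (canonical v))) v
extend-restrict I v i e = trans (Vecₚ.lookup∘tabulate _ i) (at (i Subsetₚ.∈? I))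
  where
  at : (d : Dec (i ∈ₛ I)) → extendAt I (restrict I (canonical v)) i d ≡ lookup v i
  at (yes _) = canonical-lookup v i
  at (no i∉I) = ⊥-elim (i∉I (Vecₚ.lookup⇒[]= i I e))

extend-pair : ∀ {k n} (I : Subset n) (a b : Vecᴵ (suc k) I) (Q : Fin (suc k) → Fin (suc k) → Set) →
  (∀ j → Q (a j) (b j)) → ∀ i → lookup I i ≡ true → Q (lookup (extend I a) i) (lookup (extend I b) i)
extend-pair I a b Q q i e = subst (λ z → Q z (lookup (extend I b) i)) (sym (Vecₚ.lookup∘tabulate _ i))
  (subst (Q (extendAt I a i (i Subsetₚ.∈? I))) (sym (Vecₚ.lookup∘tabulate _ i)) (at (i Subsetₚ.∈? I)))
  where
  at : (d : Dec (i ∈ₛ I)) → Q (extendAt I a i d) (extendAt I b i d)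
  at (yes p) = q (i , p)
  at (no i∉I) = ⊥-elim (i∉I (Vecₚ.lookup⇒[]= i I e))

member⇒0<∣∣ : ∀ {n} (I : Subset n) i → lookup I i ≡ true → 0 < ∣ I ∣
member⇒0<∣∣ I i e = ℕₚ.≤-<-trans z≤n (Subsetₚ.x∈p⇒∣p-x∣<∣p∣ (Vecₚ.lookup⇒[]= i I e))

-- Assembling the theorem

Goal : ∀ m → (Fin m → Fin m → Fin m) → ℚ → ℕ → ∀ n → (Fin m → Bool) → (E F : Vecᴳ m n → Bool) → Set
Goal m _⊕_ ε C n Z₀ E F = Σ (Subset n) λ I → (0 < ∣ I ∣ × ∣ I ∣ < C)
  × Σ (Vecᴵ m I → Bool) λ E′ → Σ (Vecᴵ m I → Bool) λ F′ →
    ((+ card m n (λ x → E x ∧ not (E′ (restrict I x)))) / 1 ≤ℚ ε * ((+ (m ^ n)) / 1))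
    × ((+ card m n (λ x → F x ∧ not (F′ (restrict I x)))) / 1 ≤ℚ ε * ((+ (m ^ n)) / 1))
    × SumAvoids _⊕_ E′ F′ Z₀

-- The junta pair in terms of vectors: E′ is the complement of bad and F′ is large.
Approximation : ∀ k → (Fin (suc k) → Fin (suc k) → Bool) → ℚ → ℕ → ∀ n → (E B : Vec (Fin (suc k)) n → Bool) → Set
Approximation k A ε S n E B = Σ (Subset n) λ J → (0 < ∣ J ∣ × ∣ J ∣ ≤ S)
  × Σ (Vec (Fin (suc k)) n → Bool) λ large → Σ (Vec (Fin (suc k)) n → Bool) λ bad → Σ Rate λ q →
    (∀ x y → Agree J x y → large x ≡ large y)
    × (∀ x y → Agree J x y → bad x ≡ bad y)
    × 𝔼[ q ] (λ ω → 𝟙 (B (points ω) ∧ not (large (points ω)))) ≤ℚ ε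
    × 𝔼[ q ] (λ ω → 𝟙 (E (points ω) ∧ bad (points ω))) ≤ℚ ε
    × (∀ y u → large u ≡ true → (∀ i → lookup J i ≡ true → A (lookup y i) (lookup u i) ≡ true) → bad y ≡ true)
  where open Coordinates k

-- The left side, 6η, is the bound in `Regular`; the target is ε² because `B-defect` controls only ε
-- times the defect. Any L ≥ 6/ε² works.
fineness : ∀ ε → 0ℚ <ℚ ε → ∃ λ L → 2ℚ * 1/suc L + 2ℚ * (1/suc L + 1/suc L) ≤ℚ ε * ε
fineness ε 0<ε = choose (recip (ε * ε) (0<* 0<ε 0<ε))
  where
  six : ℚ → ℚ
  six w = w + w + (w + w) + (w + w)
  bound : ∀ e w L → 0ℚ ≤ℚ e → e * w ≡ 1ℚ → six w ≤ℚ fromℕ L →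
    2ℚ * 1/suc L + 2ℚ * (1/suc L + 1/suc L) ≤ℚ e
  bound e w L 0≤e ew w≤L = begin
    2ℚ * η + 2ℚ * (η + η)      ≡⟨ collect η ⟩
    six 1ℚ * η                 ≡⟨ cong (λ z → six z * η) ew ⟨
    six (e * w) * η            ≡⟨ regroup e w η ⟩
    e * η * six w              ≤⟨ *-monoˡ (e * η) (0≤* 0≤e 0≤η) w≤L ⟩
    e * η * fromℕ L            ≤⟨ certify (next e η (fromℕ L)) (0≤* 0≤e 0≤η) ⟩
    e * ((1ℚ + fromℕ L) * η)   ≡⟨ cong (λ z → e * (z * η)) (fromℕ-suc L) ⟨
    e * (fromℕ (suc L) * η)    ≡⟨ cong (e *_) (suc*1/suc L) ⟩
    e * 1ℚ                     ≡⟨ ℚₚ.*-identityʳ e ⟩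
    e                          ∎
    where
    open ℚₚ.≤-Reasoning
    η = 1/suc L
    0≤η : 0ℚ ≤ℚ η
    0≤η = ℚₚ.<⇒≤ (0<1/suc L)
    collect : ∀ η → (+ 2 / 1) * η + (+ 2 / 1) * (η + η) ≡ (1ℚ + 1ℚ + (1ℚ + 1ℚ) + (1ℚ + 1ℚ)) * η
    collect = solve-∀ ℚ-ring
    regroup : ∀ e w η → (e * w + e * w + (e * w + e * w) + (e * w + e * w)) * η ≡ e * η * (w + w + (w + w) + (w + w))
    regroup = solve-∀ ℚ-ring
    next : ∀ e η l → e * ((1ℚ + l) * η) - e * η * l ≡ e * η
    next = solve-∀ ℚ-ring
  choose : (∃ λ w → 0ℚ <ℚ w × ε * ε * w ≡ 1ℚ) → ∃ λ L → 2ℚ * 1/suc L + 2ℚ * (1/suc L + 1/suc L) ≤ℚ ε * ε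
  choose (w , _ , ww) = proj₁ (archimedean (six w)) ,
    bound (ε * ε) w (proj₁ (archimedean (six w))) (0≤square ε) ww (proj₂ (archimedean (six w)))

module Approximate (k : ℕ) (A : Fin (suc k) → Fin (suc k) → Bool) (σ : Fin (suc k) → Fin (suc k))
  (σ-invariant : ∀ g → Expectation.ap (uniform k) (g ∘ σ) ≡ Expectation.ap (uniform k) g)
  (R-refl : ∀ x → A (σ x) x ≡ true)
  (R-connected : ∀ (Y : Fin (suc k) → Bool) → (∀ b x → Y b ≡ true → A (σ x) b ≡ true → Y x ≡ true) →
    ∀ x y → Y x ≡ true → Y y ≡ true)
  (ε : ℚ) (0<ε : 0ℚ <ℚ ε) (L : ℕ) (fine : 2ℚ * 1/suc L + 2ℚ * (1/suc L + 1/suc L) ≤ℚ ε * ε) where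

  open Bounds k L using (regularSize)
  open Regularity k (λ b x → A (σ x) b) R-refl R-connected L using (Regular; regularity-lemma)

  approximate : ∀ n → 1 ≤ n → (E B : Vec (Fin (suc k)) n → Bool) →
    (∀ y b → E y ≡ true → B b ≡ true → ¬ (∀ i → A (lookup y i) (lookup b i) ≡ true)) →
    Approximation k A ε (regularSize (suc L ℕ.* suc L) 1) n E B
  approximate (suc n) 1≤n E B avoid = conclude
    -- Starting from a singleton instead of the empty set ensures |J| > 0.
    (regularity-lemma 1≤n B ⁅ zero ⁆ (ℕₚ.≤-reflexive (Subsetₚ.∣⁅x⁆∣≡1 {suc n} zero)))
    where
    S = regularSize (suc L ℕ.* suc L) 1
    conclude : (∃ λ J → (∀ i → lookup ⁅ zero ⁆ i ≡ true → lookup J i ≡ true) × ∣ J ∣ ≤ S × ∃ (Regular J B)) →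
      Approximation k A ε S (suc n) E B
    conclude (J , contains , size , q , regular) = J , (member⇒0<∣∣ J zero (contains zero refl) , size)
      , large J B ε , bad J B ε , q , large-local J B ε , bad-local J B ε
      , *-cancelˡ ε 0<ε (ℚₚ.≤-trans (B-defect J B ε 0≤ε) (ℚₚ.≤-trans regular fine))
      , E-defect J B ε 0≤ε E avoid
      , λ y u Lu adj → dec-true (bad? J B ε y) (u , Lu , adj)
      where
      open Structure k A σ σ-invariant R-refl R-connected q
        using (large; bad; bad?; large-local; bad-local; B-defect; E-defect)
      0≤ε : 0ℚ ≤ℚ ε
      0≤ε = ℚₚ.<⇒≤ 0<ε

quarter : Rate
quarter = record { rate = ¼ ; ¼≤rate = ℚₚ.≤-refl ; rate≤¾ = 0≤⇒≤ (ℚₚ.nonNegative⁻¹ (¾ - ¼)) }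

-- For empty Z₀ there is no z₀ to translate by, but a single coordinate with both sets full already
-- avoids Z₀.
goal-no-differences : ∀ k _⊕_ ε S n → 0ℚ <ℚ ε → 1 ≤ n → (Z₀ : Fin (suc k) → Bool) → (∀ z → ¬ (Z₀ z ≡ true)) →
  ∀ E F → Goal (suc k) _⊕_ ε (suc (suc S)) n Z₀ E F
goal-no-differences k _⊕_ ε S (suc n) 0<ε 1≤n Z₀ empty E F =
  ⁅ zero ⁆ , (subst (0 <_) (sym one) (s≤s z≤n) , subst (_< suc (suc S)) (sym one) (s≤s (s≤s z≤n)))
  , (λ _ → true) , (λ _ → true) , none E , none F
  , (λ { (a , b , _ , _ , Zab) → empty _ (Zab (zero , here)) })
  where
  one : ∣ ⁅ zero {n} ⁆ ∣ ≡ 1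
  one = Subsetₚ.∣⁅x⁆∣≡1 {suc n} zero
  none : ∀ E → (+ card (suc k) (suc n) (λ x → E x ∧ not true)) / 1 ≤ℚ ε * ((+ (suc k ^ suc n)) / 1)
  none E = Counting.card-≤ k quarter (suc n) (λ x → E x ∧ not true) ε
    (Expectation.ap-≤const (power (Coordinates.coordinate k quarter) (suc n)) ε
      (λ ω → subst (λ z → 𝟙 z ≤ℚ ε) (sym (Boolₚ.∧-zeroʳ (E (canonical (points ω))))) (ℚₚ.<⇒≤ 0<ε)))

goal-from-approximation : ∀ k _⊕_ ε S n (Z₀ : Fin (suc k) → Bool) E F →
  Approximation k (λ y b → Z₀ (y ⊕ b)) ε S n (E ∘ canonical) (F ∘ canonical) →
  Goal (suc k) _⊕_ ε (suc (suc S)) n Z₀ E F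
goal-from-approximation k _⊕_ ε S n Z₀ E F
  (J , (nonempty , size) , large , bad , q , large-local , bad-local , B-defect , E-defect , excluded) =
  J , (nonempty , ℕₚ.m≤n⇒m≤1+n (s≤s size)) , E′ , F′
  , Counting.card-≤ k q n (λ x → E x ∧ not (E′ (restrict J x))) ε
      (subst (_≤ℚ ε) (𝔼-cong (λ ω → E-agree (points ω))) E-defect)
  , Counting.card-≤ k q n (λ x → F x ∧ not (F′ (restrict J x))) ε
      (subst (_≤ℚ ε) (𝔼-cong (λ ω → F-agree (points ω))) B-defect)
  , avoids
  where
  open Coordinates k
  𝔼-cong : ∀ {f g : Vec Ω n → ℚ} → (∀ ω → f ω ≡ g ω) → 𝔼[ q ] f ≡ 𝔼[ q ] g
  𝔼-cong = Expectation.ap-cong (power (coordinate q) n)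
  E′ F′ : Vecᴵ (suc k) J → Bool
  E′ y = not (bad (extend J y))
  F′ u = large (extend J u)
  E-agree : ∀ v → 𝟙 (E (canonical v) ∧ bad v) ≡ 𝟙 (E (canonical v) ∧ not (E′ (restrict J (canonical v))))
  E-agree v = cong (λ z → 𝟙 (E (canonical v) ∧ z)) (sym (trans
    (Boolₚ.not-involutive (bad (extend J (restrict J (canonical v)))))
    (bad-local (extend J (restrict J (canonical v))) v (extend-restrict J v))))
  F-agree : ∀ v → 𝟙 (F (canonical v) ∧ not (large v)) ≡ 𝟙 (F (canonical v) ∧ not (F′ (restrict J (canonical v))))
  F-agree v = cong (λ z → 𝟙 (F (canonical v) ∧ not z))
    (sym (large-local (extend J (restrict J (canonical v))) v (extend-restrict J v)))
  avoids : SumAvoids _⊕_ E′ F′ Z₀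
  avoids (a , b , E′a , F′b , Zab) = contradict (bad (extend J a)) E′a
    (excluded (extend J a) (extend J b) F′b
      (extend-pair J a b (λ x y → Z₀ (x ⊕ y) ≡ true) Zab))
    where
    contradict : ∀ c → not c ≡ true → c ≡ true → ⊥
    contradict true () _
    contradict false _ ()

theorem1p2 : (m : ℕ) (_⊕_ : Fin m → Fin m → Fin m) (e : Fin m) (⊝ : Fin m → Fin m)
    → IsAbelianGroup _≡_ _⊕_ e ⊝
    → (ε : ℚ) → 0ℚ <ℚ ε
    → ∃ λ (C : ℕ) → ∀ (n : ℕ) → 1 ≤ n
    → (Z₀ : Fin m → Bool) → ¬ InStrictCoset _⊕_ e ⊝ Z₀
    → (E F : Vecᴳ m n → Bool) → SumAvoids _⊕_ E F Z₀
    → Σ (Subset n) λ I → (0 < ∣ I ∣ × ∣ I ∣ < C)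
    × Σ (Vecᴵ m I → Bool) λ E′ → Σ (Vecᴵ m I → Bool) λ F′ →
    ((+ card m n (λ x → E x ∧ not (E′ (restrict I x)))) / 1 ≤ℚ ε * ((+ (m ^ n)) / 1))
    × ((+ card m n (λ x → F x ∧ not (F′ (restrict I x)))) / 1 ≤ℚ ε * ((+ (m ^ n)) / 1))
    × SumAvoids _⊕_ E′ F′ Z₀
theorem1p2 zero _⊕_ () ⊝ G ε 0<ε
theorem1p2 (suc k) _⊕_ e ⊝ G ε 0<ε = build (fineness ε 0<ε)
  where
  open Translation k _⊕_ e ⊝ G
  build : (∃ λ L → 2ℚ * 1/suc L + 2ℚ * (1/suc L + 1/suc L) ≤ℚ ε * ε) →
    ∃ λ C → ∀ n → 1 ≤ n → (Z₀ : Fin (suc k) → Bool) → ¬ InStrictCoset _⊕_ e ⊝ Z₀ →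
      (E F : Vecᴳ (suc k) n → Bool) → SumAvoids _⊕_ E F Z₀ → Goal (suc k) _⊕_ ε C n Z₀ E F
  -- One `suc` makes the bound on |I| strict; the other lets the singleton of the empty case fit
  -- whatever S is.
  build (L , fine) = suc (suc S) , λ n 1≤n Z₀ not-coset E F avoid →
    decide n 1≤n Z₀ not-coset E F avoid (Finₚ.any? (λ z → Z₀ z Boolₚ.≟ true))
    where
    S = Bounds.regularSize k L (suc L ℕ.* suc L) 1
    decide : ∀ n → 1 ≤ n → (Z₀ : Fin (suc k) → Bool) → ¬ InStrictCoset _⊕_ e ⊝ Z₀ →
      (E F : Vecᴳ (suc k) n → Bool) → SumAvoids _⊕_ E F Z₀ → Dec (∃ λ z → Z₀ z ≡ true) →
      Goal (suc k) _⊕_ ε (suc (suc S)) n Z₀ E F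
    decide n 1≤n Z₀ not-coset E F avoid (no empty) =
      goal-no-differences k _⊕_ ε S n 0<ε 1≤n Z₀ (λ z Zz → empty (z , Zz)) E F
    decide n 1≤n Z₀ not-coset E F avoid (yes (z₀ , Z₀z₀)) = goal-from-approximation k _⊕_ ε S n Z₀ E F
      (Approximate.approximate k (λ y b → Z₀ (y ⊕ b)) (λ x → z₀ ⊕ ⊝ x) (uniform-invariant z₀)
        (λ x → subst (λ t → Z₀ t ≡ true) (sym (cancel-right z₀ x)) Z₀z₀)
        (connected Z₀ z₀ not-coset) ε 0<ε L fine n 1≤n (E ∘ canonical) (F ∘ canonical)
        (λ y b Ey Fb Zyb → avoid (canonical y , canonical b , Ey , Fb , λ i →
          subst (λ t → Z₀ t ≡ true) (sym (cong₂ _⊕_ (canonical-lookup y i) (canonical-lookup b i))) (Zyb i))))
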